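{- For $G\sim\mathcal G_{n,1/2}$, with probability at least $1-1/\mathrm{poly}(n)$, any allocation is a $\left(1+O\left(\sqrt{\ln(n)/n}\right)\right)$-approximation. That is, there are absolute constants $C,c>0$ such that for all sufficiently large $n$, with probability at least $1-n^{ -c}$ over $G\sim\mathcal G_{n,1/2}$, for every multiset $H$ of $n$ nonnegative real house values and every allocation $\pi$ for the instance $(G,H)$, $$\mathrm{Envy}(\pi,G)\le\left(1+C\sqrt{\ln(n)/n}\right)\min_{\pi'}\mathrm{Envy}(\pi',G).$$
   Context: $\mathcal G_{n,1/2}$ is the Erdős–Rényi random graph on $n$ vertices in which each edge is present independently with probability $1/2$. An instance of Graphical House Allocation is a pair $(G,H)$, where $G=(V,E)$ is an undirected simple graph on $n$ vertices and $H=\{h_1,\dots,h_n\}$ is a multiset of nonnegative real numbers. An allocation is a bijection $\pi:V\to H$ (counting multiplicity). Its envy is $\mathrm{Envy}(\pi,G)=\sum_{(i,j)\in E}|\pi(i)-\pi(j)|$; minima are over all allocations for $(G,H)$. -}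

module Defs where

open import Algebra.Bundles using (CommutativeRing)
import Algebra.Properties.CommutativeSemiring.Exp as CExp
import Algebra.Properties.Semiring.Exp as SExp
open import Data.Bool.Base using (Bool; true; false; T; if_then_else_)
open import Data.Bool.Properties using (T?)
open import Data.Fin.Base as Fin using (Fin; zero; suc; punchIn)
import Data.Fin.Properties as FinP
open import Data.Fin.Permutation as Perm using (Permutation′; _⟨$⟩ʳ_)
import Data.Integer.Base as ℤ
open import Data.Integer.Base using (+_; -[1+_]; +[1+_]; +0)
import Data.Integer.Properties as ℤP
open import Data.List.Base using (List; []; _∷_; map; foldr; filter; allFin; cartesianProduct; cartesianProductWith)
open import Data.List.Membership.Propositional using (_∈_)
open import Data.List.Membership.Propositional.Properties using (∈-cartesianProductWith⁺; ∈-allFin)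
open import Data.List.Relation.Unary.Any using (here)
open import Data.Nat.Base as ℕ using (ℕ; zero; suc; _∸_)
open import Data.Nat.Coprimality using (Coprime)
import Data.Nat.DivMod as ℕD
import Data.Nat.Properties as ℕP
open import Data.Product.Base using (Σ-syntax; ∃-syntax; _×_; _,_; proj₁; proj₂)
open import Data.Rational.Base
open import Data.Rational.Properties
open import Data.Rational.Solver using (module +-*-Solver)
import Data.Rational.Unnormalised.Base as ℚᵘ
import Data.Rational.Unnormalised.Properties as ℚᵘP
open import Data.Sum.Base using (inj₁; inj₂)
open import Data.Unit.Base using (⊤; tt)
open import Data.Vec.Base using (Vec; []; _∷_; lookup)
open import Relation.Binary.PropositionalEquality
open import Relation.Nullary using (yes; no)
open import Relation.Nullary.Decidable using (_×-dec_)

open import Algebra.Definitions.RawSemiring +-*-rawSemiring using (_^_)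
open CommutativeRing +-*-commutativeRing using (commutativeSemiring; semiring)
open +-*-Solver using (solve; _:=_; _:+_; _:*_; _:-_; :-_; con)

infix 9 1/1+_

ι : ℕ → ℚ
ι n = + n / 1

1/1+_ : ℕ → ℚ
1/1+ k = + 1 / suc k

0≤ι : ∀ n → 0ℚ ≤ ι n
0≤ι n = nonNegative⁻¹ (ι n) {{normalize-nonNeg n 1}}

0<1/1+ : ∀ k → 0ℚ < 1/1+ k
0<1/1+ k = positive⁻¹ (1/1+ k) {{normalize-pos 1 (suc k)}}

0≤1/1+ : ∀ k → 0ℚ ≤ 1/1+ k
0≤1/1+ k = <⇒≤ (0<1/1+ k)

fromℚᵘ-homo-+ : ∀ p q → fromℚᵘ (p ℚᵘ.+ q) ≡ fromℚᵘ p + fromℚᵘ q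
fromℚᵘ-homo-+ p q = toℚᵘ-injective (begin-equality
  toℚᵘ (fromℚᵘ (p ℚᵘ.+ q))                ≃⟨ toℚᵘ-fromℚᵘ _ ⟩
  p ℚᵘ.+ q                                ≃⟨ ℚᵘP.+-cong (toℚᵘ-fromℚᵘ p) (toℚᵘ-fromℚᵘ q) ⟨
  toℚᵘ (fromℚᵘ p) ℚᵘ.+ toℚᵘ (fromℚᵘ q)    ≃⟨ toℚᵘ-homo-+ (fromℚᵘ p) (fromℚᵘ q) ⟨
  toℚᵘ (fromℚᵘ p + fromℚᵘ q)              ∎)
  where open ℚᵘP.≤-Reasoning

fromℚᵘ-homo-* : ∀ p q → fromℚᵘ (p ℚᵘ.* q) ≡ fromℚᵘ p * fromℚᵘ q
fromℚᵘ-homo-* p q = toℚᵘ-injective (begin-equality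
  toℚᵘ (fromℚᵘ (p ℚᵘ.* q))                ≃⟨ toℚᵘ-fromℚᵘ _ ⟩
  p ℚᵘ.* q                                ≃⟨ ℚᵘP.*-cong (toℚᵘ-fromℚᵘ p) (toℚᵘ-fromℚᵘ q) ⟨
  toℚᵘ (fromℚᵘ p) ℚᵘ.* toℚᵘ (fromℚᵘ q)    ≃⟨ toℚᵘ-homo-* (fromℚᵘ p) (fromℚᵘ q) ⟨
  toℚᵘ (fromℚᵘ p * fromℚᵘ q)              ∎)
  where open ℚᵘP.≤-Reasoning

ι-+ : ∀ a b → ι (a ℕ.+ b) ≡ ι a + ι b
ι-+ a b = trans
  (cong (_/ 1) (sym (cong₂ ℤ._+_ (ℤP.*-identityʳ (+ a)) (ℤP.*-identityʳ (+ b)))))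
  (fromℚᵘ-homo-+ (ℚᵘ.mkℚᵘ (+ a) 0) (ℚᵘ.mkℚᵘ (+ b) 0))

ι-* : ∀ a b → ι (a ℕ.* b) ≡ ι a * ι b
ι-* a b = trans (cong (_/ 1) (ℤP.pos-* a b))
  (fromℚᵘ-homo-* (ℚᵘ.mkℚᵘ (+ a) 0) (ℚᵘ.mkℚᵘ (+ b) 0))

ι-suc : ∀ a → ι (suc a) ≡ 1ℚ + ι a
ι-suc a = ι-+ 1 a

ι-inv : ∀ k → ι (suc k) * 1/1+ k ≡ 1ℚ
ι-inv k = trans (sym (fromℚᵘ-homo-* (ℚᵘ.mkℚᵘ (+ suc k) 0) (ℚᵘ.mkℚᵘ (+ 1) k)))
  (fromℚᵘ-cong {ℚᵘ.mkℚᵘ (+ suc k) 0 ℚᵘ.* ℚᵘ.mkℚᵘ (+ 1) k} {ℚᵘ.1ℚᵘ}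
    (ℚᵘ.*≡* (trans (cong (ℤ._* + 1) (ℤP.*-comm (+ suc k) (+ 1)))
      (trans (ℤP.*-identityʳ (+ 1 ℤ.* + suc k)) (cong (λ z → + 1 ℤ.* + suc z) (sym (ℕP.+-identityʳ k)))))))

≤-by : ∀ {p q e} → 0ℚ ≤ e → q ≡ p + e → p ≤ q
≤-by {p} {q} {e} 0≤e eq = subst₂ _≤_ (+-identityʳ p) (sym eq) (+-monoʳ-≤ p 0≤e)

0≤q-p : ∀ {p q} → p ≤ q → 0ℚ ≤ q - p
0≤q-p {p} {q} p≤q = subst (_≤ q - p) (+-inverseʳ p) (+-monoˡ-≤ (- p) p≤q)

0≤+ : ∀ {p q} → 0ℚ ≤ p → 0ℚ ≤ q → 0ℚ ≤ p + q
0≤+ 0≤p 0≤q = +-mono-≤ 0≤p 0≤q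

0≤* : ∀ {p q} → 0ℚ ≤ p → 0ℚ ≤ q → 0ℚ ≤ p * q
0≤* {p} {q} 0≤p 0≤q = nonNegative⁻¹ (p * q)
  {{nonNeg*nonNeg⇒nonNeg p {{nonNegative 0≤p}} q {{nonNegative 0≤q}}}}

0<* : ∀ {p q} → 0ℚ < p → 0ℚ < q → 0ℚ < p * q
0<* {p} {q} 0<p 0<q = positive⁻¹ (p * q)
  {{pos*pos⇒pos p {{positive 0<p}} q {{positive 0<q}}}}

0≤p² : ∀ p → 0ℚ ≤ p * p
0≤p² p with ≤-total 0ℚ p
... | inj₁ 0≤p = 0≤* 0≤p 0≤p
... | inj₂ p≤0 = subst (0ℚ ≤_) (solve 1 (λ p → :- p :* :- p := p :* p) refl p)
  (0≤* (neg-antimono-≤ p≤0) (neg-antimono-≤ p≤0))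

*-mono-≤ : ∀ {a b c d} → 0ℚ ≤ b → 0ℚ ≤ c → a ≤ b → c ≤ d → a * c ≤ b * d
*-mono-≤ {a} {b} {c} {d} 0≤b 0≤c a≤b c≤d = ≤-trans
  (*-monoʳ-≤-nonNeg c {{nonNegative 0≤c}} a≤b)
  (*-monoˡ-≤-nonNeg b {{nonNegative 0≤b}} c≤d)

*-cancel-≤ : ∀ {p q} r → 0ℚ < r → p * r ≤ q * r → p ≤ q
*-cancel-≤ r 0<r = *-cancelʳ-≤-pos r {{positive 0<r}}

ι-mono : ∀ {a b} → a ℕ.≤ b → ι a ≤ ι b
ι-mono {a} {b} a≤b = ≤-by (0≤ι (b ℕ.∸ a))
  (trans (cong ι (sym (ℕP.m+[n∸m]≡n a≤b))) (ι-+ a (b ℕ.∸ a)))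

0<ι : ∀ n → 0ℚ < ι (suc n)
0<ι n = positive⁻¹ (ι (suc n)) {{normalize-pos (suc n) 1}}

cross-≤ : ∀ K L m k → K ℕ.* suc k ℕ.≤ L ℕ.* suc m → ι K * 1/1+ m ≤ ι L * 1/1+ k
cross-≤ K L m k le = *-cancel-≤ (ι (suc m) * ι (suc k)) (0<* (0<ι m) (0<ι k))
  (subst₂ _≤_
    (trans (ι-* K (suc k)) (sym (trans
      (solve 4 (λ a b c d → (a :* b) :* (c :* d) := (a :* d) :* (c :* b)) refl (ι K) (1/1+ m) (ι (suc m)) (ι (suc k)))
      (trans (cong (ι K * ι (suc k) *_) (ι-inv m)) (*-identityʳ _)))))
    (trans (ι-* L (suc m)) (sym (trans
      (solve 4 (λ a b c d → (a :* b) :* (c :* d) := (a :* c) :* (d :* b)) refl (ι L) (1/1+ k) (ι (suc m)) (ι (suc k)))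
      (trans (cong (ι L * ι (suc m) *_) (ι-inv k)) (*-identityʳ _)))))
    (ι-mono le))

1/1+-anti : ∀ {m k} → k ℕ.≤ m → 1/1+ m ≤ 1/1+ k
1/1+-anti {m} {k} k≤m = subst₂ _≤_ (*-identityˡ _) (*-identityˡ _)
  (cross-≤ 1 1 m k (ℕP.*-monoʳ-≤ 1 (ℕ.s≤s k≤m)))

num-den : ∀ n d .(c : Coprime n (suc d)) → mkℚ (+ n) d c * ι (suc d) ≡ ι n
num-den n d c = toℚᵘ-injective (begin-equality
  toℚᵘ (mkℚ (+ n) d c * ι (suc d))   ≃⟨ toℚᵘ-homo-* (mkℚ (+ n) d c) (ι (suc d)) ⟩
  ℚᵘ.mkℚᵘ (+ n) d ℚᵘ.* toℚᵘ (ι (suc d)) ≃⟨ ℚᵘP.*-cong (ℚᵘP.≃-refl {ℚᵘ.mkℚᵘ (+ n) d}) (toℚᵘ-fromℚᵘ (ℚᵘ.mkℚᵘ (+ suc d) 0)) ⟩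
  ℚᵘ.mkℚᵘ (+ n) d ℚᵘ.* ℚᵘ.mkℚᵘ (+ suc d) 0 ≃⟨ ℚᵘ.*≡* (trans (ℤP.*-assoc (+ n) (+ suc d) (+ 1)) (cong (+ n ℤ.*_) (trans (ℤP.*-identityʳ (+ suc d)) (cong (λ z → + suc z) (sym (ℕP.*-identityʳ d)))))) ⟩
  ℚᵘ.mkℚᵘ (+ n) 0 ≃⟨ toℚᵘ-fromℚᵘ (ℚᵘ.mkℚᵘ (+ n) 0) ⟨
  toℚᵘ (ι n) ∎)
  where open ℚᵘP.≤-Reasoning

arch : ∀ {ε} → 0ℚ < ε → ∃[ N ] 1/1+ N ≤ ε
arch {ε@(mkℚ +[1+ n ] d c)} _ = d , *-cancel-≤ (ι (suc d)) (0<ι d)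
  (subst₂ _≤_ (trans (sym (ι-inv d)) (*-comm (ι (suc d)) (1/1+ d))) (sym (num-den (suc n) d c)) (ι-mono {1} {suc n} (ℕ.s≤s ℕ.z≤n)))
arch {mkℚ +0 d c} (*<* (ℤ.+<+ ()))
arch {mkℚ -[1+ _ ] d c} (*<* ())

arch* : ∀ K {ε} → 0ℚ < ε → ∃[ N ] (∀ m → N ℕ.≤ m → ι K * 1/1+ m ≤ ε)
arch* K 0<ε with arch 0<ε
... | N , N≤ = K ℕ.* suc N , λ m le → ≤-trans
  (subst (ι K * 1/1+ m ≤_) (*-identityˡ _)
    (cross-≤ K 1 m N (ℕP.≤-trans le (ℕP.≤-trans (ℕP.n≤1+n m) (ℕP.≤-reflexive (sym (ℕP.*-identityˡ (suc m)))))))) N≤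

^-assocʳ : ∀ x m n → (x ^ m) ^ n ≡ x ^ (m ℕ.* n)
^-assocʳ = SExp.^-assocʳ semiring

^-distrib-* : ∀ x y n → (x * y) ^ n ≡ x ^ n * y ^ n
^-distrib-* = CExp.^-distrib-* commutativeSemiring

p≤∣p∣ : ∀ p → p ≤ ∣ p ∣
p≤∣p∣ p with ≤-total 0ℚ p
... | inj₁ 0≤p = ≤-reflexive (sym (0≤p⇒∣p∣≡p 0≤p))
... | inj₂ p≤0 = ≤-trans p≤0 (0≤∣p∣ p)

-p≤∣p∣ : ∀ p → - p ≤ ∣ p ∣
-p≤∣p∣ p = subst (- p ≤_) (∣-p∣≡∣p∣ p) (p≤∣p∣ (- p))

∣p∣≤ : ∀ {p q} → p ≤ q → - p ≤ q → ∣ p ∣ ≤ q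
∣p∣≤ {p} {q} p≤q -p≤q with ∣p∣≡p∨∣p∣≡-p p
... | inj₁ e = subst (_≤ q) (sym e) p≤q
... | inj₂ e = subst (_≤ q) (sym e) -p≤q

halves : ∀ ε → ε * ½ + ε * ½ ≡ ε
halves = solve 1 (λ e → e :* con ½ :+ e :* con ½ := e) refl

0<ε½ : ∀ {ε} → 0ℚ < ε → 0ℚ < ε * ½
0<ε½ 0<ε = 0<* 0<ε (positive⁻¹ ½)

∣p∣≤ι : ∀ p → ∃[ B ] ∣ p ∣ ≤ ι B
∣p∣≤ι p@(mkℚ n d c) = ℤ.∣ n ∣ , subst₂ _≤_ (*-identityʳ ∣ p ∣) (num-den ℤ.∣ n ∣ d c)
  (*-monoˡ-≤-nonNeg ∣ p ∣ {{∣-∣-nonNeg p}} (ι-mono {1} {suc d} (ℕ.s≤s ℕ.z≤n)))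

IsCauchy : (ℕ → ℚ) → Set
IsCauchy x = ∀ ε → 0ℚ < ε → ∃[ N ] (∀ m n → N ℕ.≤ m → N ℕ.≤ n → ∣ x m - x n ∣ ≤ ε)

-- Equivalent to IsCauchy, since m and n may be exchanged.
IsCauchy′ : (ℕ → ℚ) → Set
IsCauchy′ x = ∀ ε → 0ℚ < ε → ∃[ N ] (∀ m n → N ℕ.≤ m → N ℕ.≤ n → x m ≤ x n + ε)

move : ∀ {a b e} → a - b ≤ e → a ≤ b + e
move {a} {b} {e} le = subst (_≤ b + e)
  (solve 2 (λ a b → b :+ (a :- b) := a) refl a b) (+-monoʳ-≤ b le)

unmove : ∀ {a b e} → a ≤ b + e → a - b ≤ e
unmove {a} {b} {e} le = subst (a - b ≤_)
  (solve 2 (λ b e → (b :+ e) :- b := e) refl b e) (+-monoˡ-≤ (- b) le)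

neg-≤ : ∀ a b e → b ≤ a + e → - a ≤ - b + e
neg-≤ a b e le = begin
  - a              ≡⟨ solve 2 (λ a e → :- a := :- (a :+ e) :+ e) refl a e ⟩
  - (a + e) + e    ≤⟨ +-monoˡ-≤ e (neg-antimono-≤ le) ⟩
  - b + e          ∎
  where open ≤-Reasoning

sum-≤ : ∀ a b c d ε → a ≤ c + ε * ½ → b ≤ d + ε * ½ → a + b ≤ c + d + ε
sum-≤ a b c d ε p q = begin
  a + b                          ≤⟨ +-mono-≤ p q ⟩
  (c + ε * ½) + (d + ε * ½)      ≡⟨ solve 3 (λ c d e → (c :+ e) :+ (d :+ e) := (c :+ d) :+ (e :+ e)) refl c d (ε * ½) ⟩
  c + d + (ε * ½ + ε * ½)        ≡⟨ cong (λ z → c + d + z) (halves ε) ⟩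
  c + d + ε                      ∎
  where open ≤-Reasoning

⊓-≤ : ∀ a b c d ε → a ≤ c + ε → b ≤ d + ε → a ⊓ b ≤ c ⊓ d + ε
⊓-≤ a b c d ε p q with ⊓-sel c d
... | inj₁ e = subst (λ z → a ⊓ b ≤ z + ε) (sym e) (≤-trans (p⊓q≤p a b) p)
... | inj₂ e = subst (λ z → a ⊓ b ≤ z + ε) (sym e) (≤-trans (p⊓q≤q a b) q)

∣∣-step : ∀ a b B → ∣ a - b ∣ ≤ 1ℚ → ∣ b ∣ ≤ ι B → ∣ a ∣ ≤ ι (suc B)
∣∣-step a b B p q = begin
  ∣ a ∣                 ≡⟨ cong ∣_∣ (solve 2 (λ a b → a := (a :- b) :+ b) refl a b) ⟩
  ∣ (a - b) + b ∣       ≤⟨ ∣p+q∣≤∣p∣+∣q∣ (a - b) b ⟩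
  ∣ a - b ∣ + ∣ b ∣     ≤⟨ +-mono-≤ p q ⟩
  1ℚ + ι B              ≡⟨ ι-suc B ⟨
  ι (suc B)             ∎
  where open ≤-Reasoning

prod-≤ : ∀ a b c d δ ε B C → 0ℚ ≤ δ → ∣ a ∣ ≤ ι B → ∣ d ∣ ≤ ι C → ∣ a - c ∣ ≤ δ → ∣ b - d ∣ ≤ δ →
         ι (B ℕ.+ C) * δ ≤ ε → a * b ≤ c * d + ε
prod-≤ a b c d δ ε B C 0≤δ a≤B d≤C p q r = move (begin
  a * b - c * d                              ≡⟨ solve 4 (λ a b c d → a :* b :- c :* d := a :* (b :- d) :+ (a :- c) :* d) refl a b c d ⟩
  a * (b - d) + (a - c) * d                  ≤⟨ +-mono-≤ (p≤∣p∣ (a * (b - d))) (p≤∣p∣ ((a - c) * d)) ⟩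
  ∣ a * (b - d) ∣ + ∣ (a - c) * d ∣          ≡⟨ cong₂ _+_ (∣p*q∣≡∣p∣*∣q∣ a (b - d)) (∣p*q∣≡∣p∣*∣q∣ (a - c) d) ⟩
  ∣ a ∣ * ∣ b - d ∣ + ∣ a - c ∣ * ∣ d ∣      ≤⟨ +-mono-≤ (*-mono-≤ (0≤ι B) (0≤∣p∣ (b - d)) a≤B q) (*-mono-≤ 0≤δ (0≤∣p∣ d) p d≤C) ⟩
  ι B * δ + δ * ι C                          ≡⟨ solve 3 (λ b c d → b :* d :+ d :* c := (b :+ c) :* d) refl (ι B) (ι C) δ ⟩
  (ι B + ι C) * δ                            ≡⟨ cong (_* δ) (ι-+ B C) ⟨
  ι (B ℕ.+ C) * δ                            ≤⟨ r ⟩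
  ε                                          ∎)
  where open ≤-Reasoning

cauchy⇐ : ∀ x → IsCauchy′ x → IsCauchy x
cauchy⇐ x c ε 0<ε = let N , h = c ε 0<ε in N , λ m n m≥ n≥ → ∣p∣≤ (unmove (h m n m≥ n≥))
  (subst (_≤ ε) (solve 2 (λ a b → b :- a := :- (a :- b)) refl (x m) (x n)) (unmove (h n m n≥ m≥)))

-- Reals are Cauchy sequences of rationals carrying a modulus, compared by _≤ℝ_ rather than
-- by identity of sequences.
record ℝ : Set where
  constructor mkℝ
  field
    seq    : ℕ → ℚ
    cauchy : IsCauchy seq

open ℝ public

one-sided : ∀ x → IsCauchy′ (seq x)
one-sided x ε 0<ε =
  let N , h = cauchy x ε 0<ε
  in N , λ m n m≥ n≥ → move (≤-trans (p≤∣p∣ (seq x m - seq x n)) (h m n m≥ n≥))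

infix 4 _≤ℝ_ _<ℝ_

_≤ℝ_ : ℝ → ℝ → Set
x ≤ℝ y = ∀ ε → 0ℚ < ε → ∃[ N ] (∀ m → N ℕ.≤ m → seq x m ≤ seq y m + ε)

_<ℝ_ : ℝ → ℝ → Set
x <ℝ y = ∃[ ε ] (0ℚ < ε × ∃[ N ] (∀ m → N ℕ.≤ m → seq x m + ε ≤ seq y m))

fromℚ : ℚ → ℝ
fromℚ q = mkℝ (λ _ → q) (λ ε 0<ε → 0 , λ _ _ _ _ → subst (λ z → ∣ z ∣ ≤ ε) (sym (+-inverseʳ q)) (<⇒≤ 0<ε))

infixl 6 _+ℝ_ _-ℝ_
infixl 7 _*ℝ_ _⊓ℝ_
infix 8 -ℝ_

m≤⊔ˡ : ∀ a b {m} → a ℕ.⊔ b ℕ.≤ m → a ℕ.≤ m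
m≤⊔ˡ a b le = ℕP.≤-trans (ℕP.m≤m⊔n a b) le

m≤⊔ʳ : ∀ a b {m} → a ℕ.⊔ b ℕ.≤ m → b ℕ.≤ m
m≤⊔ʳ a b le = ℕP.≤-trans (ℕP.m≤n⊔m a b) le

_+ℝ_ : ℝ → ℝ → ℝ
x +ℝ y = mkℝ (λ m → seq x m + seq y m) (cauchy⇐ _ go)
  where
  go : IsCauchy′ (λ m → seq x m + seq y m)
  go ε 0<ε =
    let N₁ , h₁ = one-sided x (ε * ½) (0<ε½ 0<ε)
        N₂ , h₂ = one-sided y (ε * ½) (0<ε½ 0<ε)
    in N₁ ℕ.⊔ N₂ , λ m n m≥ n≥ →
         sum-≤ (seq x m) (seq y m) (seq x n) (seq y n) ε
           (h₁ m n (m≤⊔ˡ N₁ N₂ m≥) (m≤⊔ˡ N₁ N₂ n≥)) (h₂ m n (m≤⊔ʳ N₁ N₂ m≥) (m≤⊔ʳ N₁ N₂ n≥))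

-ℝ_ : ℝ → ℝ
-ℝ x = mkℝ (λ m → - seq x m) (cauchy⇐ _ go)
  where
  go : IsCauchy′ (λ m → - seq x m)
  go ε 0<ε =
    let N , h = one-sided x ε 0<ε in N , λ m n m≥ n≥ → neg-≤ (seq x m) (seq x n) ε (h n m n≥ m≥)

_-ℝ_ : ℝ → ℝ → ℝ
x -ℝ y = x +ℝ (-ℝ y)

∣_∣ℝ : ℝ → ℝ
∣ x ∣ℝ = mkℝ (λ m → ∣ seq x m ∣) (cauchy⇐ _ go)
  where
  go : IsCauchy′ (λ m → ∣ seq x m ∣)
  go ε 0<ε =
    let N₁ , h₁ = one-sided x ε 0<ε
        N₂ , h₂ = one-sided (-ℝ x) ε 0<ε
    in N₁ ℕ.⊔ N₂ , λ m n m≥ n≥ → ∣p∣≤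
         (≤-trans (h₁ m n (m≤⊔ˡ N₁ N₂ m≥) (m≤⊔ˡ N₁ N₂ n≥)) (+-monoˡ-≤ ε (p≤∣p∣ (seq x n))))
         (≤-trans (h₂ m n (m≤⊔ʳ N₁ N₂ m≥) (m≤⊔ʳ N₁ N₂ n≥)) (+-monoˡ-≤ ε (-p≤∣p∣ (seq x n))))

_⊓ℝ_ : ℝ → ℝ → ℝ
x ⊓ℝ y = mkℝ (λ m → seq x m ⊓ seq y m) (cauchy⇐ _ go)
  where
  go : IsCauchy′ (λ m → seq x m ⊓ seq y m)
  go ε 0<ε =
    let N₁ , h₁ = one-sided x ε 0<ε
        N₂ , h₂ = one-sided y ε 0<ε
    in N₁ ℕ.⊔ N₂ , λ m n m≥ n≥ → ⊓-≤ (seq x m) (seq y m) (seq x n) (seq y n) ε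
         (h₁ m n (m≤⊔ˡ N₁ N₂ m≥) (m≤⊔ˡ N₁ N₂ n≥)) (h₂ m n (m≤⊔ʳ N₁ N₂ m≥) (m≤⊔ʳ N₁ N₂ n≥))

bounded : ∀ x → ∃[ B ] ∃[ N ] (∀ m → N ℕ.≤ m → ∣ seq x m ∣ ≤ ι B)
bounded x =
  let N , h = cauchy x 1ℚ (positive⁻¹ 1ℚ)
      B , b = ∣p∣≤ι (seq x N)
  in suc B , N , λ m m≥ → ∣∣-step (seq x m) (seq x N) B (h m N m≥ ℕP.≤-refl) b

_*ℝ_ : ℝ → ℝ → ℝ
x *ℝ y = mkℝ (λ m → seq x m * seq y m) (cauchy⇐ _ go)
  where
  go : IsCauchy′ (λ m → seq x m * seq y m)
  go ε 0<ε =
    let B , N₁ , b = bounded x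
        C , N₂ , c = bounded y
        K , k      = arch* (B ℕ.+ C) 0<ε
        N₃ , h₁    = cauchy x (1/1+ K) (0<1/1+ K)
        N₄ , h₂    = cauchy y (1/1+ K) (0<1/1+ K)
        M          = N₁ ℕ.⊔ N₂
        M′         = N₃ ℕ.⊔ N₄
    in M ℕ.⊔ M′ , λ m n m≥ n≥ → prod-≤ (seq x m) (seq y m) (seq x n) (seq y n) (1/1+ K) ε B C (0≤1/1+ K)
         (b m (m≤⊔ˡ N₁ N₂ (m≤⊔ˡ M M′ m≥)))
         (c n (m≤⊔ʳ N₁ N₂ (m≤⊔ˡ M M′ n≥)))
         (h₁ m n (m≤⊔ˡ N₃ N₄ (m≤⊔ʳ M M′ m≥)) (m≤⊔ˡ N₃ N₄ (m≤⊔ʳ M M′ n≥)))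
         (h₂ m n (m≤⊔ʳ N₃ N₄ (m≤⊔ʳ M M′ m≥)) (m≤⊔ʳ N₃ N₄ (m≤⊔ʳ M M′ n≥)))
         (k K ℕP.≤-refl)

0≤1ℚ : 0ℚ ≤ 1ℚ
0≤1ℚ = <⇒≤ (positive⁻¹ 1ℚ)

0≤^ : ∀ {u} → 0ℚ ≤ u → ∀ k → 0ℚ ≤ u ^ k
0≤^ 0≤u zero    = 0≤1ℚ
0≤^ 0≤u (suc k) = 0≤* 0≤u (0≤^ 0≤u k)

^-mono : ∀ {u v} → 0ℚ ≤ u → u ≤ v → ∀ k → u ^ k ≤ v ^ k
^-mono 0≤u u≤v zero    = ≤-refl
^-mono 0≤u u≤v (suc k) = *-mono-≤ (≤-trans 0≤u u≤v) (0≤^ 0≤u k) u≤v (^-mono 0≤u u≤v k)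

1^ : ∀ k → 1ℚ ^ k ≡ 1ℚ
1^ zero    = refl
1^ (suc k) = trans (*-identityˡ (1ℚ ^ k)) (1^ k)

^≤1 : ∀ {w} → 0ℚ ≤ w → w ≤ 1ℚ → ∀ k → w ^ k ≤ 1ℚ
^≤1 {w} 0≤w w≤1 k = subst (w ^ k ≤_) (1^ k) (^-mono 0≤w w≤1 k)

bernoulli : ∀ s → 0ℚ ≤ 1ℚ + s → ∀ k → 1ℚ + ι k * s ≤ (1ℚ + s) ^ k
bernoulli s h zero = ≤-reflexive (trans (cong (λ z → 1ℚ + z) (*-zeroˡ s)) (+-identityʳ 1ℚ))
bernoulli s h (suc k) = begin
  1ℚ + ι (suc k) * s                     ≡⟨ cong (λ z → 1ℚ + z * s) (ι-suc k) ⟩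
  1ℚ + (1ℚ + ι k) * s                    ≤⟨ ≤-by (0≤* (0≤ι k) (0≤p² s)) (solve 2 (λ s k → (con 1ℚ :+ s) :* (con 1ℚ :+ k :* s) := (con 1ℚ :+ (con 1ℚ :+ k) :* s) :+ k :* (s :* s)) refl s (ι k)) ⟩
  (1ℚ + s) * (1ℚ + ι k * s)              ≤⟨ *-monoˡ-≤-nonNeg (1ℚ + s) {{nonNegative h}} (bernoulli s h k) ⟩
  (1ℚ + s) * (1ℚ + s) ^ k                ∎
  where
  open ≤-Reasoning

^-diff : ∀ {u v W d} → 0ℚ ≤ u → 0ℚ ≤ v → u ≤ W → v ≤ W → 1ℚ ≤ W → 0ℚ ≤ d → v ≤ u + d →
         ∀ k → v ^ k ≤ u ^ k + ι k * (d * W ^ k)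
^-diff {u} {v} {W} {d} 0≤u 0≤v u≤W v≤W 1≤W 0≤d v≤u+d zero =
  ≤-reflexive (sym (trans (cong (λ z → 1ℚ + z) (*-zeroˡ (d * 1ℚ))) (+-identityʳ 1ℚ)))
^-diff {u} {v} {W} {d} 0≤u 0≤v u≤W v≤W 1≤W 0≤d v≤u+d (suc k) = begin
  v * v ^ k
    ≤⟨ *-monoʳ-≤-nonNeg (v ^ k) {{nonNegative (0≤^ 0≤v k)}} v≤u+d ⟩
  (u + d) * v ^ k
    ≡⟨ *-distribʳ-+ (v ^ k) u d ⟩
  u * v ^ k + d * v ^ k
    ≤⟨ +-mono-≤
         (*-monoˡ-≤-nonNeg u {{nonNegative 0≤u}} (^-diff 0≤u 0≤v u≤W v≤W 1≤W 0≤d v≤u+d k))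
         (*-monoˡ-≤-nonNeg d {{nonNegative 0≤d}} (≤-trans (^-mono 0≤v v≤W k)
           (subst (_≤ W * W ^ k) (*-identityˡ (W ^ k)) (*-monoʳ-≤-nonNeg (W ^ k) {{nonNegative 0≤W^}} 1≤W)))) ⟩
  u * (u ^ k + ι k * (d * W ^ k)) + d * (W * W ^ k)
    ≡⟨ cong (_+ d * (W * W ^ k)) (*-distribˡ-+ u (u ^ k) (ι k * (d * W ^ k))) ⟩
  u * u ^ k + u * (ι k * (d * W ^ k)) + d * (W * W ^ k)
    ≤⟨ +-monoˡ-≤ (d * (W * W ^ k)) (+-monoʳ-≤ (u * u ^ k)
         (*-monoʳ-≤-nonNeg (ι k * (d * W ^ k)) {{nonNegative (0≤* (0≤ι k) (0≤* 0≤d 0≤W^))}} u≤W)) ⟩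
  u * u ^ k + W * (ι k * (d * W ^ k)) + d * (W * W ^ k)
    ≡⟨ solve 5 (λ a W k d p → a :+ W :* (k :* (d :* p)) :+ d :* (W :* p) := a :+ (con 1ℚ :+ k) :* (d :* (W :* p)))
         refl (u * u ^ k) W (ι k) d (W ^ k) ⟩
  u * u ^ k + (1ℚ + ι k) * (d * (W * W ^ k))
    ≡⟨ cong (λ z → u * u ^ k + z * (d * (W * W ^ k))) (ι-suc k) ⟨
  u * u ^ k + ι (suc k) * (d * (W * W ^ k)) ∎
  where
  open ≤-Reasoning
  0≤W^ : 0ℚ ≤ W ^ k
  0≤W^ = 0≤^ (≤-trans 0≤u u≤W) k

^-upper : ∀ s → 0ℚ ≤ 1ℚ + s → 0ℚ ≤ 1ℚ + - s → ∀ k → (1ℚ + s) ^ k * (1ℚ + ι k * - s) ≤ 1ℚ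
^-upper s h h′ k = begin
  (1ℚ + s) ^ k * (1ℚ + ι k * - s)      ≤⟨ *-monoˡ-≤-nonNeg ((1ℚ + s) ^ k) {{nonNegative (0≤^ h k)}} (bernoulli (- s) h′ k) ⟩
  (1ℚ + s) ^ k * (1ℚ + - s) ^ k        ≡⟨ ^-distrib-* (1ℚ + s) (1ℚ + - s) k ⟨
  ((1ℚ + s) * (1ℚ + - s)) ^ k          ≤⟨ ^≤1 (0≤* h h′) (≤-by (0≤p² s) (solve 1 (λ s → con 1ℚ := (con 1ℚ :+ s) :* (con 1ℚ :+ :- s) :+ s :* s) refl s)) k ⟩
  1ℚ                                   ∎
  where
  open ≤-Reasoning

2ℚ 4ℚ : ℚ
2ℚ = ι 2
4ℚ = ι 4

0≤-neg : ∀ {r} → r ≤ 1ℚ → 0ℚ ≤ 1ℚ + - r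
0≤-neg = 0≤q-p

1/1+≤1 : ∀ m → 1/1+ m ≤ 1ℚ
1/1+≤1 m = 1/1+-anti {m} {0} ℕ.z≤n

e≤4 : ∀ m → (1ℚ + 1/1+ m) ^ suc m ≤ 4ℚ
e≤4 m = begin
  (1ℚ + r) ^ suc m                   ≤⟨ ^-mono (0≤+ 0≤1ℚ (0≤1/1+ m)) (≤-by (0≤* 0≤s 0≤s) eq) (suc m) ⟩
  ((1ℚ + s) * (1ℚ + s)) ^ suc m      ≡⟨ ^-distrib-* (1ℚ + s) (1ℚ + s) (suc m) ⟩
  (1ℚ + s) ^ suc m * (1ℚ + s) ^ suc m ≤⟨ *-mono-≤ (0≤ι 2) 0≤p p≤2 p≤2 ⟩
  4ℚ                                 ∎
  where
  open ≤-Reasoning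
  r = 1/1+ m
  s = r * ½
  0≤s : 0ℚ ≤ s
  0≤s = 0≤* (0≤1/1+ m) (<⇒≤ (positive⁻¹ ½))
  eq : (1ℚ + s) * (1ℚ + s) ≡ 1ℚ + r + s * s
  eq = solve 1 (λ r → (con 1ℚ :+ r :* con ½) :* (con 1ℚ :+ r :* con ½) := con 1ℚ :+ r :+ (r :* con ½) :* (r :* con ½)) refl r
  0≤p : 0ℚ ≤ (1ℚ + s) ^ suc m
  0≤p = 0≤^ (0≤+ 0≤1ℚ 0≤s) (suc m)
  s≤1 : s ≤ 1ℚ
  s≤1 = ≤-trans (≤-by 0≤s (sym (halves r))) (1/1+≤1 m)
  Ms : ι (suc m) * - s ≡ - ½
  Ms = trans (solve 2 (λ M r → M :* :- (r :* con ½) := (M :* r) :* con (- ½)) refl (ι (suc m)) r)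
         (trans (cong (_* (- ½)) (ι-inv m)) (*-identityˡ (- ½)))
  p≤2 : (1ℚ + s) ^ suc m ≤ 2ℚ
  p≤2 = *-cancel-≤ ½ (positive⁻¹ ½) (subst (λ z → (1ℚ + s) ^ suc m * (1ℚ + z) ≤ 1ℚ) Ms
          (^-upper s (0≤+ 0≤1ℚ 0≤s) (0≤-neg s≤1) (suc m)))

e^≤4^ : ∀ B m → (1ℚ + ι B * 1/1+ m) ^ suc m ≤ 4ℚ ^ B
e^≤4^ B m = begin
  (1ℚ + ι B * r) ^ suc m    ≤⟨ ^-mono (0≤+ 0≤1ℚ (0≤* (0≤ι B) (0≤1/1+ m))) (bernoulli r 0≤1+r B) (suc m) ⟩
  ((1ℚ + r) ^ B) ^ suc m    ≡⟨ ^-assocʳ (1ℚ + r) B (suc m) ⟩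
  (1ℚ + r) ^ (B ℕ.* suc m)  ≡⟨ cong ((1ℚ + r) ^_) (ℕP.*-comm B (suc m)) ⟩
  (1ℚ + r) ^ (suc m ℕ.* B)  ≡⟨ ^-assocʳ (1ℚ + r) (suc m) B ⟨
  ((1ℚ + r) ^ suc m) ^ B    ≤⟨ ^-mono (0≤^ 0≤1+r (suc m)) (e≤4 m) B ⟩
  4ℚ ^ B                    ∎
  where
  open ≤-Reasoning
  r = 1/1+ m
  0≤1+r = 0≤+ 0≤1ℚ (0≤1/1+ m)

-- exp x is defined as lim (1 + x/M)^M; this is the term with M = suc m.
expℚ : ℕ → ℚ → ℚ
expℚ m x = (1ℚ + x * 1/1+ m) ^ suc m

Bd : ℕ → ℚ → Set
Bd B x = (- ι B ≤ x) × (x ≤ ι B)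

ιr≤1 : ∀ B m → B ℕ.≤ suc m → ι B * 1/1+ m ≤ 1ℚ
ιr≤1 B m le = cross-≤ B 1 m 0 (subst₂ ℕ._≤_ (sym (ℕP.*-identityʳ B)) (sym (ℕP.*-identityˡ (suc m))) le)

xr-lower : ∀ {B x} m → - ι B ≤ x → - (ι B * 1/1+ m) ≤ x * 1/1+ m
xr-lower {B} {x} m le = subst (_≤ x * 1/1+ m) (sym (neg-distribˡ-* (ι B) (1/1+ m)))
  (*-monoʳ-≤-nonNeg (1/1+ m) {{nonNegative (0≤1/1+ m)}} le)

xr-upper : ∀ {B x} m → x ≤ ι B → x * 1/1+ m ≤ ι B * 1/1+ m
xr-upper {B} {x} m le = *-monoʳ-≤-nonNeg (1/1+ m) {{nonNegative (0≤1/1+ m)}} le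

0≤1+xr : ∀ {B x} m → - ι B ≤ x → B ℕ.≤ suc m → 0ℚ ≤ 1ℚ + x * 1/1+ m
0≤1+xr {B} {x} m le B≤ = ≤-trans (0≤q-p (ιr≤1 B m B≤)) (+-monoʳ-≤ 1ℚ (xr-lower {B} {x} m le))

expℚ-cont : ∀ B m x y δ → Bd B x → Bd B y → B ℕ.≤ suc m → 0ℚ ≤ δ → x ≤ y + δ →
            expℚ m x ≤ expℚ m y + δ * 4ℚ ^ B
expℚ-cont B m x y δ (x≥ , x≤) (y≥ , y≤) B≤ 0≤δ le = begin
  expℚ m x                                       ≤⟨ ^-diff (0≤1+xr {B} {y} m y≥ B≤) (0≤1+xr {B} {x} m x≥ B≤)
                                                      (+-monoʳ-≤ 1ℚ (xr-upper {B} {y} m y≤)) (+-monoʳ-≤ 1ℚ (xr-upper {B} {x} m x≤))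
                                                      1≤W (0≤* 0≤δ (0≤1/1+ m)) step (suc m) ⟩
  expℚ m y + ι (suc m) * (δ * r * W ^ suc m)     ≡⟨ cong (λ z → expℚ m y + z) (solve 4 (λ M d r w → M :* (d :* r :* w) := (M :* r) :* (d :* w)) refl (ι (suc m)) δ r (W ^ suc m)) ⟩
  expℚ m y + (ι (suc m) * r) * (δ * W ^ suc m)   ≡⟨ cong (λ z → expℚ m y + z * (δ * W ^ suc m)) (ι-inv m) ⟩
  expℚ m y + 1ℚ * (δ * W ^ suc m)                ≡⟨ cong (λ z → expℚ m y + z) (*-identityˡ (δ * W ^ suc m)) ⟩
  expℚ m y + δ * W ^ suc m                       ≤⟨ +-monoʳ-≤ (expℚ m y) (*-monoˡ-≤-nonNeg δ {{nonNegative 0≤δ}} (e^≤4^ B m)) ⟩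
  expℚ m y + δ * 4ℚ ^ B                          ∎
  where
  open ≤-Reasoning
  r = 1/1+ m
  W = 1ℚ + ι B * r
  1≤W : 1ℚ ≤ W
  1≤W = ≤-by (0≤* (0≤ι B) (0≤1/1+ m)) refl
  step : 1ℚ + x * r ≤ 1ℚ + y * r + δ * r
  step = begin
    1ℚ + x * r              ≤⟨ +-monoʳ-≤ 1ℚ (*-monoʳ-≤-nonNeg r {{nonNegative (0≤1/1+ m)}} le) ⟩
    1ℚ + (y + δ) * r        ≡⟨ solve 3 (λ y d r → con 1ℚ :+ (y :+ d) :* r := con 1ℚ :+ y :* r :+ d :* r) refl y δ r ⟩
    1ℚ + y * r + δ * r      ∎

-- The common refinement of two step sizes: suc (mesh m p) = suc m * suc p.
mesh : ℕ → ℕ → ℕ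
mesh m p = p ℕ.+ m ℕ.* suc p

mesh-comm : ∀ m p → mesh m p ≡ mesh p m
mesh-comm m p = ℕP.suc-injective (ℕP.*-comm (suc m) (suc p))

mesh-ι : ∀ m p → ι (suc p) * 1/1+ mesh m p ≡ 1/1+ m
mesh-ι m p = trans (≤-antisym
  (cross-≤ (suc p) 1 (mesh m p) m (ℕP.≤-reflexive eq))
  (cross-≤ 1 (suc p) m (mesh m p) (ℕP.≤-reflexive (sym eq)))) (*-identityˡ (1/1+ m))
  where
  eq : suc p ℕ.* suc m ≡ 1 ℕ.* suc (mesh m p)
  eq = trans (ℕP.*-comm (suc p) (suc m)) (sym (ℕP.*-identityˡ (suc (mesh m p))))

meshError : ℕ → ℚ
meshError B = 2ℚ * (ι B * ι B) * 4ℚ ^ B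

module Refine (B m p : ℕ) (x : ℚ) (bd : Bd B x) (2B≤ : B ℕ.+ B ℕ.≤ suc m) where
  open ≤-Reasoning
  M = suc m
  P = suc p
  q = mesh m p
  r = 1/1+ m
  t = x * r
  s = x * 1/1+ q
  b = ι B * r
  v = (1ℚ + s) ^ P
  Ps : ι P * s ≡ t
  Ps = trans (solve 3 (λ P x r → P :* (x :* r) := x :* (P :* r)) refl (ι P) x (1/1+ q)) (cong (x *_) (mesh-ι m p))
  B≤M : B ℕ.≤ suc m
  B≤M = ℕP.≤-trans (ℕP.m≤m+n B B) 2B≤
  m≤q : m ℕ.≤ q
  m≤q = ℕP.≤-trans (ℕP.m≤m*n m (suc p)) (ℕP.m≤n+m (m ℕ.* suc p) p)
  B≤Q : B ℕ.≤ suc q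
  B≤Q = ℕP.≤-trans B≤M (ℕ.s≤s m≤q)
  0≤1+s : 0ℚ ≤ 1ℚ + s
  0≤1+s = 0≤1+xr {B} {x} q (proj₁ bd) B≤Q
  0≤1-s : 0ℚ ≤ 1ℚ + - s
  0≤1-s = 0≤-neg (≤-trans (xr-upper {B} {x} q (proj₂ bd)) (ιr≤1 B q B≤Q))
  v^M : v ^ M ≡ expℚ q x
  v^M = trans (^-assocʳ (1ℚ + s) P M) (cong ((1ℚ + s) ^_) (ℕP.*-comm P M))
  0≤v : 0ℚ ≤ v
  0≤v = 0≤^ 0≤1+s P
  0≤b : 0ℚ ≤ b
  0≤b = 0≤* (0≤ι B) (0≤1/1+ m)
  b≤½ : b ≤ ½
  b≤½ = *-cancel-≤ 2ℚ (positive⁻¹ 2ℚ) (begin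
    b * 2ℚ                     ≡⟨ solve 2 (λ B r → B :* r :* con 2ℚ := (B :+ B) :* r) refl (ι B) r ⟩
    (ι B + ι B) * r            ≡⟨ cong (_* r) (ι-+ B B) ⟨
    ι (B ℕ.+ B) * r            ≤⟨ ιr≤1 (B ℕ.+ B) m 2B≤ ⟩
    1ℚ                         ∎)
  t≤b : t ≤ b
  t≤b = xr-upper {B} {x} m (proj₂ bd)
  -b≤t : - b ≤ t
  -b≤t = xr-lower {B} {x} m (proj₁ bd)
  u≤v : 1ℚ + t ≤ v
  u≤v = subst (λ z → 1ℚ + z ≤ v) Ps (bernoulli s 0≤1+s P)
  0≤1+t : 0ℚ ≤ 1ℚ + t
  0≤1+t = 0≤1+xr {B} {x} m (proj₁ bd) B≤M

  lower : expℚ m x ≤ expℚ q x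
  lower = subst (expℚ m x ≤_) v^M (^-mono 0≤1+t u≤v M)

  t²≤b² : t * t ≤ b * b
  t²≤b² = ≤-by (0≤* (0≤q-p t≤b) (subst (0ℚ ≤_) (solve 2 (λ t b → t :- (:- b) := b :+ t) refl t b) (0≤q-p -b≤t)))
            (solve 2 (λ t b → b :* b := t :* t :+ (b :- t) :* (b :+ t)) refl t b)
  0≤1-2t : 0ℚ ≤ 1ℚ - (t + t)
  0≤1-2t = 0≤q-p (+-mono-≤ (≤-trans t≤b b≤½) (≤-trans t≤b b≤½))
  0<1-t : 0ℚ < 1ℚ + - t
  0<1-t = <-≤-trans (positive⁻¹ ½) (+-monoʳ-≤ 1ℚ (neg-antimono-≤ (≤-trans t≤b b≤½)))

  d = 2ℚ * (b * b)
  v≤ : v ≤ 1ℚ + t + d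
  v≤ = ≤-trans (*-cancel-≤ (1ℚ + - t) 0<1-t (begin
    v * (1ℚ + - t)                          ≡⟨ cong (λ z → v * (1ℚ + z)) (trans (cong -_ (sym Ps)) (neg-distribʳ-* (ι P) s)) ⟩
    v * (1ℚ + ι P * - s)                    ≤⟨ ^-upper s 0≤1+s 0≤1-s P ⟩
    1ℚ                                      ≤⟨ ≤-by (0≤* (0≤p² t) 0≤1-2t) (solve 1 (λ t → (con 1ℚ :+ t :+ con 2ℚ :* (t :* t)) :* (con 1ℚ :+ :- t) := con 1ℚ :+ t :* t :* (con 1ℚ :- (t :+ t))) refl t) ⟩
    (1ℚ + t + 2ℚ * (t * t)) * (1ℚ + - t)    ∎))
    (+-monoʳ-≤ (1ℚ + t) (*-monoˡ-≤-nonNeg 2ℚ {{nonNegative (0≤ι 2)}} t²≤b²))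

  W₀ = 1ℚ + ι B * 1/1+ q
  W = W₀ ^ P
  0≤W₀ : 0ℚ ≤ W₀
  0≤W₀ = 0≤+ 0≤1ℚ (0≤* (0≤ι B) (0≤1/1+ q))
  PB : ι P * (ι B * 1/1+ q) ≡ b
  PB = trans (solve 3 (λ P x r → P :* (x :* r) := x :* (P :* r)) refl (ι P) (ι B) (1/1+ q)) (cong (ι B *_) (mesh-ι m p))
  1+b≤W : 1ℚ + b ≤ W
  1+b≤W = subst (λ z → 1ℚ + z ≤ W) PB (bernoulli (ι B * 1/1+ q) 0≤W₀ P)
  W^M : W ^ M ≤ 4ℚ ^ B
  W^M = subst (_≤ 4ℚ ^ B) (sym (trans (^-assocʳ W₀ P M) (cong (W₀ ^_) (ℕP.*-comm P M)))) (e^≤4^ B q)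

  upper : expℚ q x ≤ expℚ m x + meshError B * r
  upper = begin
    expℚ q x                                  ≡⟨ v^M ⟨
    v ^ M                                     ≤⟨ ^-diff 0≤1+t 0≤v (≤-trans (+-monoʳ-≤ 1ℚ t≤b) 1+b≤W)
                                                   (^-mono 0≤1+s (+-monoʳ-≤ 1ℚ (xr-upper {B} {x} q (proj₂ bd))) P)
                                                   (≤-trans (≤-by 0≤b refl) 1+b≤W) (0≤* (0≤ι 2) (0≤* 0≤b 0≤b)) v≤ M ⟩
    expℚ m x + ι M * (d * W ^ M)              ≤⟨ +-monoʳ-≤ (expℚ m x) (*-monoˡ-≤-nonNeg (ι M) {{nonNegative (0≤ι M)}}
                                                   (*-monoˡ-≤-nonNeg d {{nonNegative (0≤* (0≤ι 2) (0≤* 0≤b 0≤b))}} W^M)) ⟩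
    expℚ m x + ι M * (d * 4ℚ ^ B)             ≡⟨ cong (λ z → expℚ m x + z) (solve 4 (λ M B r w → M :* (con 2ℚ :* (B :* r :* (B :* r)) :* w) := (M :* r) :* (con 2ℚ :* (B :* B) :* w :* r))
                                                   refl (ι M) (ι B) r (4ℚ ^ B)) ⟩
    expℚ m x + (ι M * r) * (meshError B * r)          ≡⟨ cong (λ z → expℚ m x + z * (meshError B * r)) (ι-inv m) ⟩
    expℚ m x + 1ℚ * (meshError B * r)                 ≡⟨ cong (λ z → expℚ m x + z) (*-identityˡ (meshError B * r)) ⟩
    expℚ m x + meshError B * r                        ∎

abs⇒Bd : ∀ B x → ∣ x ∣ ≤ ι B → Bd B x
abs⇒Bd B x le = lo , ≤-trans (p≤∣p∣ x) le
  where
  lo : - ι B ≤ x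
  lo = subst (- ι B ≤_) (solve 1 (λ x → :- (:- x) := x) refl x) (neg-antimono-≤ (≤-trans (-p≤∣p∣ x) le))

exp-step : ∀ B C m n x y δ ε → Bd B x → Bd B y → B ℕ.+ B ℕ.≤ suc m → B ℕ.+ B ℕ.≤ suc n →
           4ℚ ^ B ≤ ι C → meshError B ≤ ι C → 0ℚ ≤ δ → x ≤ y + δ → ι C * δ ≤ ε * ½ → ι C * 1/1+ n ≤ ε * ½ →
           expℚ m x ≤ expℚ n y + ε
exp-step B C m n x y δ ε bx by m≥ n≥ 4≤ K≤ 0≤δ le hδ hn = begin
  expℚ m x                                        ≤⟨ Refine.lower B m n x bx m≥ ⟩
  expℚ (mesh m n) x                               ≤⟨ expℚ-cont B (mesh m n) x y δ bx by (Refine.B≤Q B m n x bx m≥) 0≤δ le ⟩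
  expℚ (mesh m n) y + δ * 4ℚ ^ B                  ≡⟨ cong (λ k → expℚ k y + δ * 4ℚ ^ B) (mesh-comm m n) ⟩
  expℚ (mesh n m) y + δ * 4ℚ ^ B                  ≤⟨ +-mono-≤ (Refine.upper B n m y by n≥) (≤-trans (*-monoˡ-≤-nonNeg δ {{nonNegative 0≤δ}} 4≤) (subst (_≤ ε * ½) (*-comm (ι C) δ) hδ)) ⟩
  expℚ n y + meshError B * 1/1+ n + ε * ½                 ≤⟨ +-monoˡ-≤ (ε * ½) (+-monoʳ-≤ (expℚ n y) (≤-trans (*-monoʳ-≤-nonNeg (1/1+ n) {{nonNegative (0≤1/1+ n)}} K≤) hn)) ⟩
  expℚ n y + ε * ½ + ε * ½                        ≡⟨ +-assoc (expℚ n y) (ε * ½) (ε * ½) ⟩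
  expℚ n y + (ε * ½ + ε * ½)                      ≡⟨ cong (λ z → expℚ n y + z) (halves ε) ⟩
  expℚ n y + ε                                    ∎
  where open ≤-Reasoning

exp : ℝ → ℝ
exp x = mkℝ (λ m → expℚ m (seq x m)) (cauchy⇐ _ go)
  where
  go : IsCauchy′ (λ m → expℚ m (seq x m))
  go ε 0<ε =
    let B , N₁ , b = bounded x
        C₁ , c₁    = ∣p∣≤ι (4ℚ ^ B)
        C₂ , c₂    = ∣p∣≤ι (meshError B)
        C          = C₁ ℕ.+ C₂
        N₂ , k     = arch* C (0<ε½ 0<ε)
        N₃ , h     = one-sided x (1/1+ N₂) (0<1/1+ N₂)
        M          = N₁ ℕ.⊔ N₂
        M′         = N₃ ℕ.⊔ (B ℕ.+ B)
    in M ℕ.⊔ M′ , λ m n m≥ n≥ → exp-step B C m n (seq x m) (seq x n) (1/1+ N₂) ε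
         (abs⇒Bd B (seq x m) (b m (m≤⊔ˡ N₁ N₂ (m≤⊔ˡ M M′ m≥))))
         (abs⇒Bd B (seq x n) (b n (m≤⊔ˡ N₁ N₂ (m≤⊔ˡ M M′ n≥))))
         (ℕP.m≤n⇒m≤1+n (m≤⊔ʳ N₃ (B ℕ.+ B) (m≤⊔ʳ M M′ m≥)))
         (ℕP.m≤n⇒m≤1+n (m≤⊔ʳ N₃ (B ℕ.+ B) (m≤⊔ʳ M M′ n≥)))
         (≤-trans (≤-trans (p≤∣p∣ (4ℚ ^ B)) c₁) (ι-mono (ℕP.m≤m+n C₁ C₂)))
         (≤-trans (≤-trans (p≤∣p∣ (meshError B)) c₂) (ι-mono (ℕP.m≤n+m C₂ C₁)))
         (0≤1/1+ N₂)
         (h m n (m≤⊔ˡ N₃ (B ℕ.+ B) (m≤⊔ʳ M M′ m≥)) (m≤⊔ˡ N₃ (B ℕ.+ B) (m≤⊔ʳ M M′ n≥)))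
         (k N₂ ℕP.≤-refl)
         (k n (m≤⊔ʳ N₁ N₂ (m≤⊔ˡ M M′ n≥)))

∑< : ℕ → (ℕ → ℚ) → ℚ
∑< zero    f = 0ℚ
∑< (suc k) f = ∑< k f + f k

-- ln n is ∫₁ⁿ dt/t; this is its right-endpoint Riemann sum with step 1/M, M = suc m:
-- Σ_{j < (n-1)M} (1/M) · 1/(1 + (j+1)/M) = Σ_{j < (n-1)M} 1/(M + j + 1).
lnℚ : ℕ → ℕ → ℚ
lnℚ m n = ∑< ((n ∸ 1) ℕ.* suc m) (λ j → 1/1+ (suc m ℕ.+ j))

block-≤ : ∀ f c a b → (∀ i → i ℕ.< b → f (i ℕ.+ a) ≤ c) → ∑< (b ℕ.+ a) f ≤ ∑< a f + ι b * c
block-≤ f c a zero    h = ≤-reflexive (sym (trans (cong (λ z → ∑< a f + z) (*-zeroˡ c)) (+-identityʳ (∑< a f))))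
block-≤ f c a (suc b) h = begin
  ∑< (b ℕ.+ a) f + f (b ℕ.+ a)     ≤⟨ +-mono-≤ (block-≤ f c a b (λ i i<b → h i (ℕP.m<n⇒m<1+n i<b))) (h b (ℕP.n<1+n b)) ⟩
  ∑< a f + ι b * c + c             ≡⟨ solve 3 (λ s b c → s :+ b :* c :+ c := s :+ (con 1ℚ :+ b) :* c) refl (∑< a f) (ι b) c ⟩
  ∑< a f + (1ℚ + ι b) * c          ≡⟨ cong (λ z → ∑< a f + z * c) (ι-suc b) ⟨
  ∑< a f + ι (suc b) * c           ∎
  where open ≤-Reasoning

block-≥ : ∀ f c a b → (∀ i → i ℕ.< b → c ≤ f (i ℕ.+ a)) → ∑< a f + ι b * c ≤ ∑< (b ℕ.+ a) f
block-≥ f c a zero    h = ≤-reflexive (trans (cong (λ z → ∑< a f + z) (*-zeroˡ c)) (+-identityʳ (∑< a f)))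
block-≥ f c a (suc b) h = begin
  ∑< a f + ι (suc b) * c           ≡⟨ cong (λ z → ∑< a f + z * c) (ι-suc b) ⟩
  ∑< a f + (1ℚ + ι b) * c          ≡⟨ solve 3 (λ s b c → s :+ (con 1ℚ :+ b) :* c := s :+ b :* c :+ c) refl (∑< a f) (ι b) c ⟩
  ∑< a f + ι b * c + c             ≤⟨ +-mono-≤ (block-≥ f c a b (λ i i<b → h i (ℕP.m<n⇒m<1+n i<b))) (h b (ℕP.n<1+n b)) ⟩
  ∑< (b ℕ.+ a) f + f (b ℕ.+ a)     ∎
  where open ≤-Reasoning

telescope : ∀ f k → ∑< k f + f k ≡ f 0 + ∑< k (λ j → f (suc j))
telescope f zero    = trans (+-identityˡ (f 0)) (sym (+-identityʳ (f 0)))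
telescope f (suc k) = trans (cong (_+ f (suc k)) (telescope f k)) (+-assoc (f 0) (∑< k (λ j → f (suc j))) (f (suc k)))

∑-cong : ∀ k {f g} → (∀ j → f j ≡ g j) → ∑< k f ≡ ∑< k g
∑-cong zero    h = refl
∑-cong (suc k) h = cong₂ _+_ (∑-cong k h) (h k)

module _ (m p : ℕ) where
  private
    q = mesh m p
    g : ℕ → ℚ
    g j = 1/1+ (suc q ℕ.+ j)

    idx : ∀ i k → suc q ℕ.+ (i ℕ.+ k ℕ.* suc p) ≡ i ℕ.+ (suc m ℕ.+ k) ℕ.* suc p
    idx i k = begin
      suc m ℕ.* suc p ℕ.+ (i ℕ.+ k ℕ.* suc p)   ≡⟨ ℕP.+-assoc (suc m ℕ.* suc p) i (k ℕ.* suc p) ⟨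
      suc m ℕ.* suc p ℕ.+ i ℕ.+ k ℕ.* suc p     ≡⟨ cong (ℕ._+ k ℕ.* suc p) (ℕP.+-comm (suc m ℕ.* suc p) i) ⟩
      i ℕ.+ suc m ℕ.* suc p ℕ.+ k ℕ.* suc p     ≡⟨ ℕP.+-assoc i (suc m ℕ.* suc p) (k ℕ.* suc p) ⟩
      i ℕ.+ (suc m ℕ.* suc p ℕ.+ k ℕ.* suc p)   ≡⟨ cong (i ℕ.+_) (ℕP.*-distribʳ-+ (suc p) (suc m) k) ⟨
      i ℕ.+ (suc m ℕ.+ k) ℕ.* suc p             ∎
      where open ≡-Reasoning

    up : ∀ k i → i ℕ.< suc p → g (i ℕ.+ k ℕ.* suc p) ≤ 1/1+ mesh (m ℕ.+ k) p
    up k i i<p = 1/1+-anti (subst (mesh (m ℕ.+ k) p ℕ.≤_) (sym (idx i k))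
      (ℕP.≤-trans (ℕP.n≤1+n (mesh (m ℕ.+ k) p)) (ℕP.m≤n+m ((suc m ℕ.+ k) ℕ.* suc p) i)))

    lo : ∀ k i → i ℕ.< suc p → 1/1+ mesh (suc m ℕ.+ k) p ≤ g (i ℕ.+ k ℕ.* suc p)
    lo k i (ℕ.s≤s i≤p) = 1/1+-anti (subst (ℕ._≤ mesh (suc m ℕ.+ k) p) (sym (idx i k))
      (ℕP.+-monoˡ-≤ ((suc m ℕ.+ k) ℕ.* suc p) i≤p))

  refine-≤ : ∀ k → ∑< (k ℕ.* suc p) g ≤ ∑< k (λ j → 1/1+ (m ℕ.+ j))
  refine-≤ zero    = ≤-refl
  refine-≤ (suc k) = ≤-trans (block-≤ g (1/1+ mesh (m ℕ.+ k) p) (k ℕ.* suc p) (suc p) (up k))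
    (+-mono-≤ (refine-≤ k) (≤-reflexive (mesh-ι (m ℕ.+ k) p)))

  refine-≥ : ∀ k → ∑< k (λ j → 1/1+ (suc m ℕ.+ j)) ≤ ∑< (k ℕ.* suc p) g
  refine-≥ zero    = ≤-refl
  refine-≥ (suc k) = ≤-trans
    (+-mono-≤ (refine-≥ k) (≤-reflexive (sym (mesh-ι (suc m ℕ.+ k) p))))
    (block-≥ g (1/1+ mesh (suc m ℕ.+ k) p) (k ℕ.* suc p) (suc p) (lo k))

∑-shift : ∀ m k → ∑< k (λ j → 1/1+ (m ℕ.+ j)) ≤ ∑< k (λ j → 1/1+ (suc m ℕ.+ j)) + 1/1+ m
∑-shift m k = begin
  ∑< k h                                     ≤⟨ ≤-by (0≤1/1+ (m ℕ.+ k)) refl ⟩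
  ∑< k h + h k                               ≡⟨ telescope h k ⟩
  h 0 + ∑< k (λ j → h (suc j))               ≡⟨ cong₂ _+_ (cong 1/1+_ (ℕP.+-identityʳ m)) (∑-cong k (λ j → cong 1/1+_ (ℕP.+-suc m j))) ⟩
  1/1+ m + ∑< k (λ j → 1/1+ (suc m ℕ.+ j))   ≡⟨ +-comm (1/1+ m) (∑< k (λ j → 1/1+ (suc m ℕ.+ j))) ⟩
  ∑< k (λ j → 1/1+ (suc m ℕ.+ j)) + 1/1+ m   ∎
  where
  open ≤-Reasoning
  h : ℕ → ℚ
  h j = 1/1+ (m ℕ.+ j)

lnℚ-step : ∀ n m p → lnℚ m n ≤ lnℚ p n + 1/1+ p
lnℚ-step n m p = begin
  lnℚ m n                        ≤⟨ refine-≥ m p k ⟩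
  ∑< (k ℕ.* suc p) (g m p)       ≡⟨ cong₂ (λ a b → ∑< a (λ j → 1/1+ (suc b ℕ.+ j))) eq (mesh-comm m p) ⟩
  ∑< (l ℕ.* suc m) (g p m)       ≤⟨ refine-≤ p m l ⟩
  ∑< l (λ j → 1/1+ (p ℕ.+ j))    ≤⟨ ∑-shift p l ⟩
  lnℚ p n + 1/1+ p               ∎
  where
  open ≤-Reasoning
  k = (n ∸ 1) ℕ.* suc m
  l = (n ∸ 1) ℕ.* suc p
  g : ℕ → ℕ → ℕ → ℚ
  g m p j = 1/1+ (suc (mesh m p) ℕ.+ j)
  eq : k ℕ.* suc p ≡ l ℕ.* suc m
  eq = trans (ℕP.*-assoc (n ∸ 1) (suc m) (suc p)) (trans (cong ((n ∸ 1) ℕ.*_) (ℕP.*-comm (suc m) (suc p)))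
         (sym (ℕP.*-assoc (n ∸ 1) (suc p) (suc m))))

ln : (n : ℕ) .{{_ : ℕ.NonZero n}} → ℝ
ln n = mkℝ (λ m → lnℚ m n) (cauchy⇐ _ go)
  where
  go : IsCauchy′ (λ m → lnℚ m n)
  go ε 0<ε =
    let N , N≤ = arch 0<ε
    in N , λ m p _ p≥ → ≤-trans (lnℚ-step n m p) (+-monoʳ-≤ (lnℚ p n) (≤-trans (1/1+-anti p≥) N≤))

√-next : ℕ → ℕ → ℕ
√-next k r with suc r ℕ.* suc r ℕP.≤? k
... | yes _ = suc r
... | no  _ = r

⌊√_⌋ : ℕ → ℕ
⌊√ zero ⌋  = 0
⌊√ suc k ⌋ = √-next (suc k) ⌊√ k ⌋

√-next-lower : ∀ k r → r ℕ.* r ℕ.≤ k → √-next (suc k) r ℕ.* √-next (suc k) r ℕ.≤ suc k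
√-next-lower k r le with suc r ℕ.* suc r ℕP.≤? suc k
... | yes le′ = le′
... | no  _   = ℕP.m≤n⇒m≤1+n le

√-next-upper : ∀ k r → k ℕ.< suc r ℕ.* suc r → suc k ℕ.< suc (√-next (suc k) r) ℕ.* suc (√-next (suc k) r)
√-next-upper k r lt with suc r ℕ.* suc r ℕP.≤? suc k
... | yes _   = ℕP.≤-<-trans lt (ℕP.*-mono-< (ℕP.n<1+n (suc r)) (ℕP.n<1+n (suc r)))
... | no  ¬le = ℕP.≰⇒> ¬le

⌊√⌋-lower : ∀ k → ⌊√ k ⌋ ℕ.* ⌊√ k ⌋ ℕ.≤ k
⌊√⌋-lower zero    = ℕ.z≤n
⌊√⌋-lower (suc k) = √-next-lower k ⌊√ k ⌋ (⌊√⌋-lower k)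

⌊√⌋-upper : ∀ k → k ℕ.< suc ⌊√ k ⌋ ℕ.* suc ⌊√ k ⌋
⌊√⌋-upper zero    = ℕ.s≤s ℕ.z≤n
⌊√⌋-upper (suc k) = √-next-upper k ⌊√ k ⌋ (⌊√⌋-upper k)

-- With M = suc m and q = a/(suc d) ≥ 0 this is ⌊√⌊qM²⌋⌋/M, which is √q rounded down to a
-- multiple of 1/M. Negative arguments give 0, so √ on ℝ is total: √ x = √ (max x 0).
√ℚ : ℕ → ℚ → ℚ
√ℚ m (mkℚ (+ a) d _)    = ι ⌊√ (a ℕ.* (suc m ℕ.* suc m)) ℕD./ suc d ⌋ * 1/1+ m
√ℚ m (mkℚ -[1+ _ ] _ _) = 0ℚ

0≤√ℚ : ∀ m q → 0ℚ ≤ √ℚ m q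
0≤√ℚ m (mkℚ (+ a) d _)    = 0≤* (0≤ι ⌊√ (a ℕ.* (suc m ℕ.* suc m)) ℕD./ suc d ⌋) (0≤1/1+ m)
0≤√ℚ m (mkℚ -[1+ _ ] _ _) = ≤-refl

module _ (m a d : ℕ) .(c : Coprime a (suc d)) where
  private
    M² = suc m ℕ.* suc m
    k  = (a ℕ.* M²) ℕD./ suc d
    r  = ⌊√ k ⌋
    v  = mkℚ (+ a) d c
    D  = ι (suc d) * (ι (suc m) * ι (suc m))

    0<D : 0ℚ < D
    0<D = 0<* (0<ι d) (0<* (0<ι m) (0<ι m))

    vD : v * D ≡ ι (a ℕ.* M²)
    vD = begin
      v * (ι (suc d) * (ι (suc m) * ι (suc m)))    ≡⟨ *-assoc v (ι (suc d)) (ι (suc m) * ι (suc m)) ⟨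
      v * ι (suc d) * (ι (suc m) * ι (suc m))      ≡⟨ cong₂ _*_ (num-den a d c) (sym (ι-* (suc m) (suc m))) ⟩
      ι a * ι M²                                   ≡⟨ ι-* a M² ⟨
      ι (a ℕ.* M²)                                 ∎
      where open ≡-Reasoning

    sqD : ∀ n → ι n * 1/1+ m * (ι n * 1/1+ m) * D ≡ ι (n ℕ.* n ℕ.* suc d)
    sqD n = begin
      ι n * 1/1+ m * (ι n * 1/1+ m) * (ι (suc d) * (ι (suc m) * ι (suc m)))
        ≡⟨ solve 4 (λ n i d M → n :* i :* (n :* i) :* (d :* (M :* M)) := n :* n :* d :* ((M :* i) :* (M :* i))) refl (ι n) (1/1+ m) (ι (suc d)) (ι (suc m)) ⟩
      ι n * ι n * ι (suc d) * ((ι (suc m) * 1/1+ m) * (ι (suc m) * 1/1+ m))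
        ≡⟨ cong (λ z → ι n * ι n * ι (suc d) * (z * z)) (ι-inv m) ⟩
      ι n * ι n * ι (suc d) * 1ℚ
        ≡⟨ *-identityʳ (ι n * ι n * ι (suc d)) ⟩
      ι n * ι n * ι (suc d)
        ≡⟨ cong (_* ι (suc d)) (ι-* n n) ⟨
      ι (n ℕ.* n) * ι (suc d)
        ≡⟨ ι-* (n ℕ.* n) (suc d) ⟨
      ι (n ℕ.* n ℕ.* suc d) ∎
      where open ≡-Reasoning

  √ℚ-lower⁺ : √ℚ m v * √ℚ m v ≤ v
  √ℚ-lower⁺ = *-cancel-≤ D 0<D (subst₂ _≤_ (sym (sqD r)) (sym vD)
    (ι-mono (ℕP.≤-trans (ℕP.*-monoˡ-≤ (suc d) (⌊√⌋-lower k)) (ℕD.m/n*n≤m (a ℕ.* M²) (suc d)))))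

  √ℚ-upper⁺ : v ≤ (√ℚ m v + 1/1+ m) * (√ℚ m v + 1/1+ m)
  √ℚ-upper⁺ = subst (λ z → v ≤ z * z)
    (trans (cong (_* 1/1+ m) (ι-suc r)) (solve 2 (λ r i → (con 1ℚ :+ r) :* i := r :* i :+ i) refl (ι r) (1/1+ m)))
    (*-cancel-≤ D 0<D (subst₂ _≤_ (sym vD) (sym (sqD (suc r))) (ι-mono le)))
    where
    le : a ℕ.* M² ℕ.≤ suc r ℕ.* suc r ℕ.* suc d
    le = begin
      a ℕ.* M²                                    ≡⟨ ℕD.m≡m%n+[m/n]*n (a ℕ.* M²) (suc d) ⟩
      (a ℕ.* M²) ℕD.% suc d ℕ.+ k ℕ.* suc d       ≤⟨ ℕP.+-monoˡ-≤ (k ℕ.* suc d) (ℕP.<⇒≤ (ℕD.m%n<n (a ℕ.* M²) (suc d))) ⟩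
      suc k ℕ.* suc d                             ≤⟨ ℕP.*-monoˡ-≤ (suc d) (⌊√⌋-upper k) ⟩
      suc r ℕ.* suc r ℕ.* suc d                   ∎
      where open ℕP.≤-Reasoning

√ℚ-lower : ∀ m q → √ℚ m q * √ℚ m q ≤ q ⊔ 0ℚ
√ℚ-lower m q@(mkℚ (+ a) d c)    = ≤-trans (√ℚ-lower⁺ m a d c) (p≤p⊔q q 0ℚ)
√ℚ-lower m q@(mkℚ -[1+ _ ] _ _) = p≤q⊔p q 0ℚ

√ℚ-upper : ∀ m q → q ⊔ 0ℚ ≤ (√ℚ m q + 1/1+ m) * (√ℚ m q + 1/1+ m)
√ℚ-upper m q = ⊔-lub (top q) (0≤* nn nn)
  where
  nn : 0ℚ ≤ √ℚ m q + 1/1+ m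
  nn = 0≤+ (0≤√ℚ m q) (0≤1/1+ m)
  top : ∀ q → q ≤ (√ℚ m q + 1/1+ m) * (√ℚ m q + 1/1+ m)
  top (mkℚ (+ a) d c)        = √ℚ-upper⁺ m a d c
  top q@(mkℚ -[1+ n ] d c) = ≤-trans (<⇒≤ (negative⁻¹ q)) (0≤* nn′ nn′)
    where
    nn′ : 0ℚ ≤ 0ℚ + 1/1+ m
    nn′ = 0≤+ ≤-refl (0≤1/1+ m)

sq-cancel : ∀ {s t} → 0ℚ ≤ t → s * s ≤ t * t → s ≤ t
sq-cancel {s} {t} 0≤t le = ≮⇒≥ λ t<s → <-irrefl refl (<-≤-trans (begin-strict
  t * t    ≤⟨ *-monoˡ-≤-nonNeg t {{nonNegative 0≤t}} (<⇒≤ t<s) ⟩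
  t * s    <⟨ *-monoˡ-<-pos s {{positive (≤-<-trans 0≤t t<s)}} t<s ⟩
  s * s    ∎) le)
  where open ≤-Reasoning

√ℚ-step : ∀ m n a b δ → 0ℚ ≤ δ → a ≤ b + δ * δ → √ℚ m a ≤ √ℚ n b + (1/1+ n + δ)
√ℚ-step m n a b δ 0≤δ le = sq-cancel (0≤+ (0≤√ℚ n b) (0≤+ (0≤1/1+ n) 0≤δ)) (begin
  √ℚ m a * √ℚ m a               ≤⟨ √ℚ-lower m a ⟩
  a ⊔ 0ℚ                        ≤⟨ ⊔-lub (≤-trans le (+-monoˡ-≤ (δ * δ) (p≤p⊔q b 0ℚ))) (0≤+ (p≤q⊔p b 0ℚ) (0≤* 0≤δ 0≤δ)) ⟩
  (b ⊔ 0ℚ) + δ * δ              ≤⟨ +-monoˡ-≤ (δ * δ) (√ℚ-upper n b) ⟩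
  w * w + δ * δ                 ≤⟨ ≤-by (0≤+ (0≤* 0≤w 0≤δ) (0≤* 0≤w 0≤δ)) (solve 3 (λ s i d → (s :+ (i :+ d)) :* (s :+ (i :+ d)) := (s :+ i) :* (s :+ i) :+ d :* d :+ ((s :+ i) :* d :+ (s :+ i) :* d)) refl (√ℚ n b) (1/1+ n) δ) ⟩
  (√ℚ n b + (1/1+ n + δ)) * (√ℚ n b + (1/1+ n + δ)) ∎)
  where
  open ≤-Reasoning
  w = √ℚ n b + 1/1+ n
  0≤w : 0ℚ ≤ w
  0≤w = 0≤+ (0≤√ℚ n b) (0≤1/1+ n)

√_ : ℝ → ℝ
√ x = mkℝ (λ m → √ℚ m (seq x m)) (cauchy⇐ _ go)
  where
  go : IsCauchy′ (λ m → √ℚ m (seq x m))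
  go ε 0<ε =
    let N , N≤ = arch (0<ε½ 0<ε)
        δ      = 1/1+ N
        N′ , h = one-sided x (δ * δ) (0<* (0<1/1+ N) (0<1/1+ N))
    in N ℕ.⊔ N′ , λ m n m≥ n≥ → ≤-trans
         (√ℚ-step m n (seq x m) (seq x n) δ (0≤1/1+ N) (h m n (m≤⊔ʳ N N′ m≥) (m≤⊔ʳ N N′ n≥)))
         (+-monoʳ-≤ (√ℚ n (seq x n)) (subst (1/1+ n + δ ≤_) (halves ε)
           (+-mono-≤ (≤-trans (1/1+-anti (m≤⊔ˡ N N′ n≥)) N≤) N≤)))

infixl 7 _÷ℕ_
infixr 8 _^ℝ_

0ℝ 1ℝ : ℝ
0ℝ = fromℚ 0ℚ
1ℝ = fromℚ 1ℚ

_÷ℕ_ : ℝ → (n : ℕ) .{{_ : ℕ.NonZero n}} → ℝ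
x ÷ℕ n = x *ℝ fromℚ (+ 1 / n)

_^ℝ_ : (n : ℕ) .{{_ : ℕ.NonZero n}} → ℝ → ℝ
n ^ℝ y = exp (y *ℝ ln n)

record Graph (n : ℕ) : Set where
  field
    adj        : Fin n → Fin n → Bool
    adj-sym    : ∀ i j → adj i j ≡ adj j i
    adj-irrefl : ∀ i → adj i i ≡ false

open Graph public

-- Each edge is listed once, with its smaller endpoint first.
edges : ∀ {n} → Graph n → List (Fin n × Fin n)
edges {n} G = filter (λ (i , j) → (i FinP.<? j) ×-dec T? (adj G i j))
  (cartesianProduct (allFin n) (allFin n))

-- The multiset of house values is a family h : Fin n → ℝ, and an allocation is a permutation π:
-- vertex i receives the house of value h (π i).
Envy : ∀ {n} → Graph n → (Fin n → ℝ) → Permutation′ n → ℝ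
Envy G h π = foldr _+ℝ_ 0ℝ
  (map (λ (i , j) → ∣ h (π ⟨$⟩ʳ i) -ℝ h (π ⟨$⟩ʳ j) ∣ℝ) (edges G))

allocations : ∀ n → List (Permutation′ n)
allocations zero    = Perm.id ∷ []
allocations (suc n) = cartesianProductWith (Perm.insert zero) (allFin (suc n)) (allocations n)

allocations-complete : ∀ {n} (π : Permutation′ n) → ∃[ ρ ] (ρ ∈ allocations n × π Perm.≈ ρ)
allocations-complete {zero}  π = Perm.id , here refl , λ ()
allocations-complete {suc n} π =
  let ρ , ρ∈ , π≈ρ = allocations-complete (Perm.remove zero π)
      j            = π ⟨$⟩ʳ zero
  in Perm.insert zero j ρ
   , ∈-cartesianProductWith⁺ (Perm.insert zero) (∈-allFin j) ρ∈
   , λ { zero    → refl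
       ; (suc i) → trans (Perm.punchIn-permute π zero i)
           (trans (cong (punchIn j) (π≈ρ i)) (sym (Perm.insert-punchIn zero j ρ i))) }

-- The fold starts at the identity allocation only because the minimum of an empty list is undefined.
minEnvy : ∀ {n} → Graph n → (Fin n → ℝ) → ℝ
minEnvy {n} G h = foldr _⊓ℝ_ (Envy G h Perm.id) (map (Envy G h) (allocations n))

-- One coin for each pair i < j: the vector holds the coins of the pairs {0 , j}, and the rest is
-- the table for the remaining vertices 1, …, n.
Coins : ℕ → Set
Coins zero    = ⊤
Coins (suc n) = Vec Bool n × Coins n

coinAdj : ∀ {n} → Coins n → Fin n → Fin n → Bool
coinAdj (r , ω) zero    zero    = false
coinAdj (r , ω) zero    (suc j) = lookup r j
coinAdj (r , ω) (suc i) zero    = lookup r i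
coinAdj (r , ω) (suc i) (suc j) = coinAdj ω i j

coinAdj-sym : ∀ {n} (ω : Coins n) i j → coinAdj ω i j ≡ coinAdj ω j i
coinAdj-sym (r , ω) zero    zero    = refl
coinAdj-sym (r , ω) zero    (suc j) = refl
coinAdj-sym (r , ω) (suc i) zero    = refl
coinAdj-sym (r , ω) (suc i) (suc j) = coinAdj-sym ω i j

coinAdj-irrefl : ∀ {n} (ω : Coins n) i → coinAdj ω i i ≡ false
coinAdj-irrefl (r , ω) zero    = refl
coinAdj-irrefl (r , ω) (suc i) = coinAdj-irrefl ω i

randomGraph : ∀ {n} → Coins n → Graph n
randomGraph ω = record
  { adj        = coinAdj ω
  ; adj-sym    = coinAdj-sym ω
  ; adj-irrefl = coinAdj-irrefl ω
  }

-- Expectations over independent fair coins.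
𝔼-row : ∀ m → (Vec Bool m → ℚ) → ℚ
𝔼-row zero    f = f []
𝔼-row (suc m) f = ½ * 𝔼-row m (λ r → f (true ∷ r)) + ½ * 𝔼-row m (λ r → f (false ∷ r))

𝔼 : ∀ n → (Coins n → ℚ) → ℚ
𝔼 zero    f = f tt
𝔼 (suc n) f = 𝔼-row n (λ r → 𝔼 n (λ ω → f (r , ω)))

Pr : ∀ {n} → (Coins n → Bool) → ℚ
Pr {n} A = 𝔼 n (λ ω → if A ω then 1ℚ else 0ℚ)

-- "E holds with probability at least p" for G ~ 𝒢(n,½). As E need not be decidable, this asks for a
-- decidable event A contained in E with Pr A ≥ p; on a finite sample space this is classically
-- the same as Pr E ≥ p.
WithProbability≥ : ∀ {n} → ℝ → (Graph n → Set) → Set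
WithProbability≥ {n} p E =
  Σ[ A ∈ (Coins n → Bool) ] ((∀ ω → T (A ω) → E (randomGraph ω)) × p ≤ℝ fromℚ (Pr A))

{-# OPTIONS --safe #-}

-- Writing |h i - h j| as an integral of indicators of level sets turns every envy into a combination
-- of cuts, so it suffices that each cut S of the random graph has (1 ± 2/τ) |S||Sᶜ|/2 edges, where
-- τ² ≈ n / (32 log₂ n); then every envy is within 1 ± 2/τ of half the sum of |h i - h j| over all pairs,
-- which does not depend on the allocation.
-- For the cuts, tilt the coins across S by 1 ± t with t = 1/(2τ). The resulting product Z_S has
-- mean 1 exactly, and exceeds n^(8 min(|S|, |Sᶜ|)) when S deviates. Hence one application of Markov's
-- inequality to Σ_S (x^|S| + x^|Sᶜ|) Z_S, with x about n^(-8), controls all cuts simultaneously.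
module Submission where

open import Defs
open import Algebra.Bundles using (CommutativeRing)
import Algebra.Properties.Semiring.Exp as Exp
import Algebra.Properties.Semiring.Sum as Sum
open import Data.Bool.Base using (Bool; true; false; T; if_then_else_; _xor_; _∧_; not)
open import Data.Bool.Properties using (T?)
open import Data.Fin.Base using (Fin; zero; suc)
import Data.Fin.Properties as FinP
open import Data.Fin.Permutation as Perm using (Permutation′; _⟨$⟩ʳ_)
open import Data.Integer.Base using (+_; -[1+_])
open import Data.List.Base as List using (List; []; _∷_; map; foldr; filter; allFin; cartesianProduct; _++_)
import Data.List.Properties as ListP
open import Data.Nat.Base as ℕ using (ℕ; zero; suc; _∸_; NonZero)
import Data.Nat.Properties as ℕP
import Data.Nat.Solver as ℕS
open import Data.Product.Base using (Σ-syntax; ∃-syntax; _×_; _,_; proj₁; proj₂)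
open import Data.Rational.Base hiding (NonZero)
open import Data.Rational.Properties
open import Data.Rational.Solver using (module +-*-Solver)
open import Data.Sum.Base using (inj₁; inj₂)
open import Data.Unit.Base using (tt)
open import Data.Vec.Base using (Vec; []; _∷_; lookup; tabulate)
open import Data.Vec.Properties using (lookup∘tabulate)
open import Function.Base using (_∘_)
open import Relation.Binary.PropositionalEquality
open import Relation.Nullary using (yes; no; does; contradiction; ¬_)
open import Relation.Nullary.Decidable using (isYes; _×-dec_)
open import Relation.Unary using (Pred; Decidable)

open import Algebra.Definitions.RawSemiring +-*-rawSemiring using (_^_)
open CommutativeRing +-*-commutativeRing using (semiring)
open Sum semiring using (sum; sum-cong-≗; ∑-distrib-+; sum-permute; *-distribˡ-sum)
open Exp semiring using (^-homo-*)
open +-*-Solver using (solve; _:=_; _:+_; _:*_; _:-_; :-_; con)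
open ℕS.+-*-Solver using () renaming (solve to solveℕ; _:=_ to _⊜_; _:+_ to _⊕_; _:*_ to _⊗_; con to conℕ)

-- The obstacle is that there are 2^n cuts and the sparsest separate only about n pairs, too few for
-- a deviation bound that survives a union over all cuts. However, at most n^k vertex sets have size
-- k, and for k ≤ n/2 each separates at least kn/2 pairs, so a relative deviation 2/τ costs a factor
-- exponential in kn/τ². Both exponents are linear in k, so one choice of τ serves every k: n/τ²
-- must be of order ln n, which is the origin of the rate √(ln n / n).
--
-- The good event mentions only the coins. It is therefore decidable, and one event serves all house
-- values at once. The comparison of envies is then an exact inequality between rationals at every
-- index of the Cauchy sequences; limits matter only where τ is compared with `ln` and `√`. The
-- concentration argument also stays rational: Bernoulli's inequality and N-th powers replace
-- estimates of exponentials.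

-- Sums over unordered pairs and their invariance under permutations.

pairΣ : ∀ n → (Fin n → Fin n → ℚ) → ℚ
pairΣ zero    φ = 0ℚ
pairΣ (suc n) φ = sum (λ j → φ zero (suc j)) + pairΣ n (λ i j → φ (suc i) (suc j))

pairΣ-cong : ∀ n {φ ψ : Fin n → Fin n → ℚ} → (∀ i j → φ i j ≡ ψ i j) → pairΣ n φ ≡ pairΣ n ψ
pairΣ-cong zero    e = refl
pairΣ-cong (suc n) e = cong₂ _+_ (sum-cong-≗ (λ j → e zero (suc j))) (pairΣ-cong n (λ i j → e (suc i) (suc j)))

+-interchange : ∀ a b c d → (a + b) + (c + d) ≡ (a + c) + (b + d)
+-interchange = solve 4 (λ a b c d → (a :+ b) :+ (c :+ d) := (a :+ c) :+ (b :+ d)) refl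

pairΣ-+ : ∀ n (φ ψ : Fin n → Fin n → ℚ) → pairΣ n (λ i j → φ i j + ψ i j) ≡ pairΣ n φ + pairΣ n ψ
pairΣ-+ zero    φ ψ = refl
pairΣ-+ (suc n) φ ψ = trans
  (cong₂ _+_ (∑-distrib-+ (λ j → φ zero (suc j)) (λ j → ψ zero (suc j))) (pairΣ-+ n _ _))
  (+-interchange (sum (λ j → φ zero (suc j))) (sum (λ j → ψ zero (suc j)))
    (pairΣ n (λ i j → φ (suc i) (suc j))) (pairΣ n (λ i j → ψ (suc i) (suc j))))

pairΣ-* : ∀ n c (φ : Fin n → Fin n → ℚ) → pairΣ n (λ i j → c * φ i j) ≡ c * pairΣ n φ
pairΣ-* zero    c φ = sym (*-zeroʳ c)
pairΣ-* (suc n) c φ = trans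
  (cong₂ _+_ (sym (*-distribˡ-sum c (λ j → φ zero (suc j)))) (pairΣ-* n c _))
  (sym (*-distribˡ-+ c (sum (λ j → φ zero (suc j))) (pairΣ n (λ i j → φ (suc i) (suc j)))))

0≤sum : ∀ {n} {f : Fin n → ℚ} → (∀ i → 0ℚ ≤ f i) → 0ℚ ≤ sum f
0≤sum {zero}  h = ≤-refl
0≤sum {suc n} h = 0≤+ (h zero) (0≤sum (h ∘ suc))

0≤pairΣ : ∀ n {φ : Fin n → Fin n → ℚ} → (∀ i j → 0ℚ ≤ φ i j) → 0ℚ ≤ pairΣ n φ
0≤pairΣ zero    h = ≤-refl
0≤pairΣ (suc n) h = 0≤+ (0≤sum (λ j → h zero (suc j))) (0≤pairΣ n (λ i j → h (suc i) (suc j)))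

sum-sum≡pairΣ : ∀ n {φ : Fin n → Fin n → ℚ} → (∀ i j → φ i j ≡ φ j i) → (∀ i → φ i i ≡ 0ℚ) →
                sum (λ i → sum (φ i)) ≡ pairΣ n φ + pairΣ n φ
sum-sum≡pairΣ zero    s d = refl
sum-sum≡pairΣ (suc n) {φ} s d = begin
  (φ zero zero + R) + sum (λ i → φ (suc i) zero + sum (λ j → φ (suc i) (suc j)))
    ≡⟨ cong₂ _+_ (trans (cong (_+ R) (d zero)) (+-identityˡ R))
         (trans (∑-distrib-+ (λ i → φ (suc i) zero) (λ i → sum (λ j → φ (suc i) (suc j))))
           (cong₂ _+_ (sum-cong-≗ (λ i → s (suc i) zero))
             (sum-sum≡pairΣ n (λ i j → s (suc i) (suc j)) (λ i → d (suc i))))) ⟩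
  R + (R + (P + P)) ≡⟨ solve 2 (λ r p → r :+ (r :+ (p :+ p)) := (r :+ p) :+ (r :+ p)) refl R P ⟩
  (R + P) + (R + P) ∎
  where
  open ≡-Reasoning
  R = sum (λ j → φ zero (suc j))
  P = pairΣ n (λ i j → φ (suc i) (suc j))

double-injective : ∀ {p q} → p + p ≡ q + q → p ≡ q
double-injective {p} {q} e = trans (half p) (trans (cong (_* ½) e) (sym (half q)))
  where
  half : ∀ p → p ≡ (p + p) * ½
  half = solve 1 (λ p → p := (p :+ p) :* con ½) refl

-- A permutation does not preserve the condition i < j, so the sum is doubled to one over all
-- ordered pairs, where each index can be permuted separately.
pairΣ-permute : ∀ n (φ : Fin n → Fin n → ℚ) (π : Permutation′ n) →
                (∀ i j → φ i j ≡ φ j i) → (∀ i → φ i i ≡ 0ℚ) →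
                pairΣ n (λ i j → φ (π ⟨$⟩ʳ i) (π ⟨$⟩ʳ j)) ≡ pairΣ n φ
pairΣ-permute n φ π s d = double-injective (begin
  pairΣ n φπ + pairΣ n φπ                              ≡⟨ sum-sum≡pairΣ n (λ i j → s _ _) (λ i → d _) ⟨
  sum (λ i → sum (φπ i))                               ≡⟨ sum-cong-≗ (λ i → sum-permute (φ (π ⟨$⟩ʳ i)) π) ⟨
  sum (λ i → sum (φ (π ⟨$⟩ʳ i)))                       ≡⟨ sum-permute (λ i → sum (φ i)) π ⟨
  sum (λ i → sum (φ i))                                ≡⟨ sum-sum≡pairΣ n s d ⟩
  pairΣ n φ + pairΣ n φ                                ∎)
  where
  open ≡-Reasoning
  φπ : Fin n → Fin n → ℚ
  φπ i j = φ (π ⟨$⟩ʳ i) (π ⟨$⟩ʳ j)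

∣-∣-sym : ∀ p q → ∣ p - q ∣ ≡ ∣ q - p ∣
∣-∣-sym p q = trans (sym (∣-p∣≡∣p∣ (p - q)))
  (cong ∣_∣ (solve 2 (λ p q → :- (p :- q) := q :- p) refl p q))

∣-∣-refl : ∀ p → ∣ p - p ∣ ≡ 0ℚ
∣-∣-refl p = cong ∣_∣ (+-inverseʳ p)

spread : ∀ n → (Fin n → ℚ) → ℚ
spread n h = pairΣ n (λ i j → ∣ h i - h j ∣)

spread-permute : ∀ n h (π : Permutation′ n) → spread n (h ∘ (π ⟨$⟩ʳ_)) ≡ spread n h
spread-permute n h π = pairΣ-permute n (λ i j → ∣ h i - h j ∣) π (λ i j → ∣-∣-sym (h i) (h j)) (λ i → ∣-∣-refl (h i))

-- Layer cake: from cuts to arbitrary rational values.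

𝟙 : Bool → ℚ
𝟙 b = if b then 1ℚ else 0ℚ

0<ᵇ : ℕ → Bool
0<ᵇ zero    = false
0<ᵇ (suc _) = true

-- The truncated predecessor removes the lowest layer, which contributes 1 exactly when it contains
-- one of the two values.
∣ι-ι∣-peel : ∀ a b → ∣ ι a - ι b ∣ ≡ 𝟙 (0<ᵇ a xor 0<ᵇ b) + ∣ ι (ℕ.pred a) - ι (ℕ.pred b) ∣
∣ι-ι∣-peel zero zero = refl
∣ι-ι∣-peel zero (suc b) = trans (eq (suc b)) (trans (ι-suc b) (cong (λ z → 1ℚ + z) (sym (eq b))))
  where
  eq : ∀ b → ∣ ι 0 - ι b ∣ ≡ ι b
  eq b = trans (∣-∣-sym 0ℚ (ι b)) (trans (cong ∣_∣ (+-identityʳ (ι b))) (0≤p⇒∣p∣≡p (0≤ι b)))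
∣ι-ι∣-peel (suc a) zero = trans (eq (suc a)) (trans (ι-suc a) (cong (λ z → 1ℚ + z) (sym (eq a))))
  where
  eq : ∀ b → ∣ ι b - ι 0 ∣ ≡ ι b
  eq b = trans (cong ∣_∣ (+-identityʳ (ι b))) (0≤p⇒∣p∣≡p (0≤ι b))
∣ι-ι∣-peel (suc a) (suc b) = trans (cong ∣_∣ (trans (cong₂ _-_ (ι-suc a) (ι-suc b))
    (solve 2 (λ a b → (con 1ℚ :+ a) :- (con 1ℚ :+ b) := a :- b) refl (ι a) (ι b))))
  (sym (+-identityˡ ∣ ι a - ι b ∣))

cutForm : ∀ {n} → (Fin n → Fin n → ℚ) → Vec Bool n → ℚ
cutForm {n} w S = pairΣ n (λ i j → w i j * 𝟙 (lookup S i xor lookup S j))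

-- Layer cake: on ℕ-valued h the form Σ w |h i - h j| is the sum of the cut forms of the level sets
-- {h > s}; a rational h is reduced to this case by a common denominator and a translation.
module NonnegativeCuts {n} (w : Fin n → Fin n → ℚ) (cut≥0 : ∀ S → 0ℚ ≤ cutForm w S) where

  onℕ : ∀ B (f : Fin n → ℕ) → (∀ i → f i ℕ.≤ B) → 0ℚ ≤ pairΣ n (λ i j → w i j * ∣ ι (f i) - ι (f j) ∣)
  onℕ zero f f≤0 = ≤-reflexive (sym (trans
    (pairΣ-cong n (λ i j → trans (cong (λ z → w i j * z) (trans (cong₂ (λ a b → ∣ ι a - ι b ∣) (f≡0 i) (f≡0 j)) (∣-∣-refl 0ℚ))) (trans (*-zeroʳ (w i j)) (sym (*-zeroˡ 0ℚ)))))
    (trans (pairΣ-* n 0ℚ (λ _ _ → 0ℚ)) (*-zeroˡ (pairΣ n (λ _ _ → 0ℚ))))))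
    where
    f≡0 : ∀ i → f i ≡ 0
    f≡0 i = ℕP.n≤0⇒n≡0 (f≤0 i)
  onℕ (suc B) f f≤ = subst (0ℚ ≤_) (sym eq)
    (0≤+ (cut≥0 S) (onℕ B (ℕ.pred ∘ f) (λ i → ℕP.pred-mono-≤ (f≤ i))))
    where
    open ≡-Reasoning
    S = tabulate (0<ᵇ ∘ f)
    rest = pairΣ n (λ i j → w i j * ∣ ι (ℕ.pred (f i)) - ι (ℕ.pred (f j)) ∣)
    eq : pairΣ n (λ i j → w i j * ∣ ι (f i) - ι (f j) ∣) ≡ cutForm w S + rest
    eq = begin
      pairΣ n (λ i j → w i j * ∣ ι (f i) - ι (f j) ∣)
        ≡⟨ pairΣ-cong n (λ i j → trans (cong (λ z → w i j * z) (∣ι-ι∣-peel (f i) (f j))) (*-distribˡ-+ (w i j) _ _)) ⟩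
      pairΣ n (λ i j → w i j * 𝟙 (0<ᵇ (f i) xor 0<ᵇ (f j)) + w i j * ∣ ι (ℕ.pred (f i)) - ι (ℕ.pred (f j)) ∣)
        ≡⟨ pairΣ-+ n _ _ ⟩
      pairΣ n (λ i j → w i j * 𝟙 (0<ᵇ (f i) xor 0<ᵇ (f j))) + rest
        ≡⟨ cong (_+ rest) (pairΣ-cong n (λ i j → cong₂ (λ a b → w i j * 𝟙 (a xor b)) (lookup∘tabulate (0<ᵇ ∘ f) i) (lookup∘tabulate (0<ᵇ ∘ f) j))) ⟨
      cutForm w S + rest ∎

  bound : ∀ {m} (f : Fin m → ℕ) → ∃[ B ] (∀ i → f i ℕ.≤ B)
  bound {zero}  f = 0 , λ ()
  bound {suc m} f = let B , h = bound (f ∘ suc) in f zero ℕ.+ B ,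
    λ { zero → ℕP.m≤m+n (f zero) B ; (suc i) → ℕP.≤-trans (h i) (ℕP.m≤n+m B (f zero)) }

  commonDenominator : ∀ {m} (g : Fin m → ℚ) → (∀ i → 0ℚ ≤ g i) →
                      ∃[ D ] Σ[ f ∈ (Fin m → ℕ) ] (∀ i → g i * ι (suc D) ≡ ι (f i))
  commonDenominator {zero}  g g≥0 = 0 , (λ ()) , λ ()
  commonDenominator {suc m} g g≥0 with g zero in eq | g≥0 zero | commonDenominator (g ∘ suc) (g≥0 ∘ suc)
  ... | mkℚ -[1+ _ ] _ _ | *≤* () | _
  ... | mkℚ (+ a) d c | _ | D , f , h = mesh d D , f′ , h′
    where
    f′ : Fin (suc m) → ℕ
    f′ zero    = a ℕ.* suc D
    f′ (suc i) = f i ℕ.* suc d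
    h′ : ∀ i → g i * ι (suc (mesh d D)) ≡ ι (f′ i)
    h′ zero = trans (cong₂ _*_ eq (ι-* (suc d) (suc D))) (trans (sym (*-assoc (mkℚ (+ a) d c) (ι (suc d)) (ι (suc D))))
      (trans (cong (_* ι (suc D)) (num-den a d c)) (sym (ι-* a (suc D)))))
    h′ (suc i) = trans (cong (g (suc i) *_) (ι-* (suc d) (suc D)))
      (trans (solve 3 (λ g d D → g :* (d :* D) := (g :* D) :* d) refl (g (suc i)) (ι (suc d)) (ι (suc D)))
        (trans (cong (_* ι (suc d)) (h i)) (sym (ι-* (f i) (suc d)))))

  lowerBound : ∀ {m} (h : Fin m → ℚ) → ∃[ b ] (∀ i → 0ℚ ≤ h i + b)
  lowerBound {zero}  h = 0ℚ , λ ()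
  lowerBound {suc m} h = let b , h≥ = lowerBound (h ∘ suc) in b ⊔ - h zero ,
    λ { zero → subst (_≤ h zero + (b ⊔ - h zero)) (+-inverseʳ (h zero)) (+-monoʳ-≤ (h zero) (p≤q⊔p b (- h zero)))
      ; (suc i) → ≤-trans (h≥ i) (+-monoʳ-≤ (h (suc i)) (p≤p⊔q b (- h zero))) }

  onℚ : ∀ (h : Fin n → ℚ) → 0ℚ ≤ pairΣ n (λ i j → w i j * ∣ h i - h j ∣)
  onℚ h with lowerBound h
  ... | b , h≥ with commonDenominator (λ i → h i + b) h≥
  ... | D , f , fh = *-cancel-≤ (ι (suc D)) (0<ι D) (subst₂ _≤_ (sym (*-zeroˡ (ι (suc D)))) eq (onℕ (proj₁ (bound f)) f (proj₂ (bound f))))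
    where
    open ≡-Reasoning
    scale : ∀ i j → ∣ ι (f i) - ι (f j) ∣ ≡ ι (suc D) * ∣ h i - h j ∣
    scale i j = begin
      ∣ ι (f i) - ι (f j) ∣       ≡⟨ cong₂ (λ a b → ∣ a - b ∣) (fh i) (fh j) ⟨
      ∣ (h i + b) * ι (suc D) - (h j + b) * ι (suc D) ∣ ≡⟨ cong ∣_∣ (solve 4 (λ x y b D → (x :+ b) :* D :- (y :+ b) :* D := D :* (x :- y)) refl (h i) (h j) b (ι (suc D))) ⟩
      ∣ ι (suc D) * (h i - h j) ∣ ≡⟨ ∣p*q∣≡∣p∣*∣q∣ (ι (suc D)) (h i - h j) ⟩
      ∣ ι (suc D) ∣ * ∣ h i - h j ∣ ≡⟨ cong (_* ∣ h i - h j ∣) (0≤p⇒∣p∣≡p (0≤ι (suc D))) ⟩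
      ι (suc D) * ∣ h i - h j ∣ ∎
    eq : pairΣ n (λ i j → w i j * ∣ ι (f i) - ι (f j) ∣) ≡ pairΣ n (λ i j → w i j * ∣ h i - h j ∣) * ι (suc D)
    eq = begin
      pairΣ n (λ i j → w i j * ∣ ι (f i) - ι (f j) ∣)
        ≡⟨ pairΣ-cong n (λ i j → trans (cong (λ z → w i j * z) (scale i j)) (solve 3 (λ w D x → w :* (D :* x) := D :* (w :* x)) refl (w i j) (ι (suc D)) ∣ h i - h j ∣)) ⟩
      pairΣ n (λ i j → ι (suc D) * (w i j * ∣ h i - h j ∣)) ≡⟨ pairΣ-* n (ι (suc D)) _ ⟩
      ι (suc D) * pairΣ n (λ i j → w i j * ∣ h i - h j ∣) ≡⟨ *-comm (ι (suc D)) _ ⟩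
      pairΣ n (λ i j → w i j * ∣ h i - h j ∣) * ι (suc D) ∎

-- Counting coins across a cut.

hit : Bool → Bool → Bool → ℕ
hit b cut e = if cut ∧ not (b xor e) then 1 else 0

rowCount : ∀ {m} → Bool → Bool → Vec Bool m → Vec Bool m → ℕ
rowCount b c []      []      = 0
rowCount b c (d ∷ S) (e ∷ r) = hit b (c xor d) e ℕ.+ rowCount b c S r

-- The number of pairs separated by S whose coin shows b.
cutCount : ∀ {n} → Bool → Vec Bool n → Coins n → ℕ
cutCount b []      tt      = 0
cutCount b (c ∷ S) (r , ω) = rowCount b c S r ℕ.+ cutCount b S ω

module _ (v : Bool → ℚ) where
  private
    V : ℕ → ℕ → ℚ
    V a b = v true * ι a + v false * ι b

    V-+ : ∀ a b a′ b′ → V a b + V a′ b′ ≡ V (a ℕ.+ a′) (b ℕ.+ b′)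
    V-+ a b a′ b′ = trans
      (solve 6 (λ t f a b a′ b′ → (t :* a :+ f :* b) :+ (t :* a′ :+ f :* b′) := t :* (a :+ a′) :+ f :* (b :+ b′)) refl (v true) (v false) (ι a) (ι b) (ι a′) (ι b′))
      (sym (cong₂ (λ x y → v true * x + v false * y) (ι-+ a a′) (ι-+ b b′)))

    cell : ∀ x e → v e * 𝟙 x ≡ V (hit true x e) (hit false x e)
    cell false e     = solve 3 (λ e t f → e :* con 0ℚ := t :* con 0ℚ :+ f :* con 0ℚ) refl (v e) (v true) (v false)
    cell true  true  = solve 2 (λ t f → t :* con 1ℚ := t :* con 1ℚ :+ f :* con 0ℚ) refl (v true) (v false)
    cell true  false = solve 2 (λ t f → f :* con 1ℚ := t :* con 0ℚ :+ f :* con 1ℚ) refl (v true) (v false)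

    zeros : 0ℚ ≡ V 0 0
    zeros = solve 2 (λ t f → con 0ℚ := t :* con 0ℚ :+ f :* con 0ℚ) refl (v true) (v false)

    row : ∀ {m} c (S r : Vec Bool m) →
          sum (λ j → v (lookup r j) * 𝟙 (c xor lookup S j)) ≡ V (rowCount true c S r) (rowCount false c S r)
    row c []      []      = zeros
    row c (d ∷ S) (e ∷ r) = trans (cong₂ _+_ (cell (c xor d) e) (row c S r))
      (V-+ (hit true (c xor d) e) (hit false (c xor d) e) (rowCount true c S r) (rowCount false c S r))

  -- For weights that depend only on the coin, nonnegativity of a cut form thus becomes a linear
  -- inequality between two counts.
  cutForm-coins : ∀ {n} (S : Vec Bool n) (ω : Coins n) →
    cutForm (λ i j → v (coinAdj ω i j)) S ≡ v true * ι (cutCount true S ω) + v false * ι (cutCount false S ω)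
  cutForm-coins []      tt      = zeros
  cutForm-coins (c ∷ S) (r , ω) = trans (cong₂ _+_ (row c S r) (cutForm-coins S ω))
    (V-+ (rowCount true c S r) (rowCount false c S r) (cutCount true S ω) (cutCount false S ω))

size : ∀ {n} → Bool → Vec Bool n → ℕ
size b []      = 0
size b (c ∷ S) = (if not (b xor c) then 1 else 0) ℕ.+ size b S

sizes : ∀ {n} (S : Vec Bool n) → size true S ℕ.+ size false S ≡ n
sizes []          = refl
sizes (true ∷ S)  = cong suc (sizes S)
sizes (false ∷ S) = trans (ℕP.+-suc (size true S) (size false S)) (cong suc (sizes S))

+-interchangeℕ : ∀ a b c d → (a ℕ.+ b) ℕ.+ (c ℕ.+ d) ≡ (a ℕ.+ c) ℕ.+ (b ℕ.+ d)
+-interchangeℕ = solveℕ 4 (λ a b c d → (a ⊕ b) ⊕ (c ⊕ d) ⊜ (a ⊕ c) ⊕ (b ⊕ d)) refl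

-- A new vertex on side `c` is separated exactly from the vertices on side `not c`.
rowCount-total : ∀ {m} c (S r : Vec Bool m) → rowCount true c S r ℕ.+ rowCount false c S r ≡ size (not c) S
rowCount-total c []      []      = refl
rowCount-total c (d ∷ S) (e ∷ r) = trans
  (+-interchangeℕ (hit true (c xor d) e) (rowCount true c S r) (hit false (c xor d) e) (rowCount false c S r))
  (cong₂ ℕ._+_ (cell c d e) (rowCount-total c S r))
  where
  cell : ∀ c d e → hit true (c xor d) e ℕ.+ hit false (c xor d) e ≡ (if not (not c xor d) then 1 else 0)
  cell true  true  e     = refl
  cell false false e     = refl
  cell true  false true  = refl
  cell true  false false = refl
  cell false true  true  = refl
  cell false true  false = refl

cutCount-total : ∀ {n} (S : Vec Bool n) ω → cutCount true S ω ℕ.+ cutCount false S ω ≡ size true S ℕ.* size false S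
cutCount-total []      tt      = refl
cutCount-total (c ∷ S) (r , ω) = trans
  (+-interchangeℕ (rowCount true c S r) (cutCount true S ω) (rowCount false c S r) (cutCount false S ω))
  (trans (cong₂ ℕ._+_ (rowCount-total c S r) (cutCount-total S ω)) (step c))
  where
  step : ∀ c → size (not c) S ℕ.+ size true S ℕ.* size false S ≡ size true (c ∷ S) ℕ.* size false (c ∷ S)
  step true  = refl
  step false = sym (ℕP.*-suc (size true S) (size false S))

-- Expectations, and likelihood ratios of mean 1.

½+½ : ∀ x → ½ * x + ½ * x ≡ x
½+½ = solve 1 (λ x → con ½ :* x :+ con ½ :* x := x) refl

½*-mono : ∀ {x y} → x ≤ y → ½ * x ≤ ½ * y
½*-mono = *-monoˡ-≤-nonNeg ½

𝔼-row-mono : ∀ m {f g : Vec Bool m → ℚ} → (∀ r → f r ≤ g r) → 𝔼-row m f ≤ 𝔼-row m g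
𝔼-row-mono zero    h = h []
𝔼-row-mono (suc m) h = +-mono-≤ (½*-mono (𝔼-row-mono m (h ∘ (true ∷_)))) (½*-mono (𝔼-row-mono m (h ∘ (false ∷_))))

𝔼-mono : ∀ n {f g : Coins n → ℚ} → (∀ ω → f ω ≤ g ω) → 𝔼 n f ≤ 𝔼 n g
𝔼-mono zero    h = h tt
𝔼-mono (suc n) h = 𝔼-row-mono n (λ r → 𝔼-mono n (λ ω → h (r , ω)))

𝔼-row-cong : ∀ m {f g : Vec Bool m → ℚ} → (∀ r → f r ≡ g r) → 𝔼-row m f ≡ 𝔼-row m g
𝔼-row-cong m h = ≤-antisym (𝔼-row-mono m (≤-reflexive ∘ h)) (𝔼-row-mono m (≤-reflexive ∘ sym ∘ h))

𝔼-row-+ : ∀ m (f g : Vec Bool m → ℚ) → 𝔼-row m (λ r → f r + g r) ≡ 𝔼-row m f + 𝔼-row m g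
𝔼-row-+ zero    f g = refl
𝔼-row-+ (suc m) f g = trans
  (cong₂ (λ a b → ½ * a + ½ * b) (𝔼-row-+ m (f ∘ (true ∷_)) (g ∘ (true ∷_))) (𝔼-row-+ m (f ∘ (false ∷_)) (g ∘ (false ∷_))))
  (solve 4 (λ a b c d → con ½ :* (a :+ b) :+ con ½ :* (c :+ d) := (con ½ :* a :+ con ½ :* c) :+ (con ½ :* b :+ con ½ :* d)) refl
    (𝔼-row m (f ∘ (true ∷_))) (𝔼-row m (g ∘ (true ∷_))) (𝔼-row m (f ∘ (false ∷_))) (𝔼-row m (g ∘ (false ∷_))))

𝔼-row-* : ∀ m c (f : Vec Bool m → ℚ) → 𝔼-row m (λ r → c * f r) ≡ c * 𝔼-row m f
𝔼-row-* zero    c f = refl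
𝔼-row-* (suc m) c f = trans
  (cong₂ (λ a b → ½ * a + ½ * b) (𝔼-row-* m c (f ∘ (true ∷_))) (𝔼-row-* m c (f ∘ (false ∷_))))
  (solve 3 (λ c a b → con ½ :* (c :* a) :+ con ½ :* (c :* b) := c :* (con ½ :* a :+ con ½ :* b)) refl
    c (𝔼-row m (f ∘ (true ∷_))) (𝔼-row m (f ∘ (false ∷_))))

𝔼-+ : ∀ n (f g : Coins n → ℚ) → 𝔼 n (λ ω → f ω + g ω) ≡ 𝔼 n f + 𝔼 n g
𝔼-+ zero    f g = refl
𝔼-+ (suc n) f g = trans (𝔼-row-cong n (λ r → 𝔼-+ n _ _))
  (𝔼-row-+ n (λ r → 𝔼 n (λ ω → f (r , ω))) (λ r → 𝔼 n (λ ω → g (r , ω))))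

𝔼-* : ∀ n c (f : Coins n → ℚ) → 𝔼 n (λ ω → c * f ω) ≡ c * 𝔼 n f
𝔼-* zero    c f = refl
𝔼-* (suc n) c f = trans (𝔼-row-cong n (λ r → 𝔼-* n c _)) (𝔼-row-* n c (λ r → 𝔼 n (λ ω → f (r , ω))))

𝔼-row-const : ∀ m c → 𝔼-row m (λ _ → c) ≡ c
𝔼-row-const zero    c = refl
𝔼-row-const (suc m) c = trans (½+½ (𝔼-row m (λ _ → c))) (𝔼-row-const m c)

𝔼-const : ∀ n c → 𝔼 n (λ _ → c) ≡ c
𝔼-const zero    c = refl
𝔼-const (suc n) c = trans (𝔼-row-cong n (λ _ → 𝔼-const n c)) (𝔼-row-const n c)

factor : ℚ → ℚ → Bool → Bool → ℚ
factor p q cut e = if cut then (if e then p else q) else 1ℚ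

rowProduct : ∀ {m} → ℚ → ℚ → Bool → Vec Bool m → Vec Bool m → ℚ
rowProduct p q c []      []      = 1ℚ
rowProduct p q c (d ∷ S) (e ∷ r) = factor p q (c xor d) e * rowProduct p q c S r

-- The likelihood ratio of the bias (p/2, q/2) against the fair coin on the pairs separated by S.
likelihood : ∀ {n} → ℚ → ℚ → Vec Bool n → Coins n → ℚ
likelihood p q []      tt      = 1ℚ
likelihood p q (c ∷ S) (r , ω) = rowProduct p q c S r * likelihood p q S ω

module _ (p q : ℚ) where
  private
    M : ℕ → ℕ → ℚ
    M a b = p ^ a * q ^ b

    M-* : ∀ a b a′ b′ → M a b * M a′ b′ ≡ M (a ℕ.+ a′) (b ℕ.+ b′)
    M-* a b a′ b′ = trans
      (solve 4 (λ x y z w → x :* y :* (z :* w) := x :* z :* (y :* w)) refl (p ^ a) (q ^ b) (p ^ a′) (q ^ b′))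
      (sym (cong₂ _*_ (^-homo-* p a a′) (^-homo-* q b b′)))

    cell : ∀ x e → factor p q x e ≡ M (hit true x e) (hit false x e)
    cell false e     = refl
    cell true  true  = solve 1 (λ p → p := p :* con 1ℚ :* con 1ℚ) refl p
    cell true  false = solve 1 (λ q → q := con 1ℚ :* (q :* con 1ℚ)) refl q

    row : ∀ {m} c (S r : Vec Bool m) → rowProduct p q c S r ≡ M (rowCount true c S r) (rowCount false c S r)
    row c []      []      = refl
    row c (d ∷ S) (e ∷ r) = trans (cong₂ _*_ (cell (c xor d) e) (row c S r))
      (M-* (hit true (c xor d) e) (hit false (c xor d) e) (rowCount true c S r) (rowCount false c S r))

  likelihood-count : ∀ {n} (S : Vec Bool n) ω → likelihood p q S ω ≡ p ^ cutCount true S ω * q ^ cutCount false S ω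
  likelihood-count []      tt      = refl
  likelihood-count (c ∷ S) (r , ω) = trans (cong₂ _*_ (row c S r) (likelihood-count S ω))
    (M-* (rowCount true c S r) (rowCount false c S r) (cutCount true S ω) (cutCount false S ω))

  module _ (p+q : ½ * p + ½ * q ≡ 1ℚ) where
    private
      cell-mean : ∀ x → ½ * factor p q x true + ½ * factor p q x false ≡ 1ℚ
      cell-mean true  = p+q
      cell-mean false = refl

      row-mean : ∀ {m} c (S : Vec Bool m) → 𝔼-row m (rowProduct p q c S) ≡ 1ℚ
      row-mean         c []      = refl
      row-mean {suc m} c (d ∷ S) = trans
        (cong₂ (λ a b → ½ * a + ½ * b) (half true) (half false))
        (cell-mean (c xor d))
        where
        half : ∀ e → 𝔼-row m (λ r → factor p q (c xor d) e * rowProduct p q c S r) ≡ factor p q (c xor d) e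
        half e = trans (𝔼-row-* m (factor p q (c xor d) e) (rowProduct p q c S))
          (trans (cong (factor p q (c xor d) e *_) (row-mean c S)) (*-identityʳ (factor p q (c xor d) e)))

    -- The factors read different coins and each has mean 1, either by `p+q` or because it is
    -- constantly 1. Independence is built into the nested expectations, so the factors are
    -- integrated out one at a time.
    𝔼-likelihood : ∀ n (S : Vec Bool n) → 𝔼 n (likelihood p q S) ≡ 1ℚ
    𝔼-likelihood zero    []      = refl
    𝔼-likelihood (suc n) (c ∷ S) = trans
      (𝔼-row-cong n (λ r → trans (𝔼-* n (rowProduct p q c S r) (likelihood p q S))
        (trans (cong (rowProduct p q c S r *_) (𝔼-likelihood n S)) (*-identityʳ (rowProduct p q c S r)))))
      (row-mean c S)

  0≤likelihood : 0ℚ ≤ p → 0ℚ ≤ q → ∀ {n} (S : Vec Bool n) ω → 0ℚ ≤ likelihood p q S ω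
  0≤likelihood 0≤p 0≤q S ω = subst (0ℚ ≤_) (sym (likelihood-count S ω))
    (0≤* (0≤^ 0≤p (cutCount true S ω)) (0≤^ 0≤q (cutCount false S ω)))

-- Weighted sums over all cuts.

subsetΣ : ∀ n → (Vec Bool n → ℚ) → ℚ
subsetΣ zero    f = f []
subsetΣ (suc n) f = subsetΣ n (f ∘ (true ∷_)) + subsetΣ n (f ∘ (false ∷_))

subsetΣ-cong : ∀ n {f g : Vec Bool n → ℚ} → (∀ S → f S ≡ g S) → subsetΣ n f ≡ subsetΣ n g
subsetΣ-cong zero    h = h []
subsetΣ-cong (suc n) h = cong₂ _+_ (subsetΣ-cong n (h ∘ (true ∷_))) (subsetΣ-cong n (h ∘ (false ∷_)))

subsetΣ-+ : ∀ n (f g : Vec Bool n → ℚ) → subsetΣ n (λ S → f S + g S) ≡ subsetΣ n f + subsetΣ n g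
subsetΣ-+ zero    f g = refl
subsetΣ-+ (suc n) f g = trans
  (cong₂ _+_ (subsetΣ-+ n (f ∘ (true ∷_)) (g ∘ (true ∷_))) (subsetΣ-+ n (f ∘ (false ∷_)) (g ∘ (false ∷_))))
  (+-interchange (subsetΣ n (f ∘ (true ∷_))) (subsetΣ n (g ∘ (true ∷_)))
    (subsetΣ n (f ∘ (false ∷_))) (subsetΣ n (g ∘ (false ∷_))))

subsetΣ-* : ∀ n c (f : Vec Bool n → ℚ) → subsetΣ n (λ S → c * f S) ≡ c * subsetΣ n f
subsetΣ-* zero    c f = refl
subsetΣ-* (suc n) c f = trans
  (cong₂ _+_ (subsetΣ-* n c (f ∘ (true ∷_))) (subsetΣ-* n c (f ∘ (false ∷_))))
  (sym (*-distribˡ-+ c (subsetΣ n (f ∘ (true ∷_))) (subsetΣ n (f ∘ (false ∷_)))))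

0≤subsetΣ : ∀ n {f : Vec Bool n → ℚ} → (∀ S → 0ℚ ≤ f S) → 0ℚ ≤ subsetΣ n f
0≤subsetΣ zero    h = h []
0≤subsetΣ (suc n) h = 0≤+ (0≤subsetΣ n (h ∘ (true ∷_))) (0≤subsetΣ n (h ∘ (false ∷_)))

p≤p+q : ∀ {p q} → 0ℚ ≤ q → p ≤ p + q
p≤p+q 0≤q = ≤-by 0≤q refl

p≤q+p : ∀ {p q} → 0ℚ ≤ q → p ≤ q + p
p≤q+p {p} {q} 0≤q = ≤-by 0≤q (+-comm q p)

term≤subsetΣ : ∀ n {f : Vec Bool n → ℚ} → (∀ S → 0ℚ ≤ f S) → ∀ S → f S ≤ subsetΣ n f
term≤subsetΣ zero    h []          = ≤-refl
term≤subsetΣ (suc n) h (true ∷ S)  = ≤-trans (term≤subsetΣ n (h ∘ (true ∷_)) S) (p≤p+q (0≤subsetΣ n (h ∘ (false ∷_))))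
term≤subsetΣ (suc n) h (false ∷ S) = ≤-trans (term≤subsetΣ n (h ∘ (false ∷_)) S) (p≤q+p (0≤subsetΣ n (h ∘ (true ∷_))))

𝔼-subsetΣ : ∀ n m (f : Vec Bool m → Coins n → ℚ) →
            𝔼 n (λ ω → subsetΣ m (λ S → f S ω)) ≡ subsetΣ m (λ S → 𝔼 n (f S))
𝔼-subsetΣ n zero    f = refl
𝔼-subsetΣ n (suc m) f = trans (𝔼-+ n _ _) (cong₂ _+_ (𝔼-subsetΣ n m (f ∘ (true ∷_))) (𝔼-subsetΣ n m (f ∘ (false ∷_))))

-- The power is replaced by 0 at exponent 0: the empty side would contribute 1 to the total weight,
-- which has to be small, and a trivial cut separates nothing that needs control.
positivePower : ℚ → ℕ → ℚ
positivePower x zero    = 0ℚ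
positivePower x (suc k) = x ^ suc k

0≤positivePower : ∀ {x} → 0ℚ ≤ x → ∀ k → 0ℚ ≤ positivePower x k
0≤positivePower 0≤x zero    = ≤-refl
0≤positivePower 0≤x (suc k) = 0≤^ 0≤x (suc k)

module _ (x : ℚ) where
  binomial : ∀ n b → subsetΣ n (λ S → x ^ size b S) ≡ (1ℚ + x) ^ n
  binomial zero    b = refl
  binomial (suc n) true = trans
    (cong₂ _+_ (trans (subsetΣ-* n x (λ S → x ^ size true S)) (cong (x *_) (binomial n true))) (binomial n true))
    (solve 2 (λ x y → x :* y :+ y := (con 1ℚ :+ x) :* y) refl x ((1ℚ + x) ^ n))
  binomial (suc n) false = trans
    (cong₂ _+_ (binomial n false) (trans (subsetΣ-* n x (λ S → x ^ size false S)) (cong (x *_) (binomial n false))))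
    (solve 2 (λ x y → y :+ x :* y := (con 1ℚ :+ x) :* y) refl x ((1ℚ + x) ^ n))

  -- In the induction the subsets that contain the new vertex are all nonempty, so their part is a
  -- full binomial sum; only the other part needs the hypothesis.
  nonemptySubsets : ∀ n b → subsetΣ n (λ S → positivePower x (size b S)) + 1ℚ ≡ (1ℚ + x) ^ n
  nonemptySubsets zero    b = refl
  nonemptySubsets (suc n) true = trans
    (+-assoc (subsetΣ n (λ S → x * x ^ size true S)) (subsetΣ n (λ S → positivePower x (size true S))) 1ℚ)
    (trans (cong (λ z → subsetΣ n (λ S → x * x ^ size true S) + z) (trans (nonemptySubsets n true) (sym (binomial n true))))
      (binomial (suc n) true))
  nonemptySubsets (suc n) false = trans
    (solve 3 (λ a b c → a :+ b :+ c := (a :+ c) :+ b) refl (subsetΣ n (λ S → positivePower x (size false S))) (subsetΣ n (λ S → x * x ^ size false S)) 1ℚ)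
    (trans (cong (_+ subsetΣ n (λ S → x * x ^ size false S)) (trans (nonemptySubsets n false) (sym (binomial n false))))
      (binomial (suc n) false))

  -- With y = nx, `^-upper` gives (1+x)^n (1-y) ≤ 1, hence P (1-y) ≤ y, and 1-y is at least ½.
  nonemptySubsets-≤ : ∀ n b → 0ℚ ≤ x → x ≤ 1ℚ → ι n * x ≤ ½ →
                      subsetΣ n (λ S → positivePower x (size b S)) ≤ 2ℚ * (ι n * x)
  nonemptySubsets-≤ n b 0≤x x≤1 nx≤½ = *-cancel-≤ ½ (positive⁻¹ ½) (begin
    P * ½               ≤⟨ *-monoˡ-≤-nonNeg P {{nonNegative 0≤P}} (+-monoʳ-≤ 1ℚ (neg-antimono-≤ nx≤½)) ⟩
    P * (1ℚ - y)        ≡⟨ solve 2 (λ P y → P :* (con 1ℚ :- y) := (P :+ con 1ℚ) :* (con 1ℚ :+ :- y) :- (con 1ℚ :- y)) refl P y ⟩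
    (P + 1ℚ) * (1ℚ + - y) - (1ℚ - y) ≤⟨ +-monoˡ-≤ (- (1ℚ - y)) upper ⟩
    1ℚ - (1ℚ - y)       ≡⟨ solve 1 (λ y → con 1ℚ :- (con 1ℚ :- y) := con 2ℚ :* y :* con ½) refl y ⟩
    2ℚ * y * ½          ∎)
    where
    open ≤-Reasoning
    P = subsetΣ n (λ S → positivePower x (size b S))
    y = ι n * x
    0≤P : 0ℚ ≤ P
    0≤P = 0≤subsetΣ n (λ S → 0≤positivePower 0≤x (size b S))
    upper : (P + 1ℚ) * (1ℚ + - y) ≤ 1ℚ
    upper = subst₂ (λ a b → a * (1ℚ + b) ≤ 1ℚ) (sym (nonemptySubsets n b)) (sym (neg-distribʳ-* (ι n) x))
      (^-upper x (0≤+ 0≤1ℚ 0≤x) (0≤-neg x≤1) n)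

  -- A sum over both sides bounds the power for the smaller side from below without a minimum, and
  -- each summand has a closed total.
  weight : ∀ {n} → Vec Bool n → ℚ
  weight S = positivePower x (size true S) + positivePower x (size false S)

  -- The two tilts detect a surplus and a shortage of edges across `S` respectively.
  excess : ∀ {n} → ℚ → ℚ → Coins n → ℚ
  excess {n} p q ω = subsetΣ n (λ S → weight S * (likelihood p q S ω + likelihood q p S ω))

  -- The constant 8 is 2 tilts times 2 sides times the 2 of `nonemptySubsets-≤`.
  𝔼-excess : ∀ n p q → ½ * p + ½ * q ≡ 1ℚ → 0ℚ ≤ x → x ≤ 1ℚ → ι n * x ≤ ½ → 𝔼 n (excess p q) ≤ ι 8 * (ι n * x)
  𝔼-excess n p q mean 0≤x x≤1 nx≤½ = begin
    𝔼 n (excess p q)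
      ≡⟨ 𝔼-subsetΣ n n _ ⟩
    subsetΣ n (λ S → 𝔼 n (λ ω → weight S * (likelihood p q S ω + likelihood q p S ω)))
      ≡⟨ subsetΣ-cong n (λ S → trans (𝔼-* n (weight S) _) (trans (cong (weight S *_) (trans (𝔼-+ n _ _)
           (cong₂ _+_ (𝔼-likelihood p q mean n S) (𝔼-likelihood q p (trans (+-comm (½ * q) (½ * p)) mean) n S)))) (*-comm (weight S) 2ℚ))) ⟩
    subsetΣ n (λ S → 2ℚ * weight S)
      ≡⟨ trans (subsetΣ-* n 2ℚ weight) (cong (2ℚ *_) (subsetΣ-+ n _ _)) ⟩
    2ℚ * (subsetΣ n (λ S → positivePower x (size true S)) + subsetΣ n (λ S → positivePower x (size false S)))
      ≤⟨ *-monoˡ-≤-nonNeg 2ℚ (+-mono-≤ (nonemptySubsets-≤ n true 0≤x x≤1 nx≤½) (nonemptySubsets-≤ n false 0≤x x≤1 nx≤½)) ⟩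
    2ℚ * (2ℚ * y + 2ℚ * y)
      ≡⟨ solve 1 (λ y → con 2ℚ :* (con 2ℚ :* y :+ con 2ℚ :* y) := con (ι 8) :* y) refl y ⟩
    ι 8 * y ∎
    where
    open ≤-Reasoning
    y = ι n * x

-- A deviating cut makes its weighted likelihood ratio exceed 1.

^-mono-exponent : ∀ {u} → 1ℚ ≤ u → ∀ {m n} → m ℕ.≤ n → u ^ m ≤ u ^ n
^-mono-exponent {u} 1≤u {m} {n} m≤n = begin
  u ^ m                   ≡⟨ *-identityʳ (u ^ m) ⟨
  u ^ m * 1ℚ              ≤⟨ *-monoˡ-≤-nonNeg (u ^ m) {{nonNegative (0≤^ 0≤u m)}} (subst (_≤ u ^ (n ∸ m)) (1^ (n ∸ m)) (^-mono 0≤1ℚ 1≤u (n ∸ m))) ⟩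
  u ^ m * u ^ (n ∸ m)     ≡⟨ trans (cong (u ^_) (sym (ℕP.m+[n∸m]≡n m≤n))) (^-homo-* u m (n ∸ m)) ⟨
  u ^ n                   ∎
  where
  open ≤-Reasoning
  0≤u = ≤-trans 0≤1ℚ 1≤u

^-anti-exponent : ∀ {u} → 0ℚ ≤ u → u ≤ 1ℚ → ∀ {m n} → m ℕ.≤ n → u ^ n ≤ u ^ m
^-anti-exponent {u} 0≤u u≤1 {m} {n} m≤n = begin
  u ^ n                   ≡⟨ trans (cong (u ^_) (sym (ℕP.m+[n∸m]≡n m≤n))) (^-homo-* u m (n ∸ m)) ⟩
  u ^ m * u ^ (n ∸ m)     ≤⟨ *-monoˡ-≤-nonNeg (u ^ m) {{nonNegative (0≤^ 0≤u m)}} (^≤1 0≤u u≤1 (n ∸ m)) ⟩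
  u ^ m * 1ℚ              ≡⟨ *-identityʳ (u ^ m) ⟩
  u ^ m                   ∎
  where open ≤-Reasoning

0≤½ : 0ℚ ≤ ½
0≤½ = <⇒≤ (positive⁻¹ ½)

½≤1 : ½ ≤ 1ℚ
½≤1 = ≤-by 0≤½ refl

½^*2^ : ∀ k → ½ ^ k * 2ℚ ^ k ≡ 1ℚ
½^*2^ k = trans (sym (^-distrib-* ½ 2ℚ k)) (1^ k)

-- The N-th power of the left-hand side of the conclusion is at least 2, where N = 2τ².
tail : ∀ {p q} τ κ a b → 0ℚ ≤ p → 0ℚ ≤ q → 2ℚ ≤ p ^ (τ ℕ.+ τ) → ½ ≤ (p * q) ^ ((τ ℕ.+ τ) ℕ.* τ) →
       κ ℕ.* ((τ ℕ.+ τ) ℕ.* τ) ℕ.≤ a ℕ.+ b → τ ℕ.* b ℕ.+ ((a ℕ.+ b) ℕ.+ (a ℕ.+ b)) ℕ.< τ ℕ.* a →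
       1ℚ < ½ ^ κ * (p ^ a * q ^ b)
tail {p} {q} τ κ a b 0≤p 0≤q p≥ pq≥ κ≤ dev = ≰⇒> λ U≤1 → <-irrefl refl (<-≤-trans 1<2 (≤-trans big (^≤1 0≤U U≤1 N)))
  where
  open ≤-Reasoning
  1<2 : 1ℚ < 2ℚ
  1<2 = +-monoʳ-< 1ℚ (positive⁻¹ 1ℚ)
  N = (τ ℕ.+ τ) ℕ.* τ
  K = a ℕ.+ b
  d = a ∸ b
  U = ½ ^ κ * (p ^ a * q ^ b)
  0≤U : 0ℚ ≤ U
  0≤U = 0≤* (0≤^ 0≤½ κ) (0≤* (0≤^ 0≤p a) (0≤^ 0≤q b))
  b≤a : b ℕ.≤ a
  b≤a with ℕP.≤-total b a
  ... | inj₁ b≤a = b≤a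
  ... | inj₂ a≤b = contradiction (ℕP.≤-<-trans (ℕP.m≤m+n (τ ℕ.* b) (K ℕ.+ K)) dev) (ℕP.≤⇒≯ (ℕP.*-monoʳ-≤ τ a≤b))
  -- Strictness of the deviation supplies the extra 1 in the exponent, which becomes the final
  -- factor 2.
  2K<τd : suc (K ℕ.+ K) ℕ.≤ τ ℕ.* d
  2K<τd = ℕP.+-cancelˡ-< (τ ℕ.* b) (K ℕ.+ K) (τ ℕ.* d) (subst (τ ℕ.* b ℕ.+ (K ℕ.+ K) ℕ.<_)
    (trans (cong (τ ℕ.*_) (sym (ℕP.m+[n∸m]≡n b≤a))) (ℕP.*-distribˡ-+ τ b d)) dev)
  split : p ^ a * q ^ b ≡ (p * q) ^ b * p ^ d
  split = trans (cong (_* q ^ b) (trans (cong (p ^_) (sym (ℕP.m+[n∸m]≡n b≤a))) (^-homo-* p b d)))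
    (trans (solve 3 (λ x y z → x :* y :* z := x :* z :* y) refl (p ^ b) (p ^ d) (q ^ b))
      (cong (_* p ^ d) (sym (^-distrib-* p q b))))
  swap-exponents : ∀ u m n → (u ^ m) ^ n ≡ (u ^ n) ^ m
  swap-exponents u m n = trans (^-assocʳ u m n) (trans (cong (u ^_) (ℕP.*-comm m n)) (sym (^-assocʳ u n m)))
  -- N = 2τ · τ lets p^(dN) be regrouped as (p^(2τ))^(τd), to which the growth hypothesis on `p`
  -- applies.
  expand : U ^ N ≡ ½ ^ (κ ℕ.* N) * (((p * q) ^ N) ^ b * (p ^ (τ ℕ.+ τ)) ^ (τ ℕ.* d))
  expand = begin-equality
    U ^ N ≡⟨ trans (cong (λ z → (½ ^ κ * z) ^ N) split) (trans (^-distrib-* (½ ^ κ) _ N) (cong ((½ ^ κ) ^ N *_) (^-distrib-* ((p * q) ^ b) (p ^ d) N))) ⟩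
    (½ ^ κ) ^ N * (((p * q) ^ b) ^ N * (p ^ d) ^ N)
      ≡⟨ cong₂ _*_ (^-assocʳ ½ κ N) (cong₂ _*_ (swap-exponents (p * q) b N)
           (trans (swap-exponents p d N) (trans (cong (_^ d) (sym (^-assocʳ p (τ ℕ.+ τ) τ))) (^-assocʳ (p ^ (τ ℕ.+ τ)) τ d)))) ⟩
    ½ ^ (κ ℕ.* N) * (((p * q) ^ N) ^ b * (p ^ (τ ℕ.+ τ)) ^ (τ ℕ.* d)) ∎
  -- The three factors of `expand` are at least 2^(-K), 2^(-K) and 2^(2K+1).
  big : 2ℚ ≤ U ^ N
  big = begin
    2ℚ
      ≡⟨ cong (2ℚ *_) (cong₂ _*_ (½^*2^ K) (½^*2^ K)) ⟨
    2ℚ * ((½ ^ K * 2ℚ ^ K) * (½ ^ K * 2ℚ ^ K))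
      ≡⟨ solve 2 (λ h t → con 2ℚ :* ((h :* t) :* (h :* t)) := h :* (h :* (con 2ℚ :* (t :* t)))) refl (½ ^ K) (2ℚ ^ K) ⟩
    ½ ^ K * (½ ^ K * (2ℚ * (2ℚ ^ K * 2ℚ ^ K)))
      ≡⟨ cong (λ z → ½ ^ K * (½ ^ K * (2ℚ * z))) (^-homo-* 2ℚ K K) ⟨
    ½ ^ K * (½ ^ K * 2ℚ ^ suc (K ℕ.+ K))
      ≤⟨ *-mono-≤ (0≤^ 0≤½ (κ ℕ.* N)) (0≤* (0≤^ 0≤½ K) (0≤^ (0≤ι 2) (suc (K ℕ.+ K))))
           (^-anti-exponent 0≤½ ½≤1 κ≤)
           (*-mono-≤ (0≤^ (≤-trans 0≤½ pq≥) b) (0≤^ (0≤ι 2) (suc (K ℕ.+ K)))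
             (≤-trans (^-anti-exponent 0≤½ ½≤1 (ℕP.m≤n+m b a)) (^-mono 0≤½ pq≥ b))
             (≤-trans (^-mono-exponent (<⇒≤ 1<2) 2K<τd) (^-mono (0≤ι 2) p≥ (τ ℕ.* d)))) ⟩
    ½ ^ (κ ℕ.* N) * (((p * q) ^ N) ^ b * (p ^ (τ ℕ.+ τ)) ^ (τ ℕ.* d))
      ≡⟨ expand ⟨
    U ^ N ∎

-- Concentration of all cuts on one event.

-- This is |a - b| ≤ (2/τ)(a + b), cleared of division and subtraction.
Balanced : ∀ {n} → ℕ → Coins n → Set
Balanced {n} τ ω = ∀ (S : Vec Bool n) → let a = cutCount true S ω; b = cutCount false S ω in
  τ ℕ.* a ℕ.≤ τ ℕ.* b ℕ.+ ((a ℕ.+ b) ℕ.+ (a ℕ.+ b)) × τ ℕ.* b ℕ.≤ τ ℕ.* a ℕ.+ ((a ℕ.+ b) ℕ.+ (a ℕ.+ b))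

half-inv : ∀ k → ι (suc k) * 1/1+ (k ℕ.+ suc k) ≡ ½
half-inv k = double-injective (trans (sym (*-distribʳ-+ (1/1+ (k ℕ.+ suc k)) (ι (suc k)) (ι (suc k))))
  (trans (cong (_* 1/1+ (k ℕ.+ suc k)) (sym (ι-+ (suc k) (suc k)))) (ι-inv (k ℕ.+ suc k))))

neg-is-scale : ∀ y → - y ≡ - 1ℚ * y
neg-is-scale = solve 1 (λ y → :- y := con (- 1ℚ) :* y) refl

-- Markov's inequality before taking expectations. The factor `- 1ℚ` in place of a negation lets
-- linearity (`𝔼-*`) act on it.
markov : ∀ X → 0ℚ ≤ X → 1ℚ + - 1ℚ * X ≤ (if isYes (X ≤? 1ℚ) then 1ℚ else 0ℚ)
markov X 0≤X with X ≤? 1ℚ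
... | yes _   = subst (λ z → 1ℚ + z ≤ 1ℚ) (neg-is-scale X) (+-monoʳ-≤ 1ℚ (neg-antimono-≤ 0≤X))
... | no  X≰1 = subst (λ z → 1ℚ + z ≤ 0ℚ) (neg-is-scale X) (+-monoʳ-≤ 1ℚ (neg-antimono-≤ (<⇒≤ (≰⇒> X≰1))))

atMostOne : ∀ X → T (isYes (X ≤? 1ℚ)) → X ≤ 1ℚ
atMostOne X ev with X ≤? 1ℚ
... | yes X≤1 = X≤1

module Concentration (s e : ℕ) where
  τ N : ℕ
  τ = suc s
  N = (τ ℕ.+ τ) ℕ.* τ

  t p q x : ℚ
  -- `suc (s + τ)` computes to `τ + τ`, so this is 1/(2τ).
  t = 1/1+ (s ℕ.+ τ)
  p = 1ℚ + t
  q = 1ℚ - t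
  x = ½ ^ e

  0≤p : 0ℚ ≤ p
  0≤p = 0≤+ 0≤1ℚ (0≤1/1+ (s ℕ.+ τ))

  0≤q : 0ℚ ≤ q
  0≤q = 0≤-neg (1/1+≤1 (s ℕ.+ τ))

  0≤x : 0ℚ ≤ x
  0≤x = 0≤^ 0≤½ e

  x≤1 : x ≤ 1ℚ
  x≤1 = ^≤1 0≤½ ½≤1 e

  mean : ½ * p + ½ * q ≡ 1ℚ
  mean = solve 1 (λ t → con ½ :* (con 1ℚ :+ t) :+ con ½ :* (con 1ℚ :- t) := con 1ℚ) refl t

  2τt : ι (τ ℕ.+ τ) * t ≡ 1ℚ
  2τt = ι-inv (s ℕ.+ τ)

  p-growth : 2ℚ ≤ p ^ (τ ℕ.+ τ)
  p-growth = subst (λ z → 1ℚ + z ≤ p ^ (τ ℕ.+ τ)) 2τt (bernoulli t 0≤p (τ ℕ.+ τ))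

  -- pq = 1 - t², and N = 2τ² is the exponent with N t² = ½, so Bernoulli's inequality gives exactly
  -- ½.
  pq-decay : ½ ≤ (p * q) ^ N
  pq-decay = subst₂ (λ a b → a ≤ b ^ N) eq (solve 1 (λ t → con 1ℚ :+ :- (t :* t) := (con 1ℚ :+ t) :* (con 1ℚ :- t)) refl t)
    (bernoulli (- (t * t)) (0≤-neg (*-mono-≤ 0≤1ℚ (0≤1/1+ (s ℕ.+ τ)) (1/1+≤1 (s ℕ.+ τ)) (1/1+≤1 (s ℕ.+ τ)))) N)
    where
    open ≡-Reasoning
    eq : 1ℚ + ι N * - (t * t) ≡ ½
    eq = begin
      1ℚ + ι N * - (t * t)                   ≡⟨ cong (λ z → 1ℚ + z * - (t * t)) (ι-* (τ ℕ.+ τ) τ) ⟩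
      1ℚ + ι (τ ℕ.+ τ) * ι τ * - (t * t)     ≡⟨ solve 3 (λ a b t → con 1ℚ :+ a :* b :* :- (t :* t) := con 1ℚ :- (a :* t) :* (b :* t)) refl (ι (τ ℕ.+ τ)) (ι τ) t ⟩
      1ℚ - (ι (τ ℕ.+ τ) * t) * (ι τ * t)     ≡⟨ cong₂ (λ a b → 1ℚ - a * b) 2τt (half-inv s) ⟩
      ½                                      ∎

  event : ∀ {n} → Coins n → Bool
  event ω = isYes (excess x p q ω ≤? 1ℚ)

  0≤weight : ∀ {n} (S : Vec Bool n) → 0ℚ ≤ weight x S
  0≤weight S = 0≤+ (0≤positivePower 0≤x (size true S)) (0≤positivePower 0≤x (size false S))

  0≤L : ∀ {n} (S : Vec Bool n) ω → 0ℚ ≤ likelihood p q S ω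
  0≤L = 0≤likelihood p q 0≤p 0≤q

  0≤L′ : ∀ {n} (S : Vec Bool n) ω → 0ℚ ≤ likelihood q p S ω
  0≤L′ = 0≤likelihood q p 0≤q 0≤p

  0≤terms : ∀ {n} (S : Vec Bool n) ω → 0ℚ ≤ weight x S * (likelihood p q S ω + likelihood q p S ω)
  0≤terms S ω = 0≤* (0≤weight S) (0≤+ (0≤L S ω) (0≤L′ S ω))

  Pr-event : ∀ n → ι n * x ≤ ½ → 1ℚ - ι 8 * (ι n * x) ≤ Pr {n} event
  Pr-event n nx≤½ = begin
    1ℚ - ι 8 * (ι n * x)                     ≤⟨ +-monoʳ-≤ 1ℚ (neg-antimono-≤ (𝔼-excess x n p q mean 0≤x x≤1 nx≤½)) ⟩
    1ℚ - 𝔼 n (excess x p q)                  ≡⟨ cong₂ _+_ (sym (𝔼-const n 1ℚ)) (trans (neg-is-scale (𝔼 n (excess x p q))) (sym (𝔼-* n (- 1ℚ) (excess x p q)))) ⟩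
    𝔼 n (λ _ → 1ℚ) + 𝔼 n (λ ω → - 1ℚ * excess x p q ω) ≡⟨ 𝔼-+ n (λ _ → 1ℚ) (λ ω → - 1ℚ * excess x p q ω) ⟨
    𝔼 n (λ ω → 1ℚ + - 1ℚ * excess x p q ω)   ≤⟨ 𝔼-mono n (λ ω → markov (excess x p q ω) (0≤subsetΣ n (λ S → 0≤terms S ω))) ⟩
    Pr {n} event                             ∎
    where
    open ≤-Reasoning
  module _ {n} (large : e ℕ.* N ℕ.+ e ℕ.* N ℕ.≤ n) where
    -- The larger side has at least n/2 ≥ eN vertices; this is the only place where n has to be
    -- large compared with τ² and e.
    smallerSide : ∀ k k′ → k ℕ.+ k′ ≡ n → k ℕ.≤ k′ → e ℕ.* k ℕ.* N ℕ.≤ k ℕ.* k′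
    smallerSide k k′ kk′ k≤k′ = begin
      e ℕ.* k ℕ.* N       ≡⟨ trans (cong (ℕ._* N) (ℕP.*-comm e k)) (ℕP.*-assoc k e N) ⟩
      k ℕ.* (e ℕ.* N)     ≤⟨ ℕP.*-monoʳ-≤ k (ℕP.≮⇒≥ λ k′<eN → ℕP.<⇒≱ (ℕP.+-mono-< (ℕP.≤-<-trans k≤k′ k′<eN) k′<eN) (subst (e ℕ.* N ℕ.+ e ℕ.* N ℕ.≤_) (sym kk′) large)) ⟩
      k ℕ.* k′            ∎
      where open ℕP.≤-Reasoning

    -- The witness is `e` times the size of the smaller side, so that ½^κ is `x` to that size and
    -- hence one summand of the weight.
    weight-lower : ∀ S → 0 ℕ.< size true S ℕ.* size false S →
                   ∃[ κ ] (κ ℕ.* N ℕ.≤ size true S ℕ.* size false S × ½ ^ κ ≤ weight x {n} S)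
    weight-lower S 0<K with size true S | size false S | sizes S | ℕP.≤-total (size true S) (size false S)
    ... | suc k | suc k′ | kk′ | inj₁ k≤k′ = e ℕ.* suc k , smallerSide (suc k) (suc k′) kk′ k≤k′ ,
          subst (_≤ x ^ suc k + x ^ suc k′) (^-assocʳ ½ e (suc k)) (p≤p+q (0≤^ 0≤x (suc k′)))
    ... | suc k | suc k′ | kk′ | inj₂ k′≤k = e ℕ.* suc k′ ,
          subst (e ℕ.* suc k′ ℕ.* N ℕ.≤_) (ℕP.*-comm (suc k′) (suc k)) (smallerSide (suc k′) (suc k) (trans (ℕP.+-comm (suc k′) (suc k)) kk′) k′≤k) ,
          subst (_≤ x ^ suc k + x ^ suc k′) (^-assocʳ ½ e (suc k′)) (p≤q+p (0≤^ 0≤x (suc k)))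
    ... | suc k | zero | kk′ | _ = contradiction (subst (0 ℕ.<_) (ℕP.*-zeroʳ k) 0<K) λ ()

    bounded-likelihoods : ∀ ω → excess x p q ω ≤ 1ℚ → ∀ S κ → ½ ^ κ ≤ weight x S →
                          ½ ^ κ * likelihood p q S ω ≤ 1ℚ × ½ ^ κ * likelihood q p S ω ≤ 1ℚ
    bounded-likelihoods ω E≤1 S κ w≥ =
      ≤-trans (*-mono-≤ (0≤weight S) (0≤L S ω) w≥ (p≤p+q (0≤L′ S ω))) term≤1 ,
      ≤-trans (*-mono-≤ (0≤weight S) (0≤L′ S ω) w≥ (p≤q+p (0≤L S ω))) term≤1
      where
      term≤1 = ≤-trans (term≤subsetΣ n (λ S → 0≤terms S ω) S) E≤1

    event⇒balanced : ∀ (ω : Coins n) → T (event ω) → Balanced τ ω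
    event⇒balanced ω ev S = ℕP.≮⇒≥ (λ dev → tooBig₁ dev (weight-lower S (0<K a (τ ℕ.* b) dev (ℕP.m≤m+n a b)))) ,
                            ℕP.≮⇒≥ (λ dev → tooBig₂ dev (weight-lower S (0<K b (τ ℕ.* a) dev (ℕP.m≤n+m b a))))
      where
      E≤1 = atMostOne (excess x p q ω) ev
      a = cutCount true S ω
      b = cutCount false S ω
      K = (a ℕ.+ b) ℕ.+ (a ℕ.+ b)
      -- A strict deviation forces some separated pair, so both sides are nonempty and
      -- `weight-lower` applies.
      0<K : ∀ c d → d ℕ.+ K ℕ.< τ ℕ.* c → c ℕ.≤ a ℕ.+ b → 0 ℕ.< size true S ℕ.* size false S
      0<K zero    d dev c≤ = contradiction (subst (d ℕ.+ K ℕ.<_) (ℕP.*-zeroʳ τ) dev) λ ()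
      0<K (suc c) d dev c≤ = subst (0 ℕ.<_) (cutCount-total S ω) (ℕP.≤-trans (ℕ.s≤s ℕ.z≤n) c≤)
      tooBig₁ : τ ℕ.* b ℕ.+ K ℕ.< τ ℕ.* a → ¬ (∃[ κ ] (κ ℕ.* N ℕ.≤ size true S ℕ.* size false S × ½ ^ κ ≤ weight x S))
      tooBig₁ dev (κ , κ≤ , w≥) = <-irrefl refl (<-≤-trans
        (tail τ κ a b 0≤p 0≤q p-growth pq-decay (subst (κ ℕ.* N ℕ.≤_) (sym (cutCount-total S ω)) κ≤) dev)
        (subst (λ z → ½ ^ κ * z ≤ 1ℚ) (likelihood-count p q S ω) (proj₁ (bounded-likelihoods ω E≤1 S κ w≥))))
      -- A shortage of edges is a surplus of non-edges: `tail` is applied with the two counts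
      -- exchanged, and the other tilt gives q^a p^b.
      tooBig₂ : τ ℕ.* a ℕ.+ K ℕ.< τ ℕ.* b → ¬ (∃[ κ ] (κ ℕ.* N ℕ.≤ size true S ℕ.* size false S × ½ ^ κ ≤ weight x S))
      tooBig₂ dev (κ , κ≤ , w≥) = <-irrefl refl (<-≤-trans
        (tail τ κ b a 0≤p 0≤q p-growth pq-decay
          (subst (κ ℕ.* N ℕ.≤_) (trans (sym (cutCount-total S ω)) (ℕP.+-comm a b)) κ≤)
          (subst (λ z → τ ℕ.* a ℕ.+ (z ℕ.+ z) ℕ.< τ ℕ.* b) (ℕP.+-comm a b) dev))
        (subst (λ z → ½ ^ κ * z ≤ 1ℚ) (trans (likelihood-count q p S ω) (*-comm (q ^ a) (p ^ b))) (proj₂ (bounded-likelihoods ω E≤1 S κ w≥))))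

-- From balanced cuts to the ratio of two envies.

edgeWeight : ∀ {n} → (Bool → ℚ) → Coins n → Fin n → Fin n → ℚ
edgeWeight v ω i j = v (coinAdj ω i j)

envyℚ : ∀ {n} → Coins n → (Fin n → ℚ) → ℚ
envyℚ {n} ω h = pairΣ n (λ i j → 𝟙 (coinAdj ω i j) * ∣ h i - h j ∣)

0≤envyℚ : ∀ {n} (ω : Coins n) h → 0ℚ ≤ envyℚ ω h
0≤envyℚ {n} ω h = 0≤pairΣ n (λ i j → 0≤* (0≤𝟙 (coinAdj ω i j)) (0≤∣p∣ (h i - h j)))
  where
  0≤𝟙 : ∀ b → 0ℚ ≤ 𝟙 b
  0≤𝟙 true  = 0≤1ℚ
  0≤𝟙 false = ≤-refl

module _ {n} (ω : Coins n) (h : Fin n → ℚ) where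
  weighted-form : ∀ v → pairΣ n (λ i j → edgeWeight v ω i j * ∣ h i - h j ∣) ≡
                  (v true - v false) * envyℚ ω h + v false * spread n h
  weighted-form v = begin
    pairΣ n (λ i j → edgeWeight v ω i j * ∣ h i - h j ∣)
      ≡⟨ pairΣ-cong n (λ i j → cell (coinAdj ω i j) ∣ h i - h j ∣) ⟩
    pairΣ n (λ i j → (v true - v false) * (𝟙 (coinAdj ω i j) * ∣ h i - h j ∣) + v false * ∣ h i - h j ∣)
      ≡⟨ trans (pairΣ-+ n _ _) (cong₂ _+_ (pairΣ-* n (v true - v false) _) (pairΣ-* n (v false) _)) ⟩
    (v true - v false) * envyℚ ω h + v false * spread n h ∎
    where
    open ≡-Reasoning
    cell : ∀ b y → v b * y ≡ (v true - v false) * (𝟙 b * y) + v false * y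
    cell true  y = solve 3 (λ t f y → t :* y := (t :- f) :* (con 1ℚ :* y) :+ f :* y) refl (v true) (v false) y
    cell false y = solve 3 (λ t f y → f :* y := (t :- f) :* (con 0ℚ :* y) :+ f :* y) refl (v true) (v false) y

  -- A linear inequality between the two coin counts, valid on every cut, passes by the layer cake
  -- to one between envy and spread.
  form≥0 : ∀ v → (∀ S → 0ℚ ≤ v true * ι (cutCount true S ω) + v false * ι (cutCount false S ω)) →
           0ℚ ≤ (v true - v false) * envyℚ ω h + v false * spread n h
  form≥0 v cut≥0 = subst (0ℚ ≤_) (weighted-form v)
    (NonnegativeCuts.onℚ (edgeWeight v ω) (λ S → subst (0ℚ ≤_) (sym (cutForm-coins v S ω)) (cut≥0 S)) h)

  module _ τ (bal : Balanced τ ω) where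
    private
      T′ = ι τ

      ι-balanced : ∀ {a b} → τ ℕ.* a ℕ.≤ τ ℕ.* b ℕ.+ ((a ℕ.+ b) ℕ.+ (a ℕ.+ b)) →
                   0ℚ ≤ (T′ * ι b + ((ι a + ι b) + (ι a + ι b))) - T′ * ι a
      ι-balanced {a} {b} le = 0≤q-p (subst₂ _≤_ (ι-* τ a)
        (trans (ι-+ (τ ℕ.* b) _) (cong₂ _+_ (ι-* τ b) (trans (ι-+ (a ℕ.+ b) (a ℕ.+ b)) (cong₂ _+_ (ι-+ a b) (ι-+ a b)))))
        (ι-mono le))

    envy-lower : (T′ - 2ℚ) * spread n h ≤ 2ℚ * T′ * envyℚ ω h
    envy-lower = ≤-by (form≥0 v cut≥0)
      (solve 3 (λ T E F → con 2ℚ :* T :* E := (T :- con 2ℚ) :* F :+ (((con 2ℚ :+ T) :- (con 2ℚ :- T)) :* E :+ (con 2ℚ :- T) :* F)) refl T′ (envyℚ ω h) (spread n h))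
      where
      v : Bool → ℚ
      -- On a cut these weights give 2(a+b) + τ(a-b), whose nonnegativity is the second half of
      -- balance.
      v b = if b then 2ℚ + T′ else 2ℚ - T′
      cut≥0 : ∀ S → 0ℚ ≤ v true * ι (cutCount true S ω) + v false * ι (cutCount false S ω)
      cut≥0 S = subst (0ℚ ≤_)
        (solve 3 (λ T a b → (T :* a :+ ((b :+ a) :+ (b :+ a))) :- T :* b := (con 2ℚ :+ T) :* a :+ (con 2ℚ :- T) :* b) refl T′ (ι a) (ι b))
        (ι-balanced {b} {a} (subst (λ z → τ ℕ.* b ℕ.≤ τ ℕ.* a ℕ.+ (z ℕ.+ z)) (ℕP.+-comm a b) (proj₂ (bal S))))
        where
        a = cutCount true S ω
        b = cutCount false S ω

    envy-upper : 2ℚ * T′ * envyℚ ω h ≤ (T′ + 2ℚ) * spread n h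
    envy-upper = ≤-by (form≥0 v cut≥0)
      (solve 3 (λ T E F → (T :+ con 2ℚ) :* F := con 2ℚ :* T :* E :+ (((con 2ℚ :- T) :- (con 2ℚ :+ T)) :* E :+ (con 2ℚ :+ T) :* F)) refl T′ (envyℚ ω h) (spread n h))
      where
      v : Bool → ℚ
      -- The opposite signs give 2(a+b) - τ(a-b), the first half of balance.
      v b = if b then 2ℚ - T′ else 2ℚ + T′
      cut≥0 : ∀ S → 0ℚ ≤ v true * ι (cutCount true S ω) + v false * ι (cutCount false S ω)
      cut≥0 S = subst (0ℚ ≤_)
        (solve 3 (λ T a b → (T :* b :+ ((a :+ b) :+ (a :+ b))) :- T :* a := (con 2ℚ :- T) :* a :+ (con 2ℚ :+ T) :* b) refl T′ (ι a) (ι b))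
        (ι-balanced {a} {b} (proj₁ (bal S)))
        where
        a = cutCount true S ω
        b = cutCount false S ω

-- Both envies are compared with the same spread, which gives the ratio (τ+2)/(τ-2). The proof
-- clears denominators by `D`, so the envies may vanish.
envy-ratio : ∀ {n} (ω : Coins n) s → 3 ℕ.≤ s → Balanced (suc s) ω → ∀ h (π π′ : Permutation′ n) →
             envyℚ ω (h ∘ (π ⟨$⟩ʳ_)) ≤ (1ℚ + ι 8 * 1/1+ s) * envyℚ ω (h ∘ (π′ ⟨$⟩ʳ_))
envy-ratio {n} ω s 3≤s bal h π π′ = *-cancel-≤ D 0<D (begin
  E * D
    ≡⟨ solve 2 (λ E T → E :* (con 2ℚ :* T :* (T :- con 2ℚ)) := (T :- con 2ℚ) :* (con 2ℚ :* T :* E)) refl E T′ ⟩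
  (T′ - 2ℚ) * (2ℚ * T′ * E)
    ≤⟨ *-monoˡ-≤-nonNeg (T′ - 2ℚ) {{nonNegative 0≤T-2}} (subst (λ z → 2ℚ * T′ * E ≤ (T′ + 2ℚ) * z) (spread-permute n h π) (envy-upper ω (h ∘ (π ⟨$⟩ʳ_)) (suc s) bal)) ⟩
  (T′ - 2ℚ) * ((T′ + 2ℚ) * spread n h)
    ≡⟨ solve 2 (λ T F → (T :- con 2ℚ) :* ((T :+ con 2ℚ) :* F) := (T :+ con 2ℚ) :* ((T :- con 2ℚ) :* F)) refl T′ (spread n h) ⟩
  (T′ + 2ℚ) * ((T′ - 2ℚ) * spread n h)
    ≤⟨ *-monoˡ-≤-nonNeg (T′ + 2ℚ) {{nonNegative (0≤+ (0≤ι (suc s)) (0≤ι 2))}} (subst (λ z → (T′ - 2ℚ) * z ≤ 2ℚ * T′ * E′) (spread-permute n h π′) (envy-lower ω (h ∘ (π′ ⟨$⟩ʳ_)) (suc s) bal)) ⟩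
  (T′ + 2ℚ) * (2ℚ * T′ * E′)
    ≤⟨ *-monoʳ-≤-nonNeg (2ℚ * T′ * E′) {{nonNegative (0≤* (0≤* (0≤ι 2) (0≤ι (suc s))) (0≤envyℚ ω (h ∘ (π′ ⟨$⟩ʳ_))))}} step ⟩
  (1ℚ + ι 8 * r) * (T′ - 2ℚ) * (2ℚ * T′ * E′)
    ≡⟨ solve 3 (λ c T E → c :* (T :- con 2ℚ) :* (con 2ℚ :* T :* E) := c :* E :* (con 2ℚ :* T :* (T :- con 2ℚ))) refl (1ℚ + ι 8 * r) T′ E′ ⟩
  (1ℚ + ι 8 * r) * E′ * D ∎)
  where
  open ≤-Reasoning
  T′ = ι (suc s)
  r = 1/1+ s
  E = envyℚ ω (h ∘ (π ⟨$⟩ʳ_))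
  E′ = envyℚ ω (h ∘ (π′ ⟨$⟩ʳ_))
  D = 2ℚ * T′ * (T′ - 2ℚ)
  0≤T-4 : 0ℚ ≤ T′ - 4ℚ
  0≤T-4 = 0≤q-p (ι-mono {4} {suc s} (ℕ.s≤s 3≤s))
  0<T-2 : 0ℚ < T′ - 2ℚ
  0<T-2 = subst (0ℚ <_) (solve 1 (λ T → (T :- con 4ℚ) :+ con 2ℚ := T :- con 2ℚ) refl T′) (≤-<-trans 0≤T-4 (subst (_< T′ - 4ℚ + 2ℚ) (+-identityʳ (T′ - 4ℚ)) (+-monoʳ-< (T′ - 4ℚ) (positive⁻¹ 2ℚ))))
  0≤T-2 = <⇒≤ 0<T-2
  0<D : 0ℚ < D
  0<D = 0<* (0<* (positive⁻¹ 2ℚ) (0<ι s)) 0<T-2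
  -- (1 + 8/T)(T - 2) exceeds T + 2 by 4 - 16/T, which is nonnegative because T ≥ 4; this is the
  -- reason for 3 ≤ s.
  step : T′ + 2ℚ ≤ (1ℚ + ι 8 * r) * (T′ - 2ℚ)
  step = ≤-by (0≤* (0≤* (0≤ι 4) (0≤1/1+ s)) 0≤T-4)
    (trans (solve 2 (λ T r → (con 1ℚ :+ con (ι 8) :* r) :* (T :- con 2ℚ) := T :- con 2ℚ :+ con 4ℚ :* (T :* r) :+ con 4ℚ :* r :* (T :- con 4ℚ)) refl T′ r)
      (cong (_+ 4ℚ * r * (T′ - 4ℚ)) (trans (cong (λ z → T′ - 2ℚ + 4ℚ * z) (ι-inv s)) (solve 1 (λ T → T :- con 2ℚ :+ con 4ℚ :* con 1ℚ := T :+ con 2ℚ) refl T′))))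

-- Transfer to envies of real house values.

⊓-elim : ∀ (P : ℚ → Set) p q → P p → P q → P (p ⊓ q)
⊓-elim P p q Pp Pq with ⊓-sel p q
... | inj₁ e = subst P (sym e) Pp
... | inj₂ e = subst P (sym e) Pq

listΣ : ∀ {A : Set} → (A → ℚ) → List A → ℚ
listΣ f xs = foldr _+_ 0ℚ (map f xs)

module _ {A : Set} where
  listΣ-++ : ∀ (f : A → ℚ) xs ys → listΣ f (xs ++ ys) ≡ listΣ f xs + listΣ f ys
  listΣ-++ f []       ys = sym (+-identityˡ (listΣ f ys))
  listΣ-++ f (x ∷ xs) ys = trans (cong (λ z → f x + z) (listΣ-++ f xs ys)) (sym (+-assoc (f x) (listΣ f xs) (listΣ f ys)))

  listΣ-filter : ∀ {p} {P : Pred A p} (P? : Decidable P) (f : A → ℚ) xs →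
                 listΣ f (filter P? xs) ≡ listΣ (λ x → if does (P? x) then f x else 0ℚ) xs
  listΣ-filter P? f []       = refl
  listΣ-filter P? f (x ∷ xs) with does (P? x)
  ... | true  = cong (λ z → f x + z) (listΣ-filter P? f xs)
  ... | false = trans (listΣ-filter P? f xs) (sym (+-identityˡ _))

  listΣ-tabulate : ∀ {n} (f : A → ℚ) (g : Fin n → A) → listΣ f (List.tabulate g) ≡ sum (f ∘ g)
  listΣ-tabulate {zero}  f g = refl
  listΣ-tabulate {suc n} f g = cong (λ z → f (g zero) + z) (listΣ-tabulate f (g ∘ suc))

  seq-+ℝ : ∀ (f : A → ℝ) xs m → seq (foldr _+ℝ_ 0ℝ (map f xs)) m ≡ listΣ (λ x → seq (f x) m) xs
  seq-+ℝ f []       m = refl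
  seq-+ℝ f (x ∷ xs) m = cong (λ z → seq (f x) m + z) (seq-+ℝ f xs m)

  -- At each index the minimum is attained by some member, possibly a different one at different
  -- indices; a property shared by all members therefore passes to it.
  seq-⊓ℝ : ∀ {P : ℚ → Set} a (f : A → ℝ) m → P (seq a m) → (∀ x → P (seq (f x) m)) →
           ∀ xs → P (seq (foldr _⊓ℝ_ a (map f xs)) m)
  seq-⊓ℝ a f m pa pf [] = pa
  seq-⊓ℝ {P} a f m pa pf (x ∷ xs) = ⊓-elim P (seq (f x) m) (seq (foldr _⊓ℝ_ a (map f xs)) m) (pf x) (seq-⊓ℝ {P} a f m pa pf xs)

listΣ-allFin : ∀ n (f : Fin n → ℚ) → listΣ f (allFin n) ≡ sum f
listΣ-allFin n f = listΣ-tabulate f (λ i → i)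

listΣ-× : ∀ {A B : Set} (f : A × B → ℚ) xs ys → listΣ f (cartesianProduct xs ys) ≡ listΣ (λ x → listΣ (λ y → f (x , y)) ys) xs
listΣ-× f []       ys = refl
listΣ-× f (x ∷ xs) ys = trans (listΣ-++ f (map (x ,_) ys) (cartesianProduct xs ys))
  (cong₂ _+_ (cong (foldr _+_ 0ℚ) (sym (ListP.map-∘ ys))) (listΣ-× f xs ys))

-- The test on `suc i` and `suc j` computes to the test on `i` and `j`, so every later row is a row
-- of the smaller sum behind one zero entry.
sum-<≡pairΣ : ∀ n (φ : Fin n → Fin n → ℚ) →
              sum (λ i → sum (λ j → if does (i FinP.<? j) then φ i j else 0ℚ)) ≡ pairΣ n φ
sum-<≡pairΣ zero    φ = refl
sum-<≡pairΣ (suc n) φ = cong₂ _+_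
  (+-identityˡ (sum (λ j → φ zero (suc j))))
  (trans (sum-cong-≗ (λ i → +-identityˡ (sum (λ j → if does (i FinP.<? j) then φ (suc i) (suc j) else 0ℚ))))
    (sum-<≡pairΣ n (λ i j → φ (suc i) (suc j))))

seq-Envy : ∀ {n} (ω : Coins n) (h : Fin n → ℝ) π m →
           seq (Envy (randomGraph ω) h π) m ≡ envyℚ ω ((λ i → seq (h i) m) ∘ (π ⟨$⟩ʳ_))
seq-Envy {n} ω h π m = begin
  seq (Envy (randomGraph ω) h π) m
    ≡⟨ seq-+ℝ (λ (i , j) → ∣ h (π ⟨$⟩ʳ i) -ℝ h (π ⟨$⟩ʳ j) ∣ℝ) (edges (randomGraph ω)) m ⟩
  listΣ (λ (i , j) → φ i j) (edges (randomGraph ω))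
    ≡⟨ listΣ-filter (λ (i , j) → (i FinP.<? j) ×-dec T? (coinAdj ω i j)) (λ (i , j) → φ i j) (cartesianProduct (allFin n) (allFin n)) ⟩
  listΣ (λ (i , j) → χ i j) (cartesianProduct (allFin n) (allFin n))
    ≡⟨ trans (listΣ-× (λ (i , j) → χ i j) (allFin n) (allFin n)) (listΣ-allFin n (λ i → listΣ (χ i) (allFin n))) ⟩
  sum (λ i → listΣ (χ i) (allFin n))
    ≡⟨ sum-cong-≗ (λ i → trans (listΣ-allFin n (χ i)) (sum-cong-≗ (λ j → cell (does (i FinP.<? j)) (coinAdj ω i j) (φ i j)))) ⟩
  sum (λ i → sum (λ j → if does (i FinP.<? j) then 𝟙 (coinAdj ω i j) * φ i j else 0ℚ))
    ≡⟨ sum-<≡pairΣ n _ ⟩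
  envyℚ ω ((λ i → seq (h i) m) ∘ (π ⟨$⟩ʳ_)) ∎
  where
  open ≡-Reasoning
  φ χ : Fin n → Fin n → ℚ
  φ i j = ∣ seq (h (π ⟨$⟩ʳ i)) m - seq (h (π ⟨$⟩ʳ j)) m ∣
  χ i j = if does (i FinP.<? j) ∧ coinAdj ω i j then φ i j else 0ℚ
  cell : ∀ b c y → (if b ∧ c then y else 0ℚ) ≡ (if b then 𝟙 c * y else 0ℚ)
  cell false c     y = refl
  cell true  true  y = sym (*-identityˡ y)
  cell true  false y = sym (*-zeroˡ y)

-- `R` stands for the relative error of the theorem; all that is needed of it is that its terms
-- eventually reach 8/τ.
approximation : ∀ {n} (ω : Coins n) s → 3 ℕ.≤ s → Balanced (suc s) ω → ∀ (h : Fin n → ℝ) π (R : ℝ) N₀ →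
                (∀ m → N₀ ℕ.≤ m → ι 8 * 1/1+ s ≤ seq R m) →
                Envy (randomGraph ω) h π ≤ℝ (1ℝ +ℝ R) *ℝ minEnvy (randomGraph ω) h
approximation {n} ω s 3≤s bal h π R N₀ R≥ ε 0<ε = N₀ , λ m m≥ → begin
  seq (Envy G h π) m
    ≤⟨ seq-⊓ℝ {P = λ y → seq (Envy G h π) m ≤ (1ℚ + ι 8 * 1/1+ s) * y} (Envy G h Perm.id) (Envy G h) m (each m Perm.id) (each m) (allocations n) ⟩
  (1ℚ + ι 8 * 1/1+ s) * seq (minEnvy G h) m
    ≤⟨ *-monoʳ-≤-nonNeg (seq (minEnvy G h) m) {{nonNegative (seq-⊓ℝ {P = 0ℚ ≤_} (Envy G h Perm.id) (Envy G h) m (0≤ m Perm.id) (0≤ m) (allocations n))}} (+-monoʳ-≤ 1ℚ (R≥ m m≥)) ⟩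
  (1ℚ + seq R m) * seq (minEnvy G h) m
    ≤⟨ p≤p+q (<⇒≤ 0<ε) ⟩
  (1ℚ + seq R m) * seq (minEnvy G h) m + ε ∎
  where
  open ≤-Reasoning
  G = randomGraph ω
  each : ∀ m π′ → seq (Envy G h π) m ≤ (1ℚ + ι 8 * 1/1+ s) * seq (Envy G h π′) m
  each m π′ = subst₂ (λ a b → a ≤ (1ℚ + ι 8 * 1/1+ s) * b) (sym (seq-Envy ω h π m)) (sym (seq-Envy ω h π′ m))
    (envy-ratio ω s 3≤s bal (λ i → seq (h i) m) π π′)
  0≤ : ∀ m π′ → 0ℚ ≤ seq (Envy G h π′) m
  0≤ m π′ = subst (0ℚ ≤_) (sym (seq-Envy ω h π′ m)) (0≤envyℚ ω ((λ i → seq (h i) m) ∘ (π′ ⟨$⟩ʳ_)))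

-- Crude dyadic bounds for the logarithm, exponential and square root.

-- The number of steps 1/M of the Riemann sum lnℚ from 1 to 2^l, where M = suc m.
dyadicSteps : ℕ → ℕ → ℕ
dyadicSteps m zero    = 0
dyadicSteps m (suc l) = 2 ℕ.^ l ℕ.* suc m ℕ.+ dyadicSteps m l

dyadicSteps-end : ∀ m l → suc m ℕ.+ dyadicSteps m l ≡ 2 ℕ.^ l ℕ.* suc m
dyadicSteps-end m zero    = refl
dyadicSteps-end m (suc l) = begin
  suc m ℕ.+ (p ℕ.+ dyadicSteps m l)  ≡⟨ solveℕ 3 (λ a b c → a ⊕ (b ⊕ c) ⊜ b ⊕ (a ⊕ c)) refl (suc m) p (dyadicSteps m l) ⟩
  p ℕ.+ (suc m ℕ.+ dyadicSteps m l)  ≡⟨ cong (p ℕ.+_) (dyadicSteps-end m l) ⟩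
  p ℕ.+ p                            ≡⟨ solveℕ 2 (λ x y → x ⊗ y ⊕ x ⊗ y ⊜ conℕ 2 ⊗ x ⊗ y) refl (2 ℕ.^ l) (suc m) ⟩
  2 ℕ.* 2 ℕ.^ l ℕ.* suc m            ∎
  where
  open ≡-Reasoning
  p = 2 ℕ.^ l ℕ.* suc m

module Logarithm (m : ℕ) where
  f : ℕ → ℚ
  f j = 1/1+ (suc m ℕ.+ j)

  predecessor : ∀ l → ∃[ k ] suc k ≡ 2 ℕ.^ l ℕ.* suc m
  predecessor l = ℕ.pred (2 ℕ.^ l ℕ.* suc m) , ℕP.suc-pred (2 ℕ.^ l ℕ.* suc m) {{ℕP.m*n≢0 (2 ℕ.^ l) (suc m) {{ℕP.m^n≢0 2 l}}}}

  shift : ∀ l i → suc m ℕ.+ (i ℕ.+ dyadicSteps m l) ≡ i ℕ.+ 2 ℕ.^ l ℕ.* suc m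
  shift l i = trans (solveℕ 3 (λ a i s → a ⊕ (i ⊕ s) ⊜ i ⊕ (a ⊕ s)) refl (suc m) i (dyadicSteps m l)) (cong (i ℕ.+_) (dyadicSteps-end m l))

  -- The block from 2^l to 2^(l+1) has 2^l M terms, each at most 1/(2^l M), so it adds at most 1.
  dyadic-upper : ∀ l → ∑< (dyadicSteps m l) f ≤ ι l
  dyadic-upper zero    = ≤-refl
  dyadic-upper (suc l) with predecessor l
  ... | k , eq = begin
    ∑< (2 ℕ.^ l ℕ.* suc m ℕ.+ dyadicSteps m l) f
      ≤⟨ block-≤ f (1/1+ k) (dyadicSteps m l) (2 ℕ.^ l ℕ.* suc m) (λ i _ → 1/1+-anti (subst (k ℕ.≤_) (sym (shift l i))
           (ℕP.≤-trans (ℕP.≤-trans (ℕP.n≤1+n k) (ℕP.≤-reflexive eq)) (ℕP.m≤n+m (2 ℕ.^ l ℕ.* suc m) i)))) ⟩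
    ∑< (dyadicSteps m l) f + ι (2 ℕ.^ l ℕ.* suc m) * 1/1+ k
      ≡⟨ cong (λ z → ∑< (dyadicSteps m l) f + z) (trans (cong (λ z → ι z * 1/1+ k) (sym eq)) (ι-inv k)) ⟩
    ∑< (dyadicSteps m l) f + 1ℚ
      ≤⟨ +-monoˡ-≤ 1ℚ (dyadic-upper l) ⟩
    ι l + 1ℚ
      ≡⟨ trans (+-comm (ι l) 1ℚ) (sym (ι-suc l)) ⟩
    ι (suc l) ∎
    where open ≤-Reasoning

  -- The last and smallest term of the block is 1/(2^(l+1) M), so the block adds at least ½.
  dyadic-lower : ∀ l → ι l * ½ ≤ ∑< (dyadicSteps m l) f
  dyadic-lower zero    = ≤-reflexive (*-zeroˡ ½)
  dyadic-lower (suc l) with predecessor l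
  ... | k , eq = begin
    ι (suc l) * ½
      ≡⟨ trans (cong (_* ½) (ι-suc l)) (solve 1 (λ l → (con 1ℚ :+ l) :* con ½ := l :* con ½ :+ con ½) refl (ι l)) ⟩
    ι l * ½ + ½
      ≤⟨ +-monoˡ-≤ ½ (dyadic-lower l) ⟩
    ∑< (dyadicSteps m l) f + ½
      ≡⟨ cong (λ z → ∑< (dyadicSteps m l) f + z) (trans (sym (half-inv k)) (cong (λ z → ι z * 1/1+ (k ℕ.+ suc k)) eq)) ⟩
    ∑< (dyadicSteps m l) f + ι (2 ℕ.^ l ℕ.* suc m) * 1/1+ (k ℕ.+ suc k)
      ≤⟨ block-≥ f (1/1+ (k ℕ.+ suc k)) (dyadicSteps m l) (2 ℕ.^ l ℕ.* suc m) (λ i i< → 1/1+-anti (subst (ℕ._≤ k ℕ.+ suc k) (sym (shift l i))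
           (ℕP.+-mono-≤ (ℕP.≤-pred (subst (i ℕ.<_) (sym eq) i<)) (ℕP.≤-reflexive (sym eq))))) ⟩
    ∑< (2 ℕ.^ l ℕ.* suc m ℕ.+ dyadicSteps m l) f ∎
    where open ≤-Reasoning

  ∑<-mono : ∀ {a b} → a ℕ.≤ b → ∑< a f ≤ ∑< b f
  ∑<-mono {a} {b} a≤b = begin
    ∑< a f                     ≡⟨ trans (cong (λ z → ∑< a f + z) (*-zeroʳ (ι (b ∸ a)))) (+-identityʳ (∑< a f)) ⟨
    ∑< a f + ι (b ∸ a) * 0ℚ    ≤⟨ block-≥ f 0ℚ a (b ∸ a) (λ i _ → 0≤1/1+ (suc m ℕ.+ (i ℕ.+ a))) ⟩
    ∑< (b ∸ a ℕ.+ a) f         ≡⟨ cong (λ z → ∑< z f) (ℕP.m∸n+n≡m a≤b) ⟩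
    ∑< b f                     ∎
    where open ≤-Reasoning

  lnℚ-upper : ∀ l n → suc n ℕ.≤ 2 ℕ.^ l → lnℚ m (suc n) ≤ ι l
  lnℚ-upper l n n≤ = ≤-trans (∑<-mono (ℕP.+-cancelˡ-≤ (suc m) (n ℕ.* suc m) (dyadicSteps m l)
    (subst (suc n ℕ.* suc m ℕ.≤_) (sym (dyadicSteps-end m l)) (ℕP.*-monoˡ-≤ (suc m) n≤)))) (dyadic-upper l)

  lnℚ-lower : ∀ l n → 2 ℕ.^ l ℕ.≤ suc n → ι l * ½ ≤ lnℚ m (suc n)
  lnℚ-lower l n n≥ = ≤-trans (dyadic-lower l) (∑<-mono (ℕP.+-cancelˡ-≤ (suc m) (dyadicSteps m l) (n ℕ.* suc m)
    (subst (ℕ._≤ suc n ℕ.* suc m) (sym (dyadicSteps-end m l)) (ℕP.*-monoˡ-≤ (suc m) n≥))))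

-- With w = 1 - L/M, the product w (1 + 2L/M) is at least 1, and (1 + 2L/M)^M ≤ 4^(2L).
expℚ-lower : ∀ L m y → y ≤ ι L → (L ℕ.+ L) ℕ.+ (L ℕ.+ L) ℕ.≤ suc m →
             ½ ^ ((L ℕ.+ L) ℕ.+ (L ℕ.+ L)) ≤ expℚ m (- 1ℚ * y)
expℚ-lower L m y y≤ M≥ = begin
  ½ ^ (k ℕ.+ k)                          ≡⟨ *-identityʳ (½ ^ (k ℕ.+ k)) ⟨
  ½ ^ (k ℕ.+ k) * 1ℚ                     ≤⟨ *-monoˡ-≤-nonNeg (½ ^ (k ℕ.+ k)) {{nonNegative 0≤½^}} 1≤ ⟩
  ½ ^ (k ℕ.+ k) * (w ^ M * 4ℚ ^ k)       ≡⟨ solve 3 (λ h w f → h :* (w :* f) := w :* (h :* f)) refl (½ ^ (k ℕ.+ k)) (w ^ M) (4ℚ ^ k) ⟩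
  w ^ M * (½ ^ (k ℕ.+ k) * 4ℚ ^ k)       ≡⟨ cong (w ^ M *_) cancel ⟩
  w ^ M * 1ℚ                             ≡⟨ *-identityʳ (w ^ M) ⟩
  w ^ M                                  ≤⟨ ^-mono 0≤w w≤ M ⟩
  expℚ m (- 1ℚ * y)                      ∎
  where
  open ≤-Reasoning
  M = suc m
  k = L ℕ.+ L
  r = 1/1+ m
  b = ι L * r
  w = 1ℚ - b
  v = 1ℚ + ι k * r
  0≤½^ : 0ℚ ≤ ½ ^ (k ℕ.+ k)
  0≤½^ = 0≤^ 0≤½ (k ℕ.+ k)
  4b≤1 : (b + b) + (b + b) ≤ 1ℚ
  4b≤1 = subst (_≤ 1ℚ) (trans (cong (_* r) (trans (ι-+ k k) (cong₂ _+_ (ι-+ L L) (ι-+ L L))))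
    (solve 2 (λ l r → ((l :+ l) :+ (l :+ l)) :* r := (l :* r :+ l :* r) :+ (l :* r :+ l :* r)) refl (ι L) r)) (ιr≤1 (k ℕ.+ k) m M≥)
  0≤b : 0ℚ ≤ b
  0≤b = 0≤* (0≤ι L) (0≤1/1+ m)
  2b≤1 : b + b ≤ 1ℚ
  2b≤1 = ≤-trans (p≤p+q (0≤+ 0≤b 0≤b)) 4b≤1
  0≤w : 0ℚ ≤ w
  0≤w = 0≤q-p (≤-trans (p≤p+q {b} {b} 0≤b) 2b≤1)
  w≤ : w ≤ 1ℚ + - 1ℚ * y * r
  w≤ = +-monoʳ-≤ 1ℚ (subst (- b ≤_) (solve 2 (λ y r → :- (y :* r) := con (- 1ℚ) :* y :* r) refl y r)
    (neg-antimono-≤ (*-monoʳ-≤-nonNeg r {{nonNegative (0≤1/1+ m)}} y≤)))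
  wv : 1ℚ ≤ w * v
  wv = ≤-by (0≤* 0≤b (0≤q-p 2b≤1))
    (trans (cong (λ z → w * (1ℚ + z * r)) (ι-+ L L))
      (solve 2 (λ l r → (con 1ℚ :- l :* r) :* (con 1ℚ :+ (l :+ l) :* r) := con 1ℚ :+ (l :* r) :* (con 1ℚ :- (l :* r :+ l :* r))) refl (ι L) r))
  1≤ : 1ℚ ≤ w ^ M * 4ℚ ^ k
  1≤ = begin
    1ℚ                   ≡⟨ 1^ M ⟨
    1ℚ ^ M               ≤⟨ ^-mono 0≤1ℚ wv M ⟩
    (w * v) ^ M          ≡⟨ ^-distrib-* w v M ⟩
    w ^ M * v ^ M        ≤⟨ *-monoˡ-≤-nonNeg (w ^ M) {{nonNegative (0≤^ 0≤w M)}} (e^≤4^ k m) ⟩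
    w ^ M * 4ℚ ^ k       ∎
  cancel : ½ ^ (k ℕ.+ k) * 4ℚ ^ k ≡ 1ℚ
  cancel = trans (cong (_* 4ℚ ^ k) (trans (^-homo-* ½ k k) (sym (^-distrib-* ½ ½ k))))
    (trans (sym (^-distrib-* (½ * ½) 4ℚ k)) (1^ k))

ι-2^ : ∀ l → ι (2 ℕ.^ l) ≡ 2ℚ ^ l
ι-2^ zero    = refl
ι-2^ (suc l) = trans (ι-* 2 (2 ℕ.^ l)) (cong (2ℚ *_) (ι-2^ l))

-- Half of the exponent 8L absorbs the factor 8n ≤ 2^(3+L) ≤ 2^(4L). The half that remains matches
-- the lower bound 2^(-4L) that `expℚ-lower` provides for 1/n.
failure-≤ : ∀ L n → 1 ℕ.≤ L → n ℕ.≤ 2 ℕ.^ L → let k = (L ℕ.+ L) ℕ.+ (L ℕ.+ L) in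
            ι 8 * (ι n * ½ ^ (k ℕ.+ k)) ≤ ½ ^ k
failure-≤ L n 1≤L n≤ = begin
  ι 8 * (ι n * ½ ^ (k ℕ.+ k))          ≡⟨ *-assoc (ι 8) (ι n) (½ ^ (k ℕ.+ k)) ⟨
  ι 8 * ι n * ½ ^ (k ℕ.+ k)            ≤⟨ *-monoʳ-≤-nonNeg (½ ^ (k ℕ.+ k)) {{nonNegative (0≤^ 0≤½ (k ℕ.+ k))}} 8n≤ ⟩
  2ℚ ^ k * ½ ^ (k ℕ.+ k)               ≡⟨ cong (2ℚ ^ k *_) (^-homo-* ½ k k) ⟩
  2ℚ ^ k * (½ ^ k * ½ ^ k)             ≡⟨ solve 2 (λ t h → t :* (h :* h) := (h :* t) :* h) refl (2ℚ ^ k) (½ ^ k) ⟩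
  ½ ^ k * 2ℚ ^ k * ½ ^ k               ≡⟨ cong (_* ½ ^ k) (½^*2^ k) ⟩
  1ℚ * ½ ^ k                           ≡⟨ *-identityˡ (½ ^ k) ⟩
  ½ ^ k                                ∎
  where
  open ≤-Reasoning
  k = (L ℕ.+ L) ℕ.+ (L ℕ.+ L)
  8n≤ : ι 8 * ι n ≤ 2ℚ ^ k
  8n≤ = begin
    ι 8 * ι n                ≤⟨ *-monoˡ-≤-nonNeg (ι 8) (ι-mono n≤) ⟩
    ι 8 * ι (2 ℕ.^ L)        ≡⟨ cong (ι 8 *_) (ι-2^ L) ⟩
    2ℚ ^ 3 * 2ℚ ^ L          ≡⟨ ^-homo-* 2ℚ 3 L ⟨
    2ℚ ^ (3 ℕ.+ L)           ≤⟨ ^-mono-exponent (≤-by 0≤1ℚ refl) (subst (3 ℕ.+ L ℕ.≤_)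
                                  (solveℕ 1 (λ L → (L ⊕ (L ⊕ L)) ⊕ L ⊜ (L ⊕ L) ⊕ (L ⊕ L)) refl L)
                                  (ℕP.+-monoˡ-≤ L (ℕP.+-mono-≤ 1≤L (ℕP.+-mono-≤ 1≤L 1≤L)))) ⟩
    2ℚ ^ k                   ∎

-- Rounding loses at most 1/M, which is eventually at most half of the positive constant `a`.
√ℚ-eventually-≥ : ∀ {a} → 0ℚ < a → ∃[ N ] (∀ m → N ℕ.≤ m → ∀ {p} → a * a ≤ p → a * ½ ≤ √ℚ m p)
√ℚ-eventually-≥ {a} 0<a = let N , N≤ = arch (0<ε½ 0<a) in N , λ m m≥ {p} a²≤p → begin
    a * ½                    ≡⟨ solve 1 (λ a → a :* con ½ := a :- a :* con ½) refl a ⟩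
    a - a * ½                ≤⟨ +-mono-≤ (sq-cancel {a} (0≤+ (0≤√ℚ m p) (0≤1/1+ m)) (≤-trans a²≤p (≤-trans (p≤p⊔q p 0ℚ) (√ℚ-upper m p))))
                                 (neg-antimono-≤ (≤-trans (1/1+-anti m≥) N≤)) ⟩
    √ℚ m p + 1/1+ m - 1/1+ m ≡⟨ solve 2 (λ s i → s :+ i :- i := s) refl (√ℚ m p) (1/1+ m) ⟩
    √ℚ m p                   ∎
  where open ≤-Reasoning

-- Choice of the parameters.

log₂ : ∀ n → ∃[ l ] (2 ℕ.^ l ℕ.≤ suc n × suc n ℕ.< 2 ℕ.^ suc l)
log₂ zero = 0 , ℕP.≤-refl , ℕP.≤-refl
log₂ (suc n) with log₂ n
... | l , ≤n , n< with 2 ℕ.^ suc l ℕP.≤? suc (suc n)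
...   | yes ≤1+n = suc l , ≤1+n , ℕP.<-≤-trans (ℕ.s≤s n<)
          (subst (suc (2 ℕ.^ suc l) ℕ.≤_) (cong (2 ℕ.^ suc l ℕ.+_) (sym (ℕP.+-identityʳ (2 ℕ.^ suc l))))
            (ℕP.+-monoˡ-≤ (2 ℕ.^ suc l) (ℕP.m^n>0 2 (suc l))))
...   | no  ≰1+n = l , ℕP.m≤n⇒m≤1+n ≤n , ℕP.≰⇒> ≰1+n

lastTrue : ∀ {P : ℕ → Set} → Decidable P → ∀ a d → P a → ¬ P (d ℕ.+ a) → ∃[ s ] (a ℕ.≤ s × P s × ¬ P (suc s))
lastTrue P? a zero    pa ¬p = contradiction pa ¬p
lastTrue {P} P? a (suc d) pa ¬p with P? (suc a)
... | no  ¬pa′ = a , ℕP.≤-refl , pa , ¬pa′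
... | yes pa′  = let s , a<s , ps , ¬ps = lastTrue P? (suc a) d pa′ (subst (λ z → ¬ P z) (sym (ℕP.+-suc d a)) ¬p)
                 in s , ℕP.<⇒≤ a<s , ps , ¬ps

-- In terms of l = 14 + d this is 512 (l+1) ≤ 2^l; it makes the threshold 2^14 sufficient.
linear≤exponential : ∀ d → 512 ℕ.* (15 ℕ.+ d) ℕ.≤ 2 ℕ.^ (14 ℕ.+ d)
linear≤exponential zero    = ℕP.≤ᵇ⇒≤ (512 ℕ.* 15) (2 ℕ.^ 14) tt
linear≤exponential (suc d) = begin
  512 ℕ.* (15 ℕ.+ suc d)               ≡⟨ solveℕ 1 (λ d → conℕ 512 ⊗ (conℕ 15 ⊕ (conℕ 1 ⊕ d)) ⊜ conℕ 512 ⊗ (conℕ 15 ⊕ d) ⊕ conℕ 512) refl d ⟩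
  512 ℕ.* (15 ℕ.+ d) ℕ.+ 512           ≤⟨ ℕP.+-mono-≤ (linear≤exponential d) (ℕP.≤-trans (ℕP.m≤m*n 512 (15 ℕ.+ d)) (linear≤exponential d)) ⟩
  2 ℕ.^ (14 ℕ.+ d) ℕ.+ 2 ℕ.^ (14 ℕ.+ d)  ≡⟨ cong (2 ℕ.^ (14 ℕ.+ d) ℕ.+_) (ℕP.+-identityʳ (2 ℕ.^ (14 ℕ.+ d))) ⟨
  2 ℕ.^ suc (14 ℕ.+ d)                   ≡⟨ cong (2 ℕ.^_) (ℕP.+-suc 14 d) ⟨
  2 ℕ.^ (14 ℕ.+ suc d)                   ∎
  where open ℕP.≤-Reasoning

module Parameters (n l : ℕ) (large : 2 ℕ.^ 14 ℕ.≤ suc n) (l≤ : 2 ℕ.^ l ℕ.≤ suc n) (n< : suc n ℕ.< 2 ℕ.^ suc l) where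
  L k e : ℕ
  L = suc l
  k = (L ℕ.+ L) ℕ.+ (L ℕ.+ L)
  e = k ℕ.+ k

  -- Equal to 32 L τ², the number of vertices that concentration at scale τ requires.
  budget : ℕ → ℕ
  budget τ = e ℕ.* ((τ ℕ.+ τ) ℕ.* τ) ℕ.+ e ℕ.* ((τ ℕ.+ τ) ℕ.* τ)

  budget-mono : ∀ {σ τ} → σ ℕ.≤ τ → budget σ ℕ.≤ budget τ
  budget-mono σ≤τ = ℕP.+-mono-≤ le le
    where le = ℕP.*-monoʳ-≤ e (ℕP.*-mono-≤ (ℕP.+-mono-≤ σ≤τ σ≤τ) σ≤τ)

  14≤l : 14 ℕ.≤ l
  14≤l = ℕP.≮⇒≥ λ l<14 → ℕP.<⇒≱ n< (ℕP.≤-trans (ℕP.^-monoʳ-≤ 2 l<14) large)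

  budget-4 : budget 4 ℕ.≤ suc n
  budget-4 = begin
    budget 4          ≡⟨ solveℕ 1 (λ L → let k = (L ⊕ L) ⊕ (L ⊕ L); e = k ⊕ k in e ⊗ conℕ 32 ⊕ e ⊗ conℕ 32 ⊜ conℕ 512 ⊗ L) refl L ⟩
    512 ℕ.* L         ≤⟨ subst (λ z → 512 ℕ.* suc z ℕ.≤ 2 ℕ.^ z) (ℕP.m+[n∸m]≡n 14≤l) (linear≤exponential (l ∸ 14)) ⟩
    2 ℕ.^ l           ≤⟨ l≤ ⟩
    suc n             ∎
    where open ℕP.≤-Reasoning

  τ≤budget : ∀ τ → suc τ ℕ.≤ budget (suc τ)
  τ≤budget τ = ℕP.≤-trans (ℕP.m≤n*m (suc τ) (suc τ ℕ.+ suc τ)) (ℕP.≤-trans (ℕP.m≤n*m _ e) (ℕP.m≤m+n _ _))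

  -- The largest affordable τ is wanted. The search starts at τ = 4, as `envy-ratio` demands, and
  -- ends where τ alone exceeds the number of vertices.
  choice : ∃[ s ] (3 ℕ.≤ s × budget (suc s) ℕ.≤ suc n × ¬ budget (suc (suc s)) ℕ.≤ suc n)
  choice = lastTrue (λ s → budget (suc s) ℕP.≤? suc n) 3 (suc n) budget-4
    (λ le → ℕP.<⇒≱ (ℕP.≤-trans (ℕP.m≤m+n (suc (suc n)) 3) (τ≤budget (suc n ℕ.+ 3))) le)

  s : ℕ
  s = proj₁ choice
  3≤s : 3 ℕ.≤ s
  3≤s = proj₁ (proj₂ choice)

  budget-≤ : budget (suc s) ℕ.≤ suc n
  budget-≤ = proj₁ (proj₂ (proj₂ choice))

  -- Maximality of τ = s + 1: already τ + 1 ≤ 2τ is too expensive, and the budget at 2τ is 128 L τ².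
  n≤ : suc n ℕ.≤ 128 ℕ.* (L ℕ.* (suc s ℕ.* suc s))
  n≤ = begin
    suc n                        ≤⟨ ℕP.<⇒≤ (ℕP.≰⇒> (proj₂ (proj₂ (proj₂ choice)))) ⟩
    budget (suc (suc s))         ≤⟨ budget-mono (ℕ.s≤s (ℕP.m≤n+m (suc s) s)) ⟩
    budget (suc s ℕ.+ suc s)     ≡⟨ solveℕ 2 (λ L t → let k = (L ⊕ L) ⊕ (L ⊕ L); e = k ⊕ k; u = t ⊕ t; v = e ⊗ ((u ⊕ u) ⊗ u) in v ⊕ v ⊜ conℕ 128 ⊗ (L ⊗ (t ⊗ t))) refl L (suc s) ⟩
    128 ℕ.* (L ℕ.* (suc s ℕ.* suc s)) ∎
    where open ℕP.≤-Reasoning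

  a : ℚ
  -- This is 1/(32τ): n ≤ 128 L τ² and L ≤ 8 ln n give n ≤ 32² τ² ln n. The generous 8 makes the
  -- constant a perfect square, so its root is rational.
  a = 1/1+ s * 1/1+ 31

  0<a : 0ℚ < a
  0<a = 0<* (0<1/1+ s) (0<1/1+ 31)

  a²≤ : ∀ m → a * a ≤ lnℚ m (suc n) * 1/1+ n
  a²≤ m = *-cancel-≤ (ι (suc n) * (T′ * T′)) (0<* (0<ι n) (0<* (0<ι s) (0<ι s))) (begin
    a * a * (ι (suc n) * (T′ * T′))
      ≡⟨ solve 4 (λ r c n T → (r :* c) :* (r :* c) :* (n :* (T :* T)) := (c :* c) :* n :* ((T :* r) :* (T :* r))) refl (1/1+ s) (1/1+ 31) (ι (suc n)) T′ ⟩
    1/1+ 31 * 1/1+ 31 * ι (suc n) * ((T′ * 1/1+ s) * (T′ * 1/1+ s))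
      ≡⟨ trans (cong (λ z → 1/1+ 31 * 1/1+ 31 * ι (suc n) * (z * z)) (ι-inv s)) (*-identityʳ _) ⟩
    1/1+ 31 * 1/1+ 31 * ι (suc n)
      ≤⟨ *-monoˡ-≤-nonNeg (1/1+ 31 * 1/1+ 31) (≤-trans (ι-mono n≤) (≤-reflexive
           (trans (ι-* 128 (L ℕ.* (suc s ℕ.* suc s))) (cong (ι 128 *_) (trans (ι-* L (suc s ℕ.* suc s)) (cong (ι L *_) (ι-* (suc s) (suc s)))))))) ⟩
    1/1+ 31 * 1/1+ 31 * (ι 128 * (ι L * (T′ * T′)))
      ≤⟨ *-monoˡ-≤-nonNeg (1/1+ 31 * 1/1+ 31) (*-monoˡ-≤-nonNeg (ι 128) (*-monoʳ-≤-nonNeg (T′ * T′) {{nonNegative (0≤p² T′)}} L≤)) ⟩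
    1/1+ 31 * 1/1+ 31 * (ι 128 * (ι 8 * y * (T′ * T′)))
      ≡⟨ solve 2 (λ y T → con (1/1+ 31) :* con (1/1+ 31) :* (con (ι 128) :* (con (ι 8) :* y :* (T :* T))) := y :* (T :* T) :* con 1ℚ) refl y T′ ⟩
    y * (T′ * T′) * 1ℚ
      ≡⟨ cong (y * (T′ * T′) *_) (ι-inv n) ⟨
    y * (T′ * T′) * (ι (suc n) * 1/1+ n)
      ≡⟨ solve 4 (λ y T n r → y :* (T :* T) :* (n :* r) := y :* r :* (n :* (T :* T))) refl y T′ (ι (suc n)) (1/1+ n) ⟩
    y * 1/1+ n * (ι (suc n) * (T′ * T′)) ∎)
    where
    open ≤-Reasoning
    T′ = ι (suc s)
    y = lnℚ m (suc n)
    -- L = l + 1 ≤ 4l, and l/2 ≤ ln n by the dyadic lower bound.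
    L≤ : ι L ≤ ι 8 * y
    L≤ = begin
      ι L                ≤⟨ ι-mono (ℕP.≤-trans (ℕP.+-monoˡ-≤ l (ℕP.≤-trans (ℕ.s≤s ℕ.z≤n) 14≤l)) (ℕP.+-monoʳ-≤ l (ℕP.m≤m+n l (2 ℕ.* l)))) ⟩
      ι (4 ℕ.* l)        ≡⟨ ι-* 4 l ⟩
      ι 4 * ι l          ≡⟨ solve 1 (λ l → con (ι 4) :* l := con (ι 8) :* (l :* con ½)) refl (ι l) ⟩
      ι 8 * (ι l * ½)    ≤⟨ *-monoˡ-≤-nonNeg (ι 8) (Logarithm.lnℚ-lower m l n l≤) ⟩
      ι 8 * y            ∎

  open Concentration s e public using (event)

  -- The square root is eventually at least a/2 = 1/(64τ), so the factor 512 yields exactly 8/τ.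
  √-large : ∃[ N ] (∀ m → N ℕ.≤ m → ι 8 * 1/1+ s ≤ ι 512 * √ℚ m (lnℚ m (suc n) * 1/1+ n))
  √-large = let N , h = √ℚ-eventually-≥ 0<a in N , λ m m≥ → subst (_≤ ι 512 * √ℚ m (lnℚ m (suc n) * 1/1+ n))
    (solve 1 (λ r → con (ι 512) :* (r :* con (1/1+ 31) :* con ½) := con (ι 8) :* r) refl (1/1+ s))
    (*-monoˡ-≤-nonNeg (ι 512) (h m m≥ (a²≤ m)))

  failure : ι 8 * (ι (suc n) * ½ ^ e) ≤ ½ ^ k
  failure = failure-≤ L (suc n) (ℕ.s≤s ℕ.z≤n) (ℕP.<⇒≤ n<)

  probability : (1ℝ -ℝ suc n ^ℝ (-ℝ 1ℝ)) ≤ℝ fromℚ (Pr {suc n} event)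
  -- Both 1/n and the failure probability are compared with 2^(-k), where k = 4L; m ≥ k is the range
  -- in which `expℚ-lower` applies.
  probability ε 0<ε = k , λ m m≥ → begin
    1ℚ - expℚ m (- 1ℚ * lnℚ m (suc n))     ≤⟨ +-monoʳ-≤ 1ℚ (neg-antimono-≤ (expℚ-lower L m (lnℚ m (suc n)) (Logarithm.lnℚ-upper m L n (ℕP.<⇒≤ n<)) (ℕP.m≤n⇒m≤1+n m≥))) ⟩
    1ℚ - ½ ^ k                             ≤⟨ +-monoʳ-≤ 1ℚ (neg-antimono-≤ failure) ⟩
    1ℚ - ι 8 * (ι (suc n) * ½ ^ e)         ≤⟨ Concentration.Pr-event s e (suc n) (*-cancel-≤ (ι 8) (0<ι 7) (begin
                                                ι (suc n) * ½ ^ e * ι 8     ≡⟨ *-comm (ι (suc n) * ½ ^ e) (ι 8) ⟩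
                                                ι 8 * (ι (suc n) * ½ ^ e)   ≤⟨ failure ⟩
                                                ½ ^ k                       ≤⟨ ^≤1 0≤½ ½≤1 k ⟩
                                                1ℚ                          ≤⟨ ι-mono {1} {4} (ℕ.s≤s ℕ.z≤n) ⟩
                                                ½ * ι 8                     ∎)) ⟩
    Pr {suc n} event                       ≤⟨ p≤p+q (<⇒≤ 0<ε) ⟩
    Pr {suc n} event + ε                   ∎
    where open ≤-Reasoning

theorem3p7 : Σ[ C ∈ ℝ ] Σ[ c ∈ ℝ ] (0ℝ <ℝ C × 0ℝ <ℝ c × (Σ[ N ∈ ℕ ] (
    (n : ℕ) .{{_ : NonZero n}} → N ℕ.≤ n →
    WithProbability≥ (1ℝ -ℝ n ^ℝ (-ℝ c)) (λ (G : Graph n) →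
    (h : Fin n → ℝ) → (∀ i → 0ℝ ≤ℝ h i) → (π : Permutation′ n) →
    Envy G h π ≤ℝ (1ℝ +ℝ C *ℝ √ (ln n ÷ℕ n)) *ℝ minEnvy G h))))
-- C = 512 comes from `√-large`, c = 1 from `probability`, and 2^14 from `linear≤exponential`.
theorem3p7 = fromℚ (ι 512) , 1ℝ , positiveℝ 511 , positiveℝ 0 , 2 ℕ.^ 14 , bound
  where
  positiveℝ : ∀ k → 0ℝ <ℝ fromℚ (ι (suc k))
  positiveℝ k = 1ℚ , positive⁻¹ 1ℚ , 0 , λ _ _ → ι-mono {1} {suc k} (ℕ.s≤s ℕ.z≤n)
  bound : (n : ℕ) .{{_ : NonZero n}} → 2 ℕ.^ 14 ℕ.≤ n →
    WithProbability≥ (1ℝ -ℝ n ^ℝ (-ℝ 1ℝ)) (λ (G : Graph n) →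
    (h : Fin n → ℝ) → (∀ i → 0ℝ ≤ℝ h i) → (π : Permutation′ n) →
    Envy G h π ≤ℝ (1ℝ +ℝ fromℚ (ι 512) *ℝ √ (ln n ÷ℕ n)) *ℝ minEnvy G h)
  bound (suc n) large = event , good , probability
    where
    l-bounds = log₂ n
    open Parameters n (proj₁ l-bounds) large (proj₁ (proj₂ l-bounds)) (proj₂ (proj₂ l-bounds))
    good : ∀ ω → T (event ω) → (h : Fin (suc n) → ℝ) → (∀ i → 0ℝ ≤ℝ h i) → (π : Permutation′ (suc n)) →
      Envy (randomGraph ω) h π ≤ℝ (1ℝ +ℝ fromℚ (ι 512) *ℝ √ (ln (suc n) ÷ℕ suc n)) *ℝ minEnvy (randomGraph ω) h
    good ω ev h _ π = approximation ω s 3≤s (Concentration.event⇒balanced s e budget-≤ ω ev) h π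
      (fromℚ (ι 512) *ℝ √ (ln (suc n) ÷ℕ suc n)) (proj₁ √-large) (proj₂ √-large)
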